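{- In the turnstile model, for each $p \in [1, \sqrt{n}]$, there exists a randomized algorithm that computes a BFS tree (rooted at a given node) of any $n$-node connected simple undirected graph with probability $1-1/n^{\Omega(1)}$ in $p$ passes using $\tilde{O}((n/p)^2)$ space. In the insertion-only model, there exists a deterministic algorithm that computes such a BFS tree in $p$ passes using $\tilde{O}(n^2/p)$ space.
   Context: Streaming model: the edges of the input graph are presented as a stream, read sequentially in passes; space is in bits. Insertion-only model: stream of edge insertions. Turnstile model: stream of edge insertions and deletions; the input is the final graph. $\tilde{O}(k)$ denotes $O(k\cdot\mathrm{poly}\log n)$ (or $O(k/\mathrm{poly}\log n)$). -}

module Defs where

open import Data.Nat using (ℕ; zero; suc; _+_; _*_; _∸_; _^_; _≤_)
open import Data.Nat.Logarithm using (⌊log₂_⌋)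
open import Data.Bool using (Bool; true; false; _∧_; _∨_; if_then_else_)
open import Data.Fin using (Fin; _≟_)
open import Data.Integer as ℤ using (ℤ; 0ℤ; 1ℤ; -1ℤ)
open import Data.List using (List; []; _∷_; foldl; allFin; map; length)
open import Data.List.Relation.Unary.All using (All)
open import Data.List.Relation.Unary.Unique.Propositional using (Unique)
open import Data.Maybe using (Maybe; just; nothing)
open import Data.Product using (Σ; ∃; ∃-syntax; _×_; _,_)
open import Data.Sum using (_⊎_)
open import Data.Vec using (Vec)
open import Relation.Nullary using (¬_; does)
open import Relation.Binary.PropositionalEquality using (_≡_; _≢_)

data Upd (n : ℕ) : Set where
  ins : Fin n → Fin n → Upd n
  del : Fin n → Fin n → Upd n

samePair : ∀ {n} → Fin n → Fin n → Fin n → Fin n → Bool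
samePair a b u v = (does (a ≟ u) ∧ does (b ≟ v)) ∨ (does (a ≟ v) ∧ does (b ≟ u))

contrib : ∀ {n} → Upd n → Fin n → Fin n → ℤ
contrib (ins a b) u v = if samePair a b u v then 1ℤ else 0ℤ
contrib (del a b) u v = if samePair a b u v then -1ℤ else 0ℤ

mult : ∀ {n} → List (Upd n) → Fin n → Fin n → ℤ
mult []       u v = 0ℤ
mult (x ∷ xs) u v = contrib x u v ℤ.+ mult xs u v

SimpleFinal : ∀ {n} → List (Upd n) → Set
SimpleFinal {n} σ = (∀ (u : Fin n) → mult σ u u ≡ 0ℤ)
                  × (∀ (u v : Fin n) → mult σ u v ≡ 0ℤ ⊎ mult σ u v ≡ 1ℤ)

Adj : ∀ {n} → List (Upd n) → Fin n → Fin n → Set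
Adj σ u v = mult σ u v ≡ 1ℤ

insOnly : ∀ {n} → List (Fin n × Fin n) → List (Upd n)
insOnly = map (λ { (a , b) → ins a b })

data Walk {n : ℕ} (A : Fin n → Fin n → Set) : Fin n → Fin n → ℕ → Set where
  here : ∀ {u} → Walk A u u zero
  step : ∀ {u w v k} → A u w → Walk A w v k → Walk A u v (suc k)

Dist : ∀ {n} → (Fin n → Fin n → Set) → Fin n → Fin n → ℕ → Set
Dist A u v d = Walk A u v d × (∀ k → Walk A u v k → d ≤ k)

Connected : ∀ {n} → (Fin n → Fin n → Set) → Set
Connected {n} A = ∀ (u v : Fin n) → ∃[ d ] Walk A u v d

IsBFSTree : ∀ {n} → (Fin n → Fin n → Set) → Fin n → (Fin n → Maybe (Fin n)) → Set
IsBFSTree {n} A r par =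
  (par r ≡ nothing) ×
  (∀ (v : Fin n) → v ≢ r →
     ∃[ u ] (par v ≡ just u) × A u v × (∀ d → Dist A r u d → Dist A r v (suc d)))

record DetAlg (U : Set) (n p s : ℕ) : Set where
  field
    start   : Fin n → Vec Bool s
    process : Fin p → U → Vec Bool s → Vec Bool s
    endPass : Fin p → Vec Bool s → Vec Bool s
    output  : Vec Bool s → (Fin n → Maybe (Fin n))

module _ {U : Set} {n p s : ℕ} where
  runPasses : (Fin p → U → Vec Bool s → Vec Bool s) → (Fin p → Vec Bool s → Vec Bool s)
            → List U → Vec Bool s → Vec Bool s
  runPasses proc end σ st0 =
    foldl (λ st i → end i (foldl (λ st' x → proc i x st') st σ)) st0 (allFin p)

  runDet : DetAlg U n p s → Fin n → List U → Fin n → Maybe (Fin n)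
  runDet A r σ = output (runPasses process endPass σ (start r))
    where open DetAlg A

-- Randomized p-pass algorithm: a random seed of R bits determines the
-- initial memory; the seed is not otherwise available, so all randomness
-- that is used must be stored in the s bits of memory.
record RandAlg (U : Set) (n p s R : ℕ) : Set where
  field
    start   : Vec Bool R → Fin n → Vec Bool s
    process : Fin p → U → Vec Bool s → Vec Bool s
    endPass : Fin p → Vec Bool s → Vec Bool s
    output  : Vec Bool s → (Fin n → Maybe (Fin n))

runRand : ∀ {U n p s R} → RandAlg U n p s R → Vec Bool R → Fin n → List U → Fin n → Maybe (Fin n)
runRand {U} {n} {p} {s} A seed r σ = output (runPasses {U} {n} {p} {s} process endPass σ (start seed r))
  where open RandAlg A

-- Success probability: "with probability at least 1 - 1/n^(a/b)" over a
-- uniformly random seed in {0,1}^R means that there is a list of distinct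
-- good seeds whose complement has size f with f^b * n^a ≤ (2^R)^b.
SuccessProb : ∀ {R} → (Vec Bool R → Set) → ℕ → ℕ → ℕ → Set
SuccessProb {R} Good n a b =
  ∃[ good ] Unique good × All Good good
    × ((2 ^ R ∸ length good) ^ b * n ^ a ≤ (2 ^ R) ^ b)

-- polylog factor (log₂ n + 1)^k, avoiding log 0
polylog : ℕ → ℕ → ℕ
polylog n k = (suc ⌊log₂ n ⌋) ^ k

{-# OPTIONS --safe #-}
-- Both algorithms are run in a query model: in one pass the counters of a linear sketch
-- tell, for predicates fixed in advance, how many ordered adjacent pairs satisfy them.
-- Binary search with such queries finds, in O(log n) passes, the neighbour of least key of
-- every vertex, and also every element of a sparse set.
--
-- Start from trivial upper bounds on the distances to the root, with some weighted edges known.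
-- A round closes the estimates under the known edges off line and relaxes all edges once.
-- After m rounds all distances are exact if every vertex has a shortest path with at most
-- m edges that are not known.
--
-- Insertion-only: with m about p / log n, learn all edges at vertices of degree at most
-- d = 3n / (m + 1).  Only edges between vertices of degree above d remain, and since the
-- neighbours of a vertex lie in three consecutive layers, a shortest path has at most m of them.
--
-- Turnstile: with h about p / log n, sample about (n / h) log n sources so that every shortest
-- path longer than h meets one in its last h steps.  Grow BFS layers from all of them at
-- once, each with a random delay below h.  The layers of one source are disjoint, so the
-- expected total frontier at any time is about (n / h) ^ 2 log n, and an exponential moment
-- bound keeps it within a constant factor of that (up to logarithms) at all times.  The
-- distances among the sources are then known edges, and h rounds suffice.
--
-- If p is less than 10 log n, the space bounds allow storing the whole graph.
module Submission where

open import Defs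
open import Algebra.Bundles using (AbelianGroup)
open import Algebra.Properties.Group using (∙-cancelʳ)
open import Data.Bool using (Bool; true; false; T; if_then_else_; _∧_; _∨_)
open import Data.Bool.Properties using (T?)
open import Data.Empty using (⊥; ⊥-elim)
open import Data.Fin as Fin using (Fin; toℕ)
import Data.Fin.Properties as Fin
open import Data.Integer as ℤ using (0ℤ; 1ℤ; -1ℤ)
import Data.Integer.Properties as ℤ
import Data.Integer.Tactic.RingSolver as ℤ
open import Data.List using (List; []; _∷_; _++_; map; length; concat; filter; foldl; zipWith; tabulate; allFin)
open import Data.List.Membership.Propositional using (_∈_)
import Data.List.Membership.DecPropositional as DecMembership
open import Data.List.Membership.Propositional.Properties using (∈-filter⁺; ∈-filter⁻; ∈-map⁺; ∈-map⁻; ∈-++⁺ˡ; ∈-++⁺ʳ; ∈-++⁻; ∈-concat⁺′; ∈-concat⁻′)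
open import Data.List.Properties using (length-map; length-++; length-filter; map-∘; map-cong)
open import Data.List.Relation.Unary.All as All using (All; []; _∷_)
import Data.List.Relation.Unary.All.Properties as All
import Data.List.Relation.Unary.AllPairs as AllPairs
open import Data.List.Relation.Unary.Any using (here; there)
open import Data.List.Relation.Unary.Unique.Propositional using (Unique)
import Data.List.Relation.Unary.Unique.Propositional.Properties as Unique
open import Data.Maybe using (Maybe; just; nothing)
open import Data.Nat
open import Data.Nat.DivMod using (_/_; _%_; m≡m%n+[m/n]*n; m%n<n; m/n*n≤m; m≥n⇒m/n>0; m<n*o⇒m/o<n; m<n⇒m%n≡m; m%n%n≡m%n; [m+kn]%n≡m%n; %-distribˡ-+)
open import Data.Nat.Induction using (<-rec)
open import Data.Nat.Logarithm using (⌊log₂_⌋; ⌊log₂⌋-mono-≤; ⌊log₂⌊n/2⌋⌋≡⌊log₂n⌋∸1)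
open import Data.Nat.Properties
open import Data.Nat.Tactic.RingSolver using (solve-∀)
open import Data.Product using (Σ; ∃-syntax; _×_; _,_; proj₁; proj₂)
open import Data.Product.Properties using (≡-dec)
open import Data.Sum using (_⊎_; inj₁; inj₂)
open import Data.Unit using (⊤; tt)
open import Data.Vec as Vec using (Vec; []; _∷_)
import Data.Vec.Properties as Vec
open import Function using (_∘_; id; case_of_)
open import Relation.Binary.PropositionalEquality
open import Relation.Nullary using (¬_; Dec; yes; no; does)
open import Relation.Nullary.Decidable using (_×-dec_; _⊎-dec_; ¬?; dec-true; dec-false)

-- Memory is a bit string of fixed length, and an encoding is faithful only on data that fit.
-- Correctness and space therefore cannot be proved separately: the size bounds are part of the
-- invariant of every pass, and for the sampled searches they are established for good seeds. Within
-- a pass the queries cannot depend on its answers. A minimum over neighbours thus costs one pass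
-- per bit, which is why about `p / lg n` rounds are available. One BFS layer can contain almost all
-- vertices, so searches started together could peak together. With a delay drawn from `h` values, a
-- fixed vertex lies on the layer of a given time for at most one delay, so a source contributes at
-- most `n / h` on average. The moment bound treats one fixed time; a union bound covers all `2 * h`
-- times. Known edges are judged from the root: they must never undercut distances from `r`, and
-- need exactness only along shortest paths from `r`. This lets both algorithms share the relaxation
-- phase. Probability is counting of seeds, with all inequalities cleared of denominators. Vertices
-- and delays are drawn from ranges that are powers of two, hence the idle sources.

-- Indicators of decidable propositions

𝟙 : Bool → ℕ
𝟙 true  = 1
𝟙 false = 0

𝟙≤1 : ∀ b → 𝟙 b ≤ 1
𝟙≤1 true  = ≤-refl
𝟙≤1 false = z≤n

𝟙-yes : ∀ {P : Set} (d : Dec P) → P → 𝟙 (does d) ≡ 1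
𝟙-yes (yes _) _ = refl
𝟙-yes (no ¬p) p = ⊥-elim (¬p p)

𝟙-no : ∀ {P : Set} (d : Dec P) → ¬ P → 𝟙 (does d) ≡ 0
𝟙-no (yes p) ¬p = ⊥-elim (¬p p)
𝟙-no (no _)  _  = refl

𝟙-pos : ∀ {P : Set} (d : Dec P) → 0 < 𝟙 (does d) → P
𝟙-pos (yes p) _ = p

𝟙-mono : ∀ {P Q : Set} (d : Dec P) (e : Dec Q) → (P → Q) → 𝟙 (does d) ≤ 𝟙 (does e)
𝟙-mono (no _)  e _ = z≤n
𝟙-mono (yes p) e f = ≤-reflexive (sym (𝟙-yes e (f p)))

𝟙-T : ∀ {b} → T b → 𝟙 b ≡ 1
𝟙-T {true} _ = refl

T-does : ∀ {P : Set} (d : Dec P) → P → T (does d)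
T-does (yes _) _ = tt
T-does (no ¬p) p = ¬p p

does-T : ∀ {P : Set} (d : Dec P) → T (does d) → P
does-T (yes p) _ = p

-- Sums over initial segments

Σ< : ℕ → (ℕ → ℕ) → ℕ
Σ< zero    f = 0
Σ< (suc n) f = Σ< n f + f n

Σ<-mono : ∀ n {f g} → (∀ i → i < n → f i ≤ g i) → Σ< n f ≤ Σ< n g
Σ<-mono zero    h = z≤n
Σ<-mono (suc n) h = +-mono-≤ (Σ<-mono n (λ i i<n → h i (m<n⇒m<1+n i<n))) (h n ≤-refl)

Σ<-cong : ∀ n {f g} → (∀ i → i < n → f i ≡ g i) → Σ< n f ≡ Σ< n g
Σ<-cong n h = ≤-antisym (Σ<-mono n (λ i i<n → ≤-reflexive (h i i<n)))
                        (Σ<-mono n (λ i i<n → ≤-reflexive (sym (h i i<n))))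

+-interchange : ∀ a b c d → (a + b) + (c + d) ≡ (a + c) + (b + d)
+-interchange = solve-∀

Σ<-+ : ∀ n f g → Σ< n (λ i → f i + g i) ≡ Σ< n f + Σ< n g
Σ<-+ zero    f g = refl
Σ<-+ (suc n) f g rewrite Σ<-+ n f g = +-interchange (Σ< n f) (Σ< n g) (f n) (g n)

Σ<-const : ∀ n c → Σ< n (λ _ → c) ≡ n * c
Σ<-const zero    c = refl
Σ<-const (suc n) c rewrite Σ<-const n c = +-comm (n * c) c

Σ<-0 : ∀ n → Σ< n (λ _ → 0) ≡ 0
Σ<-0 n = trans (Σ<-const n 0) (*-zeroʳ n)

Σ<-*ˡ : ∀ n c f → Σ< n (λ i → c * f i) ≡ c * Σ< n f
Σ<-*ˡ zero    c f = sym (*-zeroʳ c)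
Σ<-*ˡ (suc n) c f rewrite Σ<-*ˡ n c f = sym (*-distribˡ-+ c (Σ< n f) (f n))

Σ<-swap : ∀ m n (f : ℕ → ℕ → ℕ) → Σ< m (λ i → Σ< n (f i)) ≡ Σ< n (λ j → Σ< m (λ i → f i j))
Σ<-swap zero    n f = sym (Σ<-0 n)
Σ<-swap (suc m) n f rewrite Σ<-swap m n f = sym (Σ<-+ n (λ j → Σ< m (λ i → f i j)) (f m))

Σ<-term : ∀ n f {i} → i < n → f i ≤ Σ< n f
Σ<-term (suc n) f {i} i<1+n with i ≟ n
... | yes refl = m≤n+m (f n) (Σ< n f)
... | no i≢n = ≤-trans (Σ<-term n f (≤∧≢⇒< (s≤s⁻¹ i<1+n) i≢n)) (m≤m+n _ _)

Σ<-pos : ∀ n f → 0 < Σ< n f → ∃[ i ] i < n × 0 < f i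
Σ<-pos (suc n) f p with f n in eq
... | suc _ = n , ≤-refl , subst (0 <_) (sym eq) (s≤s z≤n)
... | zero with Σ<-pos n f (subst (0 <_) (+-identityʳ _) p)
...   | i , i<n , q = i , m<n⇒m<1+n i<n , q

Σ<-≤const : ∀ n {f} c → (∀ i → i < n → f i ≤ c) → Σ< n f ≤ n * c
Σ<-≤const n c h = ≤-trans (Σ<-mono n h) (≤-reflexive (Σ<-const n c))

Σ<-unique : ∀ n {P : ℕ → Set} (P? : ∀ i → Dec (P i)) → (∀ {i j} → P i → P j → i ≡ j) →
            Σ< n (λ i → 𝟙 (does (P? i))) ≤ 1
Σ<-unique zero    P? u = z≤n
Σ<-unique (suc n) P? u with P? n
... | no _  = subst (_≤ 1) (sym (+-identityʳ _)) (Σ<-unique n P? u)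
... | yes p = ≤-reflexive (cong (_+ 1)
      (trans (Σ<-cong n (λ i i<n → 𝟙-no (P? i) (λ q → <⇒≢ i<n (u q p)))) (Σ<-0 n)))

sumL : {A : Set} → (A → ℕ) → List A → ℕ
sumL f []       = 0
sumL f (x ∷ xs) = f x + sumL f xs

sumL-++ : {A : Set} (f : A → ℕ) (xs ys : List A) → sumL f (xs ++ ys) ≡ sumL f xs + sumL f ys
sumL-++ f []       ys = refl
sumL-++ f (x ∷ xs) ys rewrite sumL-++ f xs ys = sym (+-assoc (f x) _ _)

length≤sumL : {A : Set} (f : A → ℕ) {xs : List A} → All (λ x → 0 < f x) xs → length xs ≤ sumL f xs
length≤sumL f []       = z≤n
length≤sumL f (p ∷ ps) = +-mono-≤ p (length≤sumL f ps)

-- Lists as finite tables, with a default value outside the range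

tab : {A : Set} → ℕ → (ℕ → A) → List A
tab zero    f = []
tab (suc n) f = f 0 ∷ tab n (f ∘ suc)

nth : {A : Set} → A → List A → ℕ → A
nth d []       i       = d
nth d (x ∷ xs) zero    = x
nth d (x ∷ xs) (suc i) = nth d xs i

at : List ℕ → ℕ → ℕ
at = nth 0

nth-tab : {A : Set} (d : A) (n : ℕ) (f : ℕ → A) {i : ℕ} → i < n → nth d (tab n f) i ≡ f i
nth-tab d (suc n) f {zero}  _        = refl
nth-tab d (suc n) f {suc i} (s≤s lt) = nth-tab d n (f ∘ suc) lt

length-tab : {A : Set} (n : ℕ) (f : ℕ → A) → length (tab n f) ≡ n
length-tab zero    f = refl
length-tab (suc n) f = cong suc (length-tab n (f ∘ suc))

All-tab : {A : Set} {P : A → Set} (n : ℕ) {f : ℕ → A} → (∀ i → i < n → P (f i)) → All P (tab n f)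
All-tab zero    h = []
All-tab (suc n) h = h 0 (s≤s z≤n) ∷ All-tab n (λ i i<n → h (suc i) (s≤s i<n))

∈-tab : {A : Set} (n : ℕ) (f : ℕ → A) {i : ℕ} → i < n → f i ∈ tab n f
∈-tab (suc n) f {zero}  _        = here refl
∈-tab (suc n) f {suc i} (s≤s lt) = there (∈-tab n (f ∘ suc) lt)

map-tab : {A B : Set} (h : A → B) (n : ℕ) (f : ℕ → A) → map h (tab n f) ≡ tab n (h ∘ f)
map-tab h zero    f = refl
map-tab h (suc n) f = cong (h (f 0) ∷_) (map-tab h n (f ∘ suc))

Σ<-suc : ∀ n f → Σ< (suc n) f ≡ f 0 + Σ< n (f ∘ suc)
Σ<-suc zero    f = +-comm 0 (f 0)
Σ<-suc (suc n) f rewrite Σ<-suc n f = +-assoc (f 0) _ _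

sumL-tab : {A : Set} (h : A → ℕ) (n : ℕ) (f : ℕ → A) → sumL h (tab n f) ≡ Σ< n (h ∘ f)
sumL-tab h zero    f = refl
sumL-tab h (suc n) f = trans (cong (h (f 0) +_) (sumL-tab h n (f ∘ suc))) (sym (Σ<-suc n (h ∘ f)))

sumL-nth : {A : Set} (d : A) (h : A → ℕ) (xs : List A) → Σ< (length xs) (h ∘ nth d xs) ≡ sumL h xs
sumL-nth d h []       = refl
sumL-nth d h (x ∷ xs) = trans (Σ<-suc (length xs) _) (cong (h x +_) (sumL-nth d h xs))

All-nth : {A : Set} {P : A → Set} (d : A) {xs : List A} → All P xs → ∀ {i} → i < length xs → P (nth d xs i)
All-nth d (p ∷ ps) {zero}  _        = p
All-nth d (p ∷ ps) {suc i} (s≤s lt) = All-nth d ps lt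

∈⇒nth : {A : Set} (d : A) {x : A} {xs : List A} → x ∈ xs → ∃[ i ] i < length xs × nth d xs i ≡ x
∈⇒nth d (here refl) = 0 , s≤s z≤n , refl
∈⇒nth d (there x∈) with ∈⇒nth d x∈
... | i , lt , eq = suc i , s≤s lt , eq

-- Memory contents as bit strings.  Outside Ok the encoding may lose information.

record Codec (A : Set) : Set₁ where
  field
    size    : ℕ
    enc     : A → Vec Bool size
    dec     : Vec Bool size → A
    Ok      : A → Set
    dec-enc : ∀ a → Ok a → dec (enc a) ≡ a
open Codec public

val : ∀ {w} → Vec Bool w → ℕ
val []       = 0
val (b ∷ bs) = 𝟙 b + 2 * val bs

toBits : (w : ℕ) → ℕ → Vec Bool w
toBits zero    m = []
toBits (suc w) m = does (m % 2 ≟ 1) ∷ toBits w (m / 2)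

val-toBits : ∀ w m → m < 2 ^ w → val (toBits w m) ≡ m
val-toBits zero    zero m< = refl
val-toBits zero    (suc m) (s≤s ())
val-toBits (suc w) m m<
  rewrite val-toBits w (m / 2) (m<n*o⇒m/o<n (subst (m <_) (*-comm 2 (2 ^ w)) m<)) =
  trans (cong₂ _+_ lem (*-comm 2 (m / 2))) (sym (m≡m%n+[m/n]*n m 2))
  where
  lem : 𝟙 (does (m % 2 ≟ 1)) ≡ m % 2
  lem with m % 2 | m%n<n m 2
  ... | 0 | _ = refl
  ... | 1 | _ = refl
  ... | suc (suc _) | s≤s (s≤s ())

val< : ∀ {w} (bs : Vec Bool w) → val bs < 2 ^ w
val< []       = s≤s z≤n
val< {suc w} (b ∷ bs) = begin-strict
  𝟙 b + 2 * val bs <⟨ s≤s (+-monoˡ-≤ (2 * val bs) (𝟙≤1 b)) ⟩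
  2 + 2 * val bs   ≡⟨ *-suc 2 (val bs) ⟨
  2 * suc (val bs) ≤⟨ *-monoʳ-≤ 2 (val< bs) ⟩
  2 * 2 ^ w        ∎
  where open ≤-Reasoning

take-++ : ∀ {A : Set} {m n} (xs : Vec A m) (ys : Vec A n) → Vec.take m (xs Vec.++ ys) ≡ xs
take-++ []       ys = refl
take-++ (x ∷ xs) ys = cong (x ∷_) (take-++ xs ys)

drop-++ : ∀ {A : Set} {m n} (xs : Vec A m) (ys : Vec A n) → Vec.drop m (xs Vec.++ ys) ≡ ys
drop-++ []       ys = refl
drop-++ (x ∷ xs) ys = drop-++ xs ys

natC : ℕ → Codec ℕ
natC w .size    = w
natC w .enc     = toBits w
natC w .dec     = val
natC w .Ok m    = m < 2 ^ w
natC w .dec-enc = val-toBits w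

infixr 2 _×C_
_×C_ : {A B : Set} → Codec A → Codec B → Codec (A × B)
(c ×C d) .size = size c + size d
(c ×C d) .enc (a , b) = enc c a Vec.++ enc d b
(c ×C d) .dec v = dec c (Vec.take (size c) v) , dec d (Vec.drop (size c) v)
(c ×C d) .Ok (a , b) = Ok c a × Ok d b
(c ×C d) .dec-enc (a , b) (oka , okb) = cong₂ _,_
  (trans (cong (dec c) (take-++ (enc c a) (enc d b))) (dec-enc c a oka))
  (trans (cong (dec d) (drop-++ (enc c a) (enc d b))) (dec-enc d b okb))

module _ {A : Set} (c : Codec A) where

  -- Each of the `l` slots carries a presence bit, so that all lists of length at most `l` share one
  -- vector length; longer lists are truncated.
  encL : (l : ℕ) → List A → Vec Bool (l * suc (size c))
  encL zero    _        = []
  encL (suc l) []       = false ∷ Vec.replicate (size c) false Vec.++ encL l []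
  encL (suc l) (x ∷ xs) = true ∷ enc c x Vec.++ encL l xs

  decL : (l : ℕ) → Vec Bool (l * suc (size c)) → List A
  decL zero    _           = []
  decL (suc l) (false ∷ v) = []
  decL (suc l) (true ∷ v)  = dec c (Vec.take (size c) v) ∷ decL l (Vec.drop (size c) v)

  decL-encL : ∀ l xs → length xs ≤ l → All (Ok c) xs → decL l (encL l xs) ≡ xs
  decL-encL zero    []       _        _          = refl
  decL-encL (suc l) []       _        _          = refl
  decL-encL (suc l) (x ∷ xs) (s≤s le) (ok ∷ oks) = cong₂ _∷_
    (trans (cong (dec c) (take-++ (enc c x) _)) (dec-enc c x ok))
    (trans (cong (decL l) (drop-++ (enc c x) _)) (decL-encL l xs le oks))

listC : {A : Set} → ℕ → Codec A → Codec (List A)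
listC l c .size    = l * suc (size c)
listC l c .enc     = encL c l
listC l c .dec     = decL c l
listC l c .Ok xs   = length xs ≤ l × All (Ok c) xs
listC l c .dec-enc xs (le , oks) = decL-encL c l xs le oks

Ok-tab : {A : Set} (c : Codec A) (n : ℕ) {f : ℕ → A} → (∀ i → i < n → Ok c (f i)) → Ok (listC n c) (tab n f)
Ok-tab c n {f} h = ≤-reflexive (length-tab n f) , All-tab n h

-- The query model

-- The answer to a query is the number of ordered pairs (u , v) of adjacent vertices that satisfy it.

Query : Set
Query = ℕ → ℕ → Bool

cnt : ℕ → (ℕ → ℕ → Bool) → Query → ℕ
cnt n adj q = Σ< n λ u → Σ< n λ v → 𝟙 (q u v) * 𝟙 (adj u v)

cnt-pos : ∀ n adj q → 0 < cnt n adj q → ∃[ u ] ∃[ v ] u < n × v < n × T (q u v) × T (adj u v)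
cnt-pos n adj q pos with Σ<-pos n _ pos
... | u , u<n , pos′ with Σ<-pos n _ pos′
...   | v , v<n , pos″ with q u v in eq | adj u v in eq′
...     | true | true = u , v , u<n , v<n , subst T (sym eq) tt , subst T (sym eq′) tt

pos-cnt : ∀ n adj q {u v} → u < n → v < n → T (q u v) → T (adj u v) → 0 < cnt n adj q
pos-cnt n adj q {u} {v} u<n v<n tq ta = begin
  1                                          ≡⟨ cong₂ _*_ (𝟙-T tq) (𝟙-T ta) ⟨
  𝟙 (q u v) * 𝟙 (adj u v)                    ≤⟨ Σ<-term n (λ v → 𝟙 (q u v) * 𝟙 (adj u v)) v<n ⟩
  Σ< n (λ v → 𝟙 (q u v) * 𝟙 (adj u v))       ≤⟨ Σ<-term n (λ u → Σ< n λ v → 𝟙 (q u v) * 𝟙 (adj u v)) u<n ⟩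
  cnt n adj q                                ∎
  where open ≤-Reasoning

cnt≤ : ∀ n adj q → cnt n adj q ≤ n * n
cnt≤ n adj q = Σ<-≤const n n λ u _ → subst (Σ< n _ ≤_) (*-identityʳ n)
  (Σ<-≤const n 1 λ v _ → *-mono-≤ (𝟙≤1 (q u v)) (𝟙≤1 (adj u v)))

-- One pass: the queries are determined by the memory at its beginning, and `next` sees the answers
-- at its end.
record Step (M : Set) : Set where
  constructor mkStep
  field
    ask  : M → List Query
    next : M → List ℕ → M
open Step public

noop : ∀ {M} → Step M
noop = mkStep (λ _ → []) (λ m _ → m)

offline : ∀ {M} → (M → M) → Step M
offline f = mkStep (λ _ → []) (λ m _ → f m)

onFst : ∀ {A B} → Step A → Step (A × B)
onFst s = mkStep (λ (a , _) → ask s a) (λ (a , b) as → next s a as , b)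

onSnd : ∀ {A B} → Step B → Step (A × B)
onSnd s = mkStep (λ (_ , b) → ask s b) (λ (a , b) as → a , next s b as)

loop : ∀ {M} → (ℕ → List (Step M)) → ℕ → List (Step M)
loop body zero    = []
loop body (suc t) = loop body t ++ body t

length-loop : ∀ {M} (body : ℕ → List (Step M)) c → (∀ i → length (body i) ≡ c) → ∀ t → length (loop body t) ≡ t * c
length-loop body c h zero    = refl
length-loop body c h (suc t) = trans (length-++ (loop body t))
  (trans (cong₂ _+_ (length-loop body c h t) (h t)) (+-comm (t * c) c))

module Hoare (n : ℕ) (adj : ℕ → ℕ → Bool) (cap : ℕ) where

  exec : ∀ {M} → Step M → M → M
  exec s m = next s m (map (cnt n adj) (ask s m))

  run : ∀ {M} → List (Step M) → M → M
  run []       m = m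
  run (s ∷ ss) m = run ss (exec s m)

  -- Besides the postcondition, WP records that memory and number of queries
  -- obey the space bounds at the beginning of every pass.
  WP : ∀ {M} → (M → Set) → List (Step M) → (M → Set) → M → Set
  WP Fit []       Q m = Q m
  WP Fit (s ∷ ss) Q m = Fit m × length (ask s m) ≤ cap × WP Fit ss Q (exec s m)

  module _ {M : Set} {Fit : M → Set} where

    WP-mono : ∀ ss {Q Q′ : M → Set} → (∀ m → Q m → Q′ m) → ∀ m → WP Fit ss Q m → WP Fit ss Q′ m
    WP-mono []       f m q              = f m q
    WP-mono (s ∷ ss) f m (ok , le , wp) = ok , le , WP-mono ss f _ wp

    WP-++ : ∀ ss ts {Q} m → WP Fit ss (WP Fit ts Q) m → WP Fit (ss ++ ts) Q m
    WP-++ []       ts m wp             = wp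
    WP-++ (s ∷ ss) ts m (ok , le , wp) = ok , le , WP-++ ss ts _ wp

    WP-seq : ∀ ss ts {P Q : M → Set} → (∀ m → P m → WP Fit ts Q m) → ∀ m → WP Fit ss P m → WP Fit (ss ++ ts) Q m
    WP-seq ss ts h m wp = WP-++ ss ts m (WP-mono ss h m wp)

    WP-run : ∀ ss {Q} m → WP Fit ss Q m → Q (run ss m)
    WP-run []       m q            = q
    WP-run (s ∷ ss) m (_ , _ , wp) = WP-run ss _ wp

    WP-loop : ∀ body t (Inv : ℕ → M → Set) →
              (∀ i → i < t → ∀ m → Inv i m → WP Fit (body i) (Inv (suc i)) m) →
              ∀ m → Inv 0 m → WP Fit (loop body t) (Inv t) m
    WP-loop body zero    Inv h m i = i
    WP-loop body (suc t) Inv h m i =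
      WP-seq (loop body t) (body t) (h t ≤-refl) m (WP-loop body t Inv (λ j j<t → h j (m<n⇒m<1+n j<t)) m i)

  WP-onFst : ∀ {A B} {FitA : A → Set} {FitB : B → Set} ss {Q : A → Set} a b → FitB b → WP FitA ss Q a →
             WP (λ (a , b) → FitA a × FitB b) (map onFst ss) (λ (a′ , b′) → Q a′ × b′ ≡ b) (a , b)
  WP-onFst []       a b fb q              = q , refl
  WP-onFst (s ∷ ss) a b fb (ok , le , wp) = (ok , fb) , le , WP-onFst ss _ b fb wp

  WP-onSnd : ∀ {A B} {FitA : A → Set} {FitB : B → Set} ss {Q : B → Set} a b → FitA a → WP FitB ss Q b →
             WP (λ (a , b) → FitA a × FitB b) (map onSnd ss) (λ (a′ , b′) → a′ ≡ a × Q b′) (a , b)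
  WP-onSnd []       a b fa q              = refl , q
  WP-onSnd (s ∷ ss) a b fa (ok , le , wp) = (fa , ok) , le , WP-onSnd ss a _ fa wp

-- Implementing queries by counters modulo 2 ^ w

-- Intermediate multiplicities are unbounded and may be negative, so a deletion is counted
-- as 2 ^ w - 1 insertions; the final multiplicities are 0 or 1, so the residue is the answer.

sumL-Σ< : {A : Set} (n : ℕ) (f : A → ℕ → ℕ) (xs : List A) →
          sumL (λ x → Σ< n (f x)) xs ≡ Σ< n (λ i → sumL (λ x → f x i) xs)
sumL-Σ< n f []       = sym (Σ<-0 n)
sumL-Σ< n f (x ∷ xs) rewrite sumL-Σ< n f xs = sym (Σ<-+ n (f x) _)

sumL-*ˡ : {A : Set} (c : ℕ) (f : A → ℕ) (xs : List A) → sumL (λ x → c * f x) xs ≡ c * sumL f xs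
sumL-*ˡ c f []       = sym (*-zeroʳ c)
sumL-*ˡ c f (x ∷ xs) rewrite sumL-*ˡ c f xs = sym (*-distribˡ-+ c (f x) _)

zipWith-map : {A B C : Set} (f : A → B → C) (g : A → B) (xs : List A) →
              zipWith f xs (map g xs) ≡ map (λ x → f x (g x)) xs
zipWith-map f g []       = refl
zipWith-map f g (x ∷ xs) = cong (f x (g x) ∷_) (zipWith-map f g xs)

same : ∀ {n} → Fin n → Fin n → ℕ → ℕ → Bool
same a b u v = (does (toℕ a ≟ u) ∧ does (toℕ b ≟ v)) ∨ (does (toℕ a ≟ v) ∧ does (toℕ b ≟ u))

insC delC : ∀ {n} → List (Upd n) → ℕ → ℕ → ℕ
insC []              u v = 0
insC (ins a b ∷ σ) u v = 𝟙 (same a b u v) + insC σ u v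
insC (del a b ∷ σ) u v = insC σ u v
delC []              u v = 0
delC (ins a b ∷ σ) u v = delC σ u v
delC (del a b ∷ σ) u v = 𝟙 (same a b u v) + delC σ u v

-- Multiplicity 1 without integers: with insertions and deletions counted separately, adjacency
-- becomes a decidable equation in the naturals.
adjOf : ∀ {n} → List (Upd n) → ℕ → ℕ → Bool
adjOf σ u v = does (insC σ u v ≟ suc (delC σ u v))

does-≟ : ∀ {n} (a u : Fin n) → does (a Fin.≟ u) ≡ does (toℕ a ≟ toℕ u)
does-≟ a u with a Fin.≟ u
... | yes refl = sym (dec-true (toℕ a ≟ toℕ a) refl)
... | no a≢u   = sym (dec-false (toℕ a ≟ toℕ u) (λ eq → a≢u (Fin.toℕ-injective eq)))

same-samePair : ∀ {n} (a b u v : Fin n) → samePair a b u v ≡ same a b (toℕ u) (toℕ v)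
same-samePair a b u v rewrite does-≟ a u | does-≟ b v | does-≟ a v | does-≟ b u = refl

mult-count : ∀ {n} (σ : List (Upd n)) (u v : Fin n) →
             mult σ u v ℤ.+ ℤ.+ delC σ (toℕ u) (toℕ v) ≡ ℤ.+ insC σ (toℕ u) (toℕ v)
mult-count []            u v = refl
mult-count (ins a b ∷ σ) u v rewrite same-samePair a b u v with same a b (toℕ u) (toℕ v)
... | true  = trans (ℤ.+-assoc 1ℤ (mult σ u v) _) (cong (λ z → 1ℤ ℤ.+ z) (mult-count σ u v))
... | false = trans (ℤ.+-assoc 0ℤ (mult σ u v) _) (trans (cong (λ z → 0ℤ ℤ.+ z) (mult-count σ u v)) (ℤ.+-identityˡ _))
mult-count (del a b ∷ σ) u v rewrite same-samePair a b u v with same a b (toℕ u) (toℕ v)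
... | true  = trans (lem (mult σ u v) (ℤ.+ delC σ (toℕ u) (toℕ v))) (mult-count σ u v)
  where
  lem : ∀ x y → (-1ℤ ℤ.+ x) ℤ.+ (1ℤ ℤ.+ y) ≡ x ℤ.+ y
  lem = ℤ.solve-∀
... | false = trans (ℤ.+-assoc 0ℤ (mult σ u v) _) (trans (cong (λ z → 0ℤ ℤ.+ z) (mult-count σ u v)) (ℤ.+-identityˡ _))

Adj⇒adj : ∀ {n} (σ : List (Upd n)) {u v : Fin n} → Adj σ u v → T (adjOf σ (toℕ u) (toℕ v))
Adj⇒adj σ {u} {v} eq = T-does (_ ≟ _)
  (sym (ℤ.+-injective (trans (cong (ℤ._+ ℤ.+ delC σ (toℕ u) (toℕ v)) (sym eq)) (mult-count σ u v))))

adj⇒Adj : ∀ {n} (σ : List (Upd n)) {u v : Fin n} → T (adjOf σ (toℕ u) (toℕ v)) → Adj σ u v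
adj⇒Adj σ {u} {v} t = ∙-cancelʳ (AbelianGroup.group ℤ.+-0-abelianGroup) (ℤ.+ delC σ (toℕ u) (toℕ v)) _ _
  (trans (mult-count σ u v) (cong ℤ.+_ (does-T (_ ≟ _) t)))

same-comm : ∀ {n} (a b : Fin n) u v → same a b u v ≡ same a b v u
same-comm a b u v with does (toℕ a ≟ u) ∧ does (toℕ b ≟ v) | does (toℕ a ≟ v) ∧ does (toℕ b ≟ u)
... | true  | true  = refl
... | true  | false = refl
... | false | true  = refl
... | false | false = refl

insC-comm : ∀ {n} (σ : List (Upd n)) u v → insC σ u v ≡ insC σ v u
insC-comm []            u v = refl
insC-comm (ins a b ∷ σ) u v = cong₂ _+_ (cong 𝟙 (same-comm a b u v)) (insC-comm σ u v)
insC-comm (del a b ∷ σ) u v = insC-comm σ u v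

delC-comm : ∀ {n} (σ : List (Upd n)) u v → delC σ u v ≡ delC σ v u
delC-comm []            u v = refl
delC-comm (ins a b ∷ σ) u v = delC-comm σ u v
delC-comm (del a b ∷ σ) u v = cong₂ _+_ (cong 𝟙 (same-comm a b u v)) (delC-comm σ u v)

adjOf-sym : ∀ {n} (σ : List (Upd n)) u v → T (adjOf σ u v) → T (adjOf σ v u)
adjOf-sym σ u v t = T-does (_ ≟ _)
  (trans (insC-comm σ v u) (trans (does-T (_ ≟ _) t) (cong suc (delC-comm σ u v))))

∧∨-does : ∀ {A B C D : Set} (a : Dec A) (b : Dec B) (c : Dec C) (d : Dec D) →
          (does a ∧ does b) ∨ (does c ∧ does d) ≡ true → (A × B) ⊎ (C × D)
∧∨-does (yes a) (yes b) _       _       _ = inj₁ (a , b)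
∧∨-does (no _)  _       (yes c) (yes d) _ = inj₂ (c , d)
∧∨-does (yes _) (no _)  (yes c) (yes d) _ = inj₂ (c , d)

insC-range : ∀ {n} (σ : List (Upd n)) u v → 0 < insC σ u v → u < n × v < n
insC-range (del a b ∷ σ) u v pos = insC-range σ u v pos
insC-range (ins a b ∷ σ) u v pos with same a b u v in eq
... | false = insC-range σ u v pos
... | true with ∧∨-does (toℕ a ≟ u) (toℕ b ≟ v) (toℕ a ≟ v) (toℕ b ≟ u) eq
...   | inj₁ (refl , refl) = Fin.toℕ<n a , Fin.toℕ<n b
...   | inj₂ (refl , refl) = Fin.toℕ<n b , Fin.toℕ<n a

adjOf-range : ∀ {n} (σ : List (Upd n)) u v → T (adjOf σ u v) → u < n × v < n
adjOf-range σ u v t = insC-range σ u v (subst (0 <_) (sym (does-T (_ ≟ _) t)) (s≤s z≤n))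

-- The subtraction-free form in which the hypothesis on final multiplicities enters the counters.
simple-count : ∀ {n} (σ : List (Upd n)) → SimpleFinal σ → ∀ u v → u < n → v < n →
               insC σ u v ≡ 𝟙 (adjOf σ u v) + delC σ u v
simple-count {n} σ (_ , s) u v u<n v<n =
  subst₂ (λ x y → insC σ x y ≡ 𝟙 (adjOf σ x y) + delC σ x y) (Fin.toℕ-fromℕ< u<n) (Fin.toℕ-fromℕ< v<n) (go (s u′ v′))
  where
  u′ = Fin.fromℕ< u<n
  v′ = Fin.fromℕ< v<n
  go : mult σ u′ v′ ≡ 0ℤ ⊎ mult σ u′ v′ ≡ 1ℤ →
       insC σ (toℕ u′) (toℕ v′) ≡ 𝟙 (adjOf σ (toℕ u′) (toℕ v′)) + delC σ (toℕ u′) (toℕ v′)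
  go (inj₁ m0) = trans i≡d (cong (_+ delC σ (toℕ u′) (toℕ v′)) (sym
      (𝟙-no (insC σ (toℕ u′) (toℕ v′) ≟ suc (delC σ (toℕ u′) (toℕ v′))) (λ e → m≢1+m+n _ (trans (sym i≡d) (trans e (sym (+-identityʳ _))))))))
    where
    i≡d : insC σ (toℕ u′) (toℕ v′) ≡ delC σ (toℕ u′) (toℕ v′)
    i≡d = sym (ℤ.+-injective (trans (cong (ℤ._+ ℤ.+ delC σ (toℕ u′) (toℕ v′)) (sym m0)) (mult-count σ u′ v′)))
  go (inj₂ m1) = trans (does-T (_ ≟ _) t) (cong (_+ delC σ (toℕ u′) (toℕ v′)) (sym (𝟙-T t)))
    where t = Adj⇒adj σ m1

iter : {S : Set} → (ℕ → S → S) → ℕ → S → S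
iter F zero    x = x
iter F (suc c) x = iter (F ∘ suc) c (F 0 x)

foldl-tabulate : {S : Set} {p P : ℕ} (h : S → Fin P → S) (f : Fin p → Fin P) (F : ℕ → S → S) →
                 (∀ i s → h s (f i) ≡ F (toℕ i) s) → ∀ x → foldl h x (tabulate f) ≡ iter F p x
foldl-tabulate {p = zero}  h f F eq x = refl
foldl-tabulate {p = suc p} h f F eq x rewrite eq Fin.zero x =
  foldl-tabulate h (f ∘ Fin.suc) (F ∘ suc) (λ i s → eq (Fin.suc i) s) (F 0 x)

foldl-map : {A B S : Set} (h : S → B → S) (f : A → B) (xs : List A) (x : S) →
            foldl h x (map f xs) ≡ foldl (λ s a → h s (f a)) x xs
foldl-map h f []       x = refl
foldl-map h f (a ∷ as) x = foldl-map h f as (h x (f a))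

foldl-cong : {A S : Set} {h k : S → A → S} → (∀ s a → h s a ≡ k s a) → ∀ as x → foldl h x as ≡ foldl k x as
foldl-cong eq []       x = refl
foldl-cong {k = k} eq (a ∷ as) x = trans (cong (λ y → foldl _ y as) (eq x a)) (foldl-cong eq as (k x a))

module Compile (n w cap : ℕ) {M : Set} (c : Codec M) where

  private
    instance
      nz : NonZero (2 ^ w)
      nz = m^n≢0 2 w

  stateC : Codec (M × List ℕ)
  stateC = c ×C listC cap (natC w)

  weight : Upd n → ℕ → ℕ → ℕ
  weight (ins a b) u v = 𝟙 (same a b u v)
  weight (del a b) u v = (2 ^ w ∸ 1) * 𝟙 (same a b u v)

  incr : Query → Upd n → ℕ
  incr q x = Σ< n λ u → Σ< n λ v → 𝟙 (q u v) * weight x u v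

  bump : Step M → Upd n → M × List ℕ → M × List ℕ
  bump s x (m , cs) = m , zipWith (λ q k → (k + incr q x) % 2 ^ w) (ask s m) cs

  load : Step M → M → Vec Bool (size stateC)
  load s m = enc stateC (m , map (λ _ → 0) (ask s m))

  process : Step M → Upd n → Vec Bool (size stateC) → Vec Bool (size stateC)
  process s x v = enc stateC (bump s x (dec stateC v))

  endPass : Step M → Step M → Vec Bool (size stateC) → Vec Bool (size stateC)
  endPass s s′ v = load s′ (next s (proj₁ (dec stateC v)) (proj₂ (dec stateC v)))

  pass : List (Upd n) → (ℕ → Step M) → ℕ → Vec Bool (size stateC) → Vec Bool (size stateC)
  pass σ prog j v = endPass (prog j) (prog (suc j)) (foldl (λ st x → process (prog j) x st) v σ)

  sum-weight : ∀ σ u v → sumL (λ x → weight x u v) σ ≡ insC σ u v + (2 ^ w ∸ 1) * delC σ u v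
  sum-weight []            u v = sym (*-zeroʳ (2 ^ w ∸ 1))
  sum-weight (ins a b ∷ σ) u v rewrite sum-weight σ u v = sym (+-assoc (𝟙 (same a b u v)) _ _)
  sum-weight (del a b ∷ σ) u v rewrite sum-weight σ u v =
    lem (2 ^ w ∸ 1) (𝟙 (same a b u v)) (insC σ u v) (delC σ u v)
    where
    lem : ∀ m s i d → m * s + (i + m * d) ≡ i + m * (s + d)
    lem = solve-∀

  module _ (σ : List (Upd n)) (simple : SimpleFinal σ) (n²<2^w : n * n < 2 ^ w) where

    open Hoare n (adjOf σ) cap

    -- Insertions exceed deletions by the final multiplicity, so each deletion, of weight
    -- `2 ^ w ∸ 1`, can be paired with an insertion of weight 1, and the pair adds a full `2 ^ w`.
    -- The witness counts the deletions over the ordered pairs that satisfy the query.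
    sum-incr : ∀ q → ∃[ z ] sumL (incr q) σ ≡ cnt n (adjOf σ) q + z * 2 ^ w
    sum-incr q = Σ< n (λ u → Σ< n λ v → 𝟙 (q u v) * delC σ u v) , (begin
      sumL (incr q) σ
        ≡⟨ sumL-Σ< n (λ x u → Σ< n λ v → 𝟙 (q u v) * weight x u v) σ ⟩
      Σ< n (λ u → sumL (λ x → Σ< n λ v → 𝟙 (q u v) * weight x u v) σ)
        ≡⟨ Σ<-cong n (λ u u<n → trans (sumL-Σ< n (λ x v → 𝟙 (q u v) * weight x u v) σ)
             (trans (Σ<-cong n (λ v v<n → entry u v u<n v<n))
               (Σ<-+ n (λ v → 𝟙 (q u v) * 𝟙 (adjOf σ u v)) (λ v → 2 ^ w * (𝟙 (q u v) * delC σ u v))))) ⟩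
      Σ< n (λ u → Σ< n (λ v → 𝟙 (q u v) * 𝟙 (adjOf σ u v)) + Σ< n (λ v → 2 ^ w * (𝟙 (q u v) * delC σ u v)))
        ≡⟨ Σ<-+ n _ _ ⟩
      cnt n (adjOf σ) q + Σ< n (λ u → Σ< n (λ v → 2 ^ w * (𝟙 (q u v) * delC σ u v)))
        ≡⟨ cong (cnt n (adjOf σ) q +_) (trans (Σ<-cong n (λ u _ → Σ<-*ˡ n (2 ^ w) _)) (Σ<-*ˡ n (2 ^ w) _)) ⟩
      cnt n (adjOf σ) q + 2 ^ w * Σ< n (λ u → Σ< n λ v → 𝟙 (q u v) * delC σ u v)
        ≡⟨ cong (cnt n (adjOf σ) q +_) (*-comm (2 ^ w) _) ⟩
      cnt n (adjOf σ) q + Σ< n (λ u → Σ< n λ v → 𝟙 (q u v) * delC σ u v) * 2 ^ w ∎)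
      where
      open ≡-Reasoning
      lem : ∀ q a d m → q * ((a + d) + m * d) ≡ q * a + suc m * (q * d)
      lem = solve-∀
      entry : ∀ u v → u < n → v < n → sumL (λ x → 𝟙 (q u v) * weight x u v) σ ≡
              𝟙 (q u v) * 𝟙 (adjOf σ u v) + 2 ^ w * (𝟙 (q u v) * delC σ u v)
      entry u v u<n v<n = begin
        sumL (λ x → 𝟙 (q u v) * weight x u v) σ
          ≡⟨ sumL-*ˡ (𝟙 (q u v)) (λ x → weight x u v) σ ⟩
        𝟙 (q u v) * sumL (λ x → weight x u v) σ
          ≡⟨ cong (𝟙 (q u v) *_) (trans (sum-weight σ u v) (cong (_+ (2 ^ w ∸ 1) * delC σ u v) (simple-count σ simple u v u<n v<n))) ⟩
        𝟙 (q u v) * ((𝟙 (adjOf σ u v) + delC σ u v) + (2 ^ w ∸ 1) * delC σ u v)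
          ≡⟨ lem (𝟙 (q u v)) (𝟙 (adjOf σ u v)) (delC σ u v) (2 ^ w ∸ 1) ⟩
        𝟙 (q u v) * 𝟙 (adjOf σ u v) + suc (2 ^ w ∸ 1) * (𝟙 (q u v) * delC σ u v)
          ≡⟨ cong (λ m → 𝟙 (q u v) * 𝟙 (adjOf σ u v) + m * (𝟙 (q u v) * delC σ u v)) (suc-pred (2 ^ w)) ⟩
        𝟙 (q u v) * 𝟙 (adjOf σ u v) + 2 ^ w * (𝟙 (q u v) * delC σ u v) ∎

    counter-value : ∀ q → sumL (incr q) σ % 2 ^ w ≡ cnt n (adjOf σ) q
    counter-value q with sum-incr q
    ... | z , eq rewrite eq = trans ([m+kn]%n≡m%n (cnt n (adjOf σ) q) z (2 ^ w))
      (m<n⇒m%n≡m (≤-<-trans (cnt≤ n (adjOf σ) q) n²<2^w))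

    %-absorb : ∀ a b → (a % 2 ^ w + b) % 2 ^ w ≡ (a + b) % 2 ^ w
    %-absorb a b = begin
      (a % 2 ^ w + b) % 2 ^ w                     ≡⟨ %-distribˡ-+ (a % 2 ^ w) b (2 ^ w) ⟩
      (a % 2 ^ w % 2 ^ w + b % 2 ^ w) % 2 ^ w     ≡⟨ cong (λ x → (x + b % 2 ^ w) % 2 ^ w) (m%n%n≡m%n a (2 ^ w)) ⟩
      (a % 2 ^ w + b % 2 ^ w) % 2 ^ w             ≡⟨ %-distribˡ-+ a b (2 ^ w) ⟨
      (a + b) % 2 ^ w                             ∎
      where open ≡-Reasoning

    Ok-counters : ∀ {m} (s : Step M) (t : Query → ℕ) → Ok c m → length (ask s m) ≤ cap →
                  Ok stateC (m , map (λ q → t q % 2 ^ w) (ask s m))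
    Ok-counters {m} s t ok le = ok , subst (_≤ cap) (sym (length-map _ (ask s m))) le ,
      All.map⁺ (All.universal (λ q → m%n<n (t q) (2 ^ w)) (ask s m))

    -- Induction over the stream with an arbitrary running total `t`, kept exact inside the
    -- reduction modulo `2 ^ w`. The size hypotheses are what allows the memory to be read back
    -- after each update.
    process-all : ∀ τ s m (t : Query → ℕ) → Ok c m → length (ask s m) ≤ cap →
      foldl (λ st x → process s x st) (enc stateC (m , map (λ q → t q % 2 ^ w) (ask s m))) τ
      ≡ enc stateC (m , map (λ q → (t q + sumL (incr q) τ) % 2 ^ w) (ask s m))
    process-all [] s m t ok le = cong (λ l → enc stateC (m , l))
      (map-cong (λ q → cong (_% 2 ^ w) (sym (+-identityʳ (t q)))) (ask s m))
    process-all (x ∷ τ) s m t ok le = trans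
      (cong (λ st → foldl (λ st x → process s x st) st τ) first)
      (trans (process-all τ s m (λ q → t q + incr q x) ok le)
        (cong (λ l → enc stateC (m , l))
          (map-cong (λ q → cong (_% 2 ^ w) (+-assoc (t q) _ _)) (ask s m))))
      where
      first : process s x (enc stateC (m , map (λ q → t q % 2 ^ w) (ask s m)))
            ≡ enc stateC (m , map (λ q → (t q + incr q x) % 2 ^ w) (ask s m))
      first = trans
        (cong (λ st → enc stateC (bump s x st))
          (dec-enc stateC (m , map (λ q → t q % 2 ^ w) (ask s m)) (Ok-counters s t ok le)))
        (cong (λ l → enc stateC (m , l)) (trans
          (zipWith-map (λ q k → (k + incr q x) % 2 ^ w) (λ q → t q % 2 ^ w) (ask s m))
          (map-cong (λ q → %-absorb (t q) (incr q x)) (ask s m))))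

    pass-exec : ∀ prog j m → Ok c m → length (ask (prog j) m) ≤ cap →
                pass σ prog j (load (prog j) m) ≡ load (prog (suc j)) (exec (prog j) m)
    pass-exec prog j m ok le = trans
      (cong (endPass (prog j) (prog (suc j))) (trans
        (cong (λ l → foldl (λ st x → process (prog j) x st) (enc stateC (m , l)) σ)
          (map-cong (λ q → sym (m<n⇒m%n≡m (m^n>0 2 w))) (ask (prog j) m)))
        (process-all σ (prog j) m (λ _ → 0) ok le)))
      (trans
        (cong (λ st → load (prog (suc j)) (next (prog j) (proj₁ st) (proj₂ st)))
          (dec-enc stateC (m , map (λ q → sumL (incr q) σ % 2 ^ w) (ask (prog j) m))
            (Ok-counters (prog j) (λ q → sumL (incr q) σ) ok le)))
        (cong (λ l → load (prog (suc j)) (next (prog j) m l))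
          (map-cong counter-value (ask (prog j) m))))

    -- A program with fewer than `p` passes is padded by `noop`, the default of `nth`. The
    -- postcondition has to imply that the memory fits, because the idle passes and the output
    -- decode it again.
    iter-pass : ∀ p ss {Q : M → Set} → (∀ m → Q m → Ok c m) → length ss ≤ p → ∀ m → WP (Ok c) ss Q m →
                ∃[ m′ ] Q m′ × proj₁ (dec stateC (iter (pass σ (nth noop ss)) p (load (nth noop ss 0) m))) ≡ m′
    iter-pass zero    []       Q⇒ok le m q = m , q ,
      cong proj₁ (dec-enc stateC (m , []) (Q⇒ok m q , z≤n , []))
    iter-pass (suc p) []       Q⇒ok le m q
      rewrite pass-exec (nth noop []) 0 m (Q⇒ok m q) z≤n = iter-pass p [] Q⇒ok z≤n m q
    iter-pass (suc p) (s ∷ ss) Q⇒ok (s≤s le) m (ok , le′ , wp)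
      rewrite pass-exec (nth noop (s ∷ ss)) 0 m ok le′ = iter-pass p ss Q⇒ok le _ wp

  module _ {I : Set} (p : ℕ) (ss : List (Step M)) (init : I → Fin n → M) (out : M → Fin n → Maybe (Fin n)) where

    process# : Fin p → Upd n → Vec Bool (size stateC) → Vec Bool (size stateC)
    process# i = process (nth noop ss (toℕ i))

    endPass# : Fin p → Vec Bool (size stateC) → Vec Bool (size stateC)
    endPass# i = endPass (nth noop ss (toℕ i)) (nth noop ss (suc (toℕ i)))

    start# : I → Fin n → Vec Bool (size stateC)
    start# x r = load (nth noop ss 0) (init x r)

    output# : Vec Bool (size stateC) → Fin n → Maybe (Fin n)
    output# v = out (proj₁ (dec stateC v))

    runPasses-iter : ∀ σ st → runPasses {Upd n} {n} {p} {size stateC} process# endPass# σ st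
                              ≡ iter (pass σ (nth noop ss)) p st
    runPasses-iter σ st = foldl-tabulate {p = p} _ id (pass σ (nth noop ss)) (λ i s → refl) st

    detAlg : I → DetAlg (Fin n × Fin n) n p (size stateC)
    detAlg x = record
      { start   = start# x
      ; process = λ i e → process# i (ins (proj₁ e) (proj₂ e))
      ; endPass = endPass#
      ; output  = output#
      }

    randAlg : ∀ R → (Vec Bool R → I) → RandAlg (Upd n) n p (size stateC) R
    randAlg R f = record
      { start   = λ seed → start# (f seed)
      ; process = process#
      ; endPass = endPass#
      ; output  = output#
      }

    runDet-insOnly : ∀ x r σ → runDet (detAlg x) r σ ≡
                     output# (runPasses {Upd n} {n} {p} {size stateC} process# endPass# (insOnly σ) (start# x r))
    runDet-insOnly x r σ = cong output# (foldl-cong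
      (λ st i → cong (endPass# i) (sym (foldl-map (λ st′ e → process# i e st′) _ σ st)))
      (allFin p) (start# x r))

    run-correct : n * n < 2 ^ w → length ss ≤ p → ∀ σ → SimpleFinal σ → ∀ x r {Q : M → Set} →
      (∀ m → Q m → Ok c m) → Hoare.WP n (adjOf σ) cap (Ok c) ss Q (init x r) →
      ∃[ m ] Q m × output# (runPasses {Upd n} {n} {p} {size stateC} process# endPass# σ (start# x r)) ≡ out m
    run-correct n²< le σ simple x r Q⇒ok wp
      with iter-pass σ simple n²< p ss Q⇒ok le (init x r) wp
    ... | m , q , eq = m , q , cong out (trans (cong (λ v → proj₁ (dec stateC v)) (runPasses-iter σ _)) eq)

    rand-correct : n * n < 2 ^ w → length ss ≤ p → ∀ σ → SimpleFinal σ → ∀ R (f : Vec Bool R → I) seed r {Q : M → Set} →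
      (∀ m → Q m → Ok c m) → Hoare.WP n (adjOf σ) cap (Ok c) ss Q (init (f seed) r) →
      ∃[ m ] Q m × runRand (randAlg R f) seed r σ ≡ out m
    rand-correct n²< le σ simple R f seed r = run-correct n²< le σ simple (f seed) r

    det-correct : n * n < 2 ^ w → length ss ≤ p → ∀ σ → SimpleFinal (insOnly σ) → ∀ x r {Q : M → Set} →
      (∀ m → Q m → Ok c m) → Hoare.WP n (adjOf (insOnly σ)) cap (Ok c) ss Q (init x r) →
      ∃[ m ] Q m × runDet (detAlg x) r σ ≡ out m
    det-correct n²< le σ simple x r Q⇒ok wp with run-correct n²< le (insOnly σ) simple x r Q⇒ok wp
    ... | m , q , eq = m , q , trans (runDet-insOnly x r σ) eq

-- Connected graphs on {0, ..., n - 1} with their distance function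

record Graph (n : ℕ) : Set where
  field
    adj : ℕ → ℕ → Bool
    dst : ℕ → ℕ → ℕ

  E : ℕ → ℕ → Set
  E u v = T (adj u v)

  field
    E<       : ∀ {u v} → E u v → u < n × v < n
    E-sym    : ∀ {u v} → E u v → E v u
    E-irr    : ∀ {u} → ¬ E u u
    -- The four laws of `dst` describe breadth-first distances locally, without walks, so they carry
    -- over at once to an adjacency test that is merely equivalent, such as a stored edge list.
    dst-refl : ∀ {s} → s < n → dst s s ≡ 0
    dst-0    : ∀ {s v} → s < n → v < n → dst s v ≡ 0 → s ≡ v
    dst-step : ∀ {s u v} → s < n → E u v → dst s v ≤ suc (dst s u)
    dst-pred : ∀ {s v j} → s < n → v < n → dst s v ≡ suc j → ∃[ u ] E u v × dst s u ≡ j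

  triangle : ∀ {s u v} → s < n → u < n → v < n → dst s v ≤ dst s u + dst u v
  triangle {s} {u} {v} s<n u<n v<n = go (dst u v) v v<n refl
    where
    go : ∀ d v → v < n → dst u v ≡ d → dst s v ≤ dst s u + d
    go zero    v v<n eq rewrite dst-0 u<n v<n eq = ≤-reflexive (sym (+-identityʳ _))
    go (suc d) v v<n eq with dst-pred u<n v<n eq
    ... | x , e , eq′ = ≤-trans (dst-step s<n e)
      (≤-trans (s≤s (go d x (proj₁ (E< e)) eq′)) (≤-reflexive (sym (+-suc _ d))))

  step-left : ∀ {u x v} → E u x → v < n → dst u v ≤ suc (dst x v)
  step-left {u} {x} {v} e v<n = ≤-trans (triangle (proj₁ (E< e)) (proj₂ (E< e)) v<n)
    (+-monoˡ-≤ (dst x v) (subst (λ d → dst u x ≤ suc d) (dst-refl (proj₁ (E< e))) (dst-step (proj₁ (E< e)) e)))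

  -- All smaller distances occur, and the spheres are disjoint.
  dst<n : ∀ {s v} → s < n → v < n → dst s v < n
  dst<n {s} {v} s<n v<n = begin
    suc (dst s v)                                          ≡⟨ *-identityʳ _ ⟨
    suc (dst s v) * 1                                      ≡⟨ Σ<-const (suc (dst s v)) 1 ⟨
    Σ< (suc (dst s v)) (λ _ → 1)                           ≤⟨ Σ<-mono (suc (dst s v)) (λ i i≤ → sphere i (s≤s⁻¹ i≤)) ⟩
    Σ< (suc (dst s v)) (λ i → Σ< n (λ u → 𝟙 (does (dst s u ≟ i)))) ≡⟨ Σ<-swap (suc (dst s v)) n (λ i u → 𝟙 (does (dst s u ≟ i))) ⟩
    Σ< n (λ u → Σ< (suc (dst s v)) (λ i → 𝟙 (does (dst s u ≟ i)))) ≤⟨ Σ<-≤const n 1 (λ u _ → Σ<-unique (suc (dst s v)) (λ i → dst s u ≟ i) (λ p q → trans (sym p) q)) ⟩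
    n * 1                                                  ≡⟨ *-identityʳ n ⟩
    n                                                      ∎
    where
    open ≤-Reasoning
    nonempty : ∀ k i v → v < n → dst s v ≡ k + i → ∃[ u ] u < n × dst s u ≡ i
    nonempty zero    i v v<n eq = v , v<n , eq
    nonempty (suc k) i v v<n eq with dst-pred s<n v<n eq
    ... | u , e , eq′ = nonempty k i u (proj₁ (E< e)) eq′
    sphere : ∀ i → i ≤ dst s v → 1 ≤ Σ< n (λ u → 𝟙 (does (dst s u ≟ i)))
    sphere i i≤ with nonempty (dst s v ∸ i) i v v<n (sym (m∸n+n≡m i≤))
    ... | u , u<n , eq = ≤-trans (≤-reflexive (sym (𝟙-yes (dst s u ≟ i) eq)))
      (Σ<-term n (λ u → 𝟙 (does (dst s u ≟ i))) u<n)

  -- Guarantees that the least key sought by a binary search exists at every vertex. Some other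
  -- vertex has positive distance to `v`, and `dst-pred` then yields the neighbour.
  has-neighbour : 2 ≤ n → ∀ {v} → v < n → ∃[ u ] E u v
  has-neighbour 2≤n {v} v<n with v ≟ 0
  ... | yes refl = lem 1 2≤n (λ ())
    where
    lem : ∀ s → s < n → ¬ s ≡ 0 → ∃[ u ] E u 0
    lem s s<n ne with dst s 0 in eq
    ... | zero  = ⊥-elim (ne (dst-0 s<n v<n eq))
    ... | suc j = let u , e , _ = dst-pred s<n v<n eq in u , e
  ... | no v≢0 with dst 0 v in eq
  ...   | zero  = ⊥-elim (v≢0 (sym (dst-0 (<-trans (s≤s z≤n) 2≤n) v<n eq)))
  ...   | suc j = let u , e , _ = dst-pred (<-trans (s≤s z≤n) 2≤n) v<n eq in u , e

-- The graph presented by a stream and its distances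

least : {P : ℕ → Set} → (∀ j → Dec (P j)) → ∀ d → P d → ∃[ m ] P m × (∀ j → P j → m ≤ j)
least P? zero    p = 0 , p , λ _ _ → z≤n
least {P} P? (suc d) p with P? 0
... | yes p₀ = 0 , p₀ , λ _ _ → z≤n
... | no ¬p₀ with least (P? ∘ suc) d p
...   | m , q , min = suc m , q , bound
  where
  bound : ∀ j → P j → suc m ≤ j
  bound zero    p₀ = ⊥-elim (¬p₀ p₀)
  bound (suc j) pj = s≤s (min j pj)

walk-snoc : ∀ {n A} {u v w : Fin n} {k} → Walk A u v k → A v w → Walk A u w (suc k)
walk-snoc here       a = step a here
walk-snoc (step b p) a = step b (walk-snoc p a)

module StreamGraph {n : ℕ} (σ : List (Upd n)) (simple : SimpleFinal σ) (conn : Connected (Adj σ)) where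

  -- Bounded reachability is decidable by recursion on the bound, which makes distances computable
  -- by `least`; the first summand allows walks shorter than the bound.
  Reach : ℕ → ℕ → ℕ → Set
  Reach s zero    v = s ≡ v
  Reach s (suc j) v = Reach s j v ⊎ (∃[ u ] u < n × Reach s j u × T (adjOf σ u v))

  Reach? : ∀ s j v → Dec (Reach s j v)
  Reach? s zero    v = s ≟ v
  Reach? s (suc j) v = Reach? s j v ⊎-dec anyUpTo? (λ u → Reach? s j u ×-dec T? (adjOf σ u v)) n

  walk-reach : ∀ s j {u v k} → Reach s j (toℕ u) → Walk (Adj σ) u v k → Reach s (j + k) (toℕ v)
  walk-reach s j {u} r here rewrite +-identityʳ j = r
  walk-reach s j {u} {v} {suc k} r (step {w = w} a p) rewrite +-suc j k =
    walk-reach s (suc j) (inj₂ (toℕ u , Fin.toℕ<n u , r , Adj⇒adj σ a)) p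

  reach-walk : ∀ (s : Fin n) j (v : Fin n) → Reach (toℕ s) j (toℕ v) → ∃[ k ] k ≤ j × Walk (Adj σ) s v k
  reach-walk s zero    v eq rewrite Fin.toℕ-injective eq = 0 , z≤n , here
  reach-walk s (suc j) v (inj₁ r) with reach-walk s j v r
  ... | k , le , w = k , m≤n⇒m≤1+n le , w
  reach-walk s (suc j) v (inj₂ (u , u<n , r , e))
    with reach-walk s j (Fin.fromℕ< u<n) (subst (Reach (toℕ s) j) (sym (Fin.toℕ-fromℕ< u<n)) r)
  ... | k , le , w = suc k , s≤s le ,
    walk-snoc w (adj⇒Adj σ (subst (λ x → T (adjOf σ x (toℕ v))) (sym (Fin.toℕ-fromℕ< u<n)) e))

  reachable : ∀ {s v} → s < n → v < n → ∃[ d ] Reach s d v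
  reachable {s} {v} s<n v<n with conn (Fin.fromℕ< s<n) (Fin.fromℕ< v<n)
  ... | d , w = d , subst (Reach s d) (Fin.toℕ-fromℕ< v<n)
    (walk-reach s 0 (sym (Fin.toℕ-fromℕ< s<n)) w)

  distance : ∀ {s v} → s < n → v < n → ∃[ m ] Reach s m v × (∀ j → Reach s j v → m ≤ j)
  distance {s} {v} s<n v<n = least (λ j → Reach? s j v) (proj₁ (reachable s<n v<n)) (proj₂ (reachable s<n v<n))

  dist : ℕ → ℕ → ℕ
  dist s v with s <? n | v <? n
  ... | yes s<n | yes v<n = proj₁ (distance s<n v<n)
  ... | _       | _       = 0

  dist-reach : ∀ {s v} → s < n → v < n → Reach s (dist s v) v
  dist-reach {s} {v} s<n v<n with s <? n | v <? n
  ... | yes p | yes q = proj₁ (proj₂ (distance p q))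
  ... | no ¬p | _     = ⊥-elim (¬p s<n)
  ... | yes _ | no ¬q = ⊥-elim (¬q v<n)

  dist-min : ∀ {s v} → s < n → v < n → ∀ j → Reach s j v → dist s v ≤ j
  dist-min {s} {v} s<n v<n with s <? n | v <? n
  ... | yes p | yes q = proj₂ (proj₂ (distance p q))
  ... | no ¬p | _     = ⊥-elim (¬p s<n)
  ... | yes _ | no ¬q = ⊥-elim (¬q v<n)

  graph : Graph n
  graph = record
    { adj = adjOf σ
    ; dst = dist
    ; E< = λ {u} {v} → adjOf-range σ u v
    ; E-sym = λ {u} {v} → adjOf-sym σ u v
    ; E-irr = λ {u} e → irr u e
    ; dst-refl = λ s<n → n≤0⇒n≡0 (dist-min s<n s<n 0 refl)
    ; dst-0 = λ {s} {v} s<n v<n eq → subst (λ j → Reach s j v) eq (dist-reach s<n v<n)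
    ; dst-step = λ {s} {u} {v} s<n e → let u<n , v<n = adjOf-range σ u v e in
        dist-min s<n v<n (suc (dist s u)) (inj₂ (u , u<n , dist-reach s<n u<n , e))
    ; dst-pred = predecessor
    }
    where
    irr : ∀ u → ¬ T (adjOf σ u u)
    irr u e = case trans (sym (proj₁ simple u′)) (adj⇒Adj σ e′) of λ ()
      where
      u<n = proj₁ (adjOf-range σ u u e)
      u′ = Fin.fromℕ< u<n
      e′ : T (adjOf σ (toℕ u′) (toℕ u′))
      e′ = subst (λ x → T (adjOf σ x x)) (sym (Fin.toℕ-fromℕ< u<n)) e
    predecessor : ∀ {s v j} → s < n → v < n → dist s v ≡ suc j → ∃[ u ] T (adjOf σ u v) × dist s u ≡ j
    predecessor {s} {v} {j} s<n v<n eq with subst (λ d → Reach s d v) eq (dist-reach s<n v<n)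
    ... | inj₁ r = ⊥-elim (1+n≰n (subst (_≤ j) eq (dist-min s<n v<n j r)))
    ... | inj₂ (u , u<n , r , e) = u , e , ≤-antisym (dist-min s<n u<n j r)
      (s≤s⁻¹ (subst (_≤ suc (dist s u)) eq (dist-min s<n v<n (suc (dist s u)) (inj₂ (u , u<n , dist-reach s<n u<n , e)))))

  isDist : ∀ (r v : Fin n) → Dist (Adj σ) r v (dist (toℕ r) (toℕ v))
  isDist r v with reach-walk r _ v (dist-reach (Fin.toℕ<n r) (Fin.toℕ<n v))
  ... | k , le , w = subst (Walk (Adj σ) r v) (≤-antisym le (minimal k w)) w , minimal
    where
    minimal : ∀ k → Walk (Adj σ) r v k → dist (toℕ r) (toℕ v) ≤ k
    minimal k w = dist-min (Fin.toℕ<n r) (Fin.toℕ<n v) k (walk-reach (toℕ r) 0 refl w)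

  isBFSTree : ∀ r par → par r ≡ nothing →
    (∀ v → v ≢ r → ∃[ u ] par v ≡ just u × T (adjOf σ (toℕ u) (toℕ v)) ×
                          suc (dist (toℕ r) (toℕ u)) ≡ dist (toℕ r) (toℕ v)) →
    IsBFSTree (Adj σ) r par
  isBFSTree r par p₀ h = p₀ , λ v v≢r → let u , eq , e , d = h v v≢r in
    u , eq , adj⇒Adj σ e , λ k (w , min) →
      subst (Dist (Adj σ) r v) (trans (sym d) (cong suc
        (≤-antisym (proj₂ (isDist r u) k w) (min _ (proj₁ (isDist r u)))))) (isDist r v)

if-yes : ∀ {P A : Set} (d : Dec P) {x y : A} → P → (if does d then x else y) ≡ x
if-yes (yes _) _ = refl
if-yes (no ¬p) p = ⊥-elim (¬p p)

if-no : ∀ {P A : Set} (d : Dec P) {x y : A} → ¬ P → (if does d then x else y) ≡ y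
if-no (yes p) ¬p = ⊥-elim (¬p p)
if-no (no _)  _  = refl

-- Simultaneous binary search, over L passes, for the least key of a neighbour of each vertex

module Search (n : ℕ) {Z : Set} (key : Z → ℕ → ℕ → ℕ) where

  below? : ∀ z (lo : List ℕ) ℓ v u x → Dec (x ≡ v × key z v u < at lo v + 2 ^ ℓ)
  below? z lo ℓ v u x = (x ≟ v) ×-dec (key z v u <? at lo v + 2 ^ ℓ)

  below : Z → List ℕ → ℕ → ℕ → Query
  below z lo ℓ v u x = does (below? z lo ℓ v u x)

  halved : List ℕ → List ℕ → ℕ → ℕ → ℕ
  halved lo as ℓ v = if does (at as v ≟ 0) then at lo v + 2 ^ ℓ else at lo v

  halve : ℕ → Step (Z × List ℕ)
  halve ℓ = mkStep (λ (z , lo) → tab n (below z lo ℓ))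
                   (λ (z , lo) as → z , tab n (halved lo as ℓ))

  search : ℕ → List (Step (Z × List ℕ))
  search zero    = []
  search (suc ℓ) = halve ℓ ∷ search ℓ

  length-search : ∀ ℓ → length (search ℓ) ≡ ℓ
  length-search zero    = refl
  length-search (suc ℓ) = cong suc (length-search ℓ)

  module Correct (G : Graph n) (w L cap : ℕ) (L≤w : L ≤ w) (n≤cap : n ≤ cap) (FitZ : Z → Set) where
    open Graph G
    open Hoare n adj cap

    loC : Codec (List ℕ)
    loC = listC n (natC w)

    Fit : Z × List ℕ → Set
    Fit (z , lo) = FitZ z × Ok loC lo

    -- The first clause keeps `at lo v` within the word size. The other two confine the least key to
    -- an interval of length `2 ^ ℓ`, so at level 0 the lower bound is that key.
    Bracket : Z → ℕ → List ℕ → ℕ → Set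
    Bracket z ℓ lo v = at lo v + 2 ^ ℓ ≤ 2 ^ L
                     × (∀ u → E u v → at lo v ≤ key z v u)
                     × (∃[ u ] E u v × key z v u < at lo v + 2 ^ ℓ)

    Inv : Z → ℕ → List ℕ → Set
    Inv z ℓ lo = Ok loC lo × (∀ v → v < n → Bracket z ℓ lo v)

    halve-correct : ∀ z ℓ lo → Inv z (suc ℓ) lo → Inv z ℓ (proj₂ (exec (halve ℓ) (z , lo)))
    halve-correct z ℓ lo (_ , br) =
        Ok-tab (natC w) n (λ v v<n → <-≤-trans
          (<-≤-trans (m<m+n _ (m^n>0 2 ℓ)) (proj₁ (bracket v v<n)))
          (^-monoʳ-≤ 2 L≤w))
      , λ v v<n → subst (λ x → x + 2 ^ ℓ ≤ 2 ^ L × (∀ u → E u v → x ≤ key z v u) × (∃[ u ] E u v × key z v u < x + 2 ^ ℓ))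
                        (sym (nth-tab 0 n (halved lo as ℓ) v<n)) (bracket v v<n)
      where
      as = map (cnt n adj) (tab n (below z lo ℓ))
      at-as : ∀ {v} → v < n → at as v ≡ cnt n adj (below z lo ℓ v)
      at-as {v} v<n = trans (cong (λ l → at l v) (map-tab (cnt n adj) n (below z lo ℓ))) (nth-tab 0 n _ v<n)
      double : ∀ a → a + 2 ^ suc ℓ ≡ (a + 2 ^ ℓ) + 2 ^ ℓ
      double a = trans (cong (λ x → a + (2 ^ ℓ + x)) (+-identityʳ (2 ^ ℓ))) (sym (+-assoc a (2 ^ ℓ) (2 ^ ℓ)))
      bracket : ∀ v → v < n → let x = halved lo as ℓ v in
                x + 2 ^ ℓ ≤ 2 ^ L × (∀ u → E u v → x ≤ key z v u) × (∃[ u ] E u v × key z v u < x + 2 ^ ℓ)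
      bracket v v<n with br v v<n
      ... | top , low , u₀ , e₀ , k₀ = go (at as v ≟ 0)
        where
        Goal : ℕ → Set
        Goal x = x + 2 ^ ℓ ≤ 2 ^ L × (∀ u → E u v → x ≤ key z v u) × (∃[ u ] E u v × key z v u < x + 2 ^ ℓ)
        go : Dec (at as v ≡ 0) → Goal (halved lo as ℓ v)
        go (yes none) = subst Goal (sym (if-yes (at as v ≟ 0) none))
          ( subst (_≤ 2 ^ L) (double (at lo v)) top
          , (λ u e → ≮⇒≥ (λ k< → <-irrefl (trans (sym none) (at-as v<n))
              (pos-cnt n adj (below z lo ℓ v) (proj₁ (E< e)) v<n (T-does (below? z lo ℓ v u v) (refl , k<)) e)))
          , u₀ , e₀ , subst (key z v u₀ <_) (double (at lo v)) k₀)
        go (no some) = subst Goal (sym (if-no (at as v ≟ 0) some))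
          (≤-trans (+-monoʳ-≤ (at lo v) (m≤m+n (2 ^ ℓ) _)) top , low , witness)
          where
          witness : ∃[ u ] E u v × key z v u < at lo v + 2 ^ ℓ
          witness with cnt-pos n adj (below z lo ℓ v) (n≢0⇒n>0 (λ eq → some (trans (at-as v<n) eq)))
          ... | u , x , _ , _ , t , e with does-T (below? z lo ℓ v u x) t
          ...   | refl , k< = u , e , k<

    search-correct : ∀ z → FitZ z → ∀ ℓ lo → Inv z ℓ lo →
                     WP Fit (search ℓ) (λ (z′ , lo′) → z′ ≡ z × Inv z 0 lo′) (z , lo)
    search-correct z fz zero    lo inv = refl , inv
    search-correct z fz (suc ℓ) lo inv = (fz , proj₁ inv) ,
      ≤-trans (≤-reflexive (length-tab n _)) n≤cap ,
      search-correct z fz ℓ _ (halve-correct z ℓ lo inv)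

-- Distances from a set of known weighted edges and a few relaxations over all edges

Edge : Set
Edge = ℕ × ℕ × ℕ

relaxAt : List ℕ → ℕ → List Edge → ℕ
relaxAt est v []                 = at est v
relaxAt est v ((a , b , c) ∷ es) = if does (b ≟ v) then (at est a + c) ⊓ relaxAt est v es else relaxAt est v es

relaxAt-≤ : ∀ est v es → relaxAt est v es ≤ at est v
relaxAt-≤ est v []                 = ≤-refl
relaxAt-≤ est v ((a , b , c) ∷ es) with does (b ≟ v)
... | true  = ≤-trans (m⊓n≤n _ _) (relaxAt-≤ est v es)
... | false = relaxAt-≤ est v es

relaxAt-edge : ∀ est {a v c} es → (a , v , c) ∈ es → relaxAt est v es ≤ at est a + c
relaxAt-edge est {a} {v} {c} (_ ∷ es) (here refl) =
  ≤-trans (≤-reflexive (if-yes (v ≟ v) refl)) (m⊓n≤m _ _)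
relaxAt-edge est {v = v} ((a′ , b , c′) ∷ es) (there e∈) with does (b ≟ v)
... | true  = ≤-trans (m⊓n≤n _ _) (relaxAt-edge est es e∈)
... | false = relaxAt-edge est es e∈

relaxAt-≥ : ∀ est v x es → x ≤ at est v → (∀ a c → (a , v , c) ∈ es → x ≤ at est a + c) → x ≤ relaxAt est v es
relaxAt-≥ est v x []                 h₀ h = h₀
relaxAt-≥ est v x ((a , b , c) ∷ es) h₀ h with b ≟ v
... | yes refl = ≤-trans (⊓-glb (h a c (here refl)) (relaxAt-≥ est v x es h₀ (λ a c e → h a c (there e))))
                         (≤-reflexive (sym (if-yes (b ≟ b) refl)))
... | no b≢v   = ≤-trans (relaxAt-≥ est v x es h₀ (λ a c e → h a c (there e)))
                         (≤-reflexive (sym (if-no (b ≟ v) b≢v)))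

module Finish (n L : ℕ) {A : Set} (edges : A → List Edge) where

  relax : List Edge → List ℕ → List ℕ
  relax es est = tab n (λ v → relaxAt est v es)

  close : ℕ → List Edge → List ℕ → List ℕ
  close zero    es est = est
  close (suc c) es est = relax es (close c es est)

  State : Set
  State = (A × List ℕ) × List ℕ

  closeStep : Step State
  closeStep = offline λ ((a , est) , lo) → (a , close n (edges a) est) , tab n (λ _ → 0)

  updateStep : Step State
  updateStep = offline λ ((a , est) , lo) → (a , tab n (λ v → at est v ⊓ suc (at lo v))) , lo

  -- Minimising `estKey` relaxes all edges into a vertex at once. Under `parentKey` a neighbour one
  -- layer closer to the root has its own number as key and any other neighbour has `2 ^ L ∸ 1`,
  -- which is at least `n`; hence the least key names a parent.
  estKey parentKey : A × List ℕ → ℕ → ℕ → ℕ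
  estKey    (a , est) v u = at est u
  parentKey (a , est) v u = if does (suc (at est u) ≟ at est v) then u else 2 ^ L ∸ 1

  module E = Search n estKey
  module P = Search n parentKey

  round : List (Step State)
  round = closeStep ∷ E.search L ++ updateStep ∷ []

  finish : ℕ → List (Step State)
  finish m = loop (λ _ → round) m ++ closeStep ∷ P.search L

  length-round : length round ≡ L + 2
  length-round = trans (cong suc (trans (length-++ (E.search L)) (cong (_+ 1) (E.length-search L)))) (sym (+-suc L 1))

  length-finish : ∀ m → length (finish m) ≡ m * (L + 2) + suc L
  length-finish m = trans (length-++ (loop (λ _ → round) m))
    (cong₂ _+_ (length-loop (λ _ → round) (L + 2) (λ _ → length-round) m) (cong suc (P.length-search L)))

  -- The value `2 ^ L ∸ 1` plays the role of infinity: it fits in `L` bits and, being at least `n`,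
  -- exceeds every distance.
  initEst : ℕ → List ℕ
  initEst r = tab n (λ v → if does (v ≟ r) then 0 else 2 ^ L ∸ 1)

  module Correct (G : Graph n) (2≤n : 2 ≤ n) (n<2^L : n < 2 ^ L) (w cap : ℕ) (L≤w : L ≤ w) (n≤cap : n ≤ cap)
                 (FitA : A → Set) (r : ℕ) (r<n : r < n) where
    open Graph G
    open Hoare n adj cap

    numsC : Codec (List ℕ)
    numsC = listC n (natC w)

    FitZ : A × List ℕ → Set
    FitZ (a , est) = FitA a × Ok numsC est

    Fit : State → Set
    Fit (z , lo) = FitZ z × Ok numsC lo

    module ES = E.Correct G w L cap L≤w n≤cap FitZ
    module PS = P.Correct G w L cap L≤w n≤cap FitZ

    -- Relative to the root `r`, so the weight may exceed the distance between the endpoints and may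
    -- even be the value that stands for infinity.
    SoundEdges : List Edge → Set
    SoundEdges es = ∀ u v c → (u , v , c) ∈ es → v < n → u < n × dst r v ≤ dst r u + c

    -- Hyb es m v ℓ: a walk of length ℓ from r to v using known edges and exactly m other edges.
    data Hyb (es : List Edge) : ℕ → ℕ → ℕ → Set where
      root  : Hyb es 0 r 0
      known : ∀ {m u v ℓ c} → Hyb es m u ℓ → (u , v , c) ∈ es → 1 ≤ c → v < n → Hyb es m v (ℓ + c)
      real  : ∀ {m u v ℓ} → Hyb es m u ℓ → E u v → Hyb es (suc m) v (suc ℓ)

    Sound : List ℕ → Set
    Sound est = Ok numsC est × (∀ v → v < n → dst r v ≤ at est v × at est v < 2 ^ L)

    -- Covers the root and walks that end with a real edge. `close` supplies trailing known edges
    -- and leads to `Closed`; one update over all edges leads from there to `Open` with one more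
    -- real edge.
    Open : List Edge → ℕ → List ℕ → Set
    Open es m est = Sound est × at est r ≤ 0 ×
      (∀ {m′ u v ℓ} → m′ < m → Hyb es m′ u ℓ → ℓ ≤ n → E u v → at est v ≤ suc ℓ)

    Closed : List Edge → ℕ → List ℕ → Set
    Closed es m est = Sound est × (∀ {m′ v ℓ} → m′ ≤ m → Hyb es m′ v ℓ → ℓ ≤ n → at est v ≤ ℓ)

    tabSound : ∀ f → (∀ v → v < n → dst r v ≤ f v × f v < 2 ^ L) → Sound (tab n f)
    tabSound f h = Ok-tab (natC w) n (λ v v<n → <-≤-trans (proj₂ (h v v<n)) (^-monoʳ-≤ 2 L≤w)) ,
      λ v v<n → subst (λ x → dst r v ≤ x × x < 2 ^ L) (sym (nth-tab 0 n f v<n)) (h v v<n)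

    relax-sound : ∀ es est → SoundEdges es → Sound est → Sound (relax es est)
    relax-sound es est se (_ , h) = tabSound _ λ v v<n →
      relaxAt-≥ est v (dst r v) es (proj₁ (h v v<n))
        (λ a c e → let a<n , le = se a v c e v<n in ≤-trans le (+-monoˡ-≤ c (proj₁ (h a a<n)))) ,
      ≤-<-trans (relaxAt-≤ est v es) (proj₂ (h v v<n))

    close-sound : ∀ c es est → SoundEdges es → Sound est → Sound (close c es est)
    close-sound zero    es est se s = s
    close-sound (suc c) es est se s = relax-sound es _ se (close-sound c es est se s)

    close-≤ : ∀ c es est {v} → v < n → at (close c es est) v ≤ at est v
    close-≤ zero    es est v<n = ≤-refl
    close-≤ (suc c) es est {v} v<n = ≤-trans (≤-reflexive (nth-tab 0 n _ v<n))
      (≤-trans (relaxAt-≤ (close c es est) v es) (close-≤ c es est v<n))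

    -- Trailing known edges are peeled off, one per relaxation. Each has weight at least 1, so the
    -- length `ℓ` bounds their number; the root, or a real edge at the end, is settled by `Open`.
    close-hyb : ∀ c es est m → Open es m est → ∀ {m′ v ℓ} → m′ ≤ m → Hyb es m′ v ℓ → ℓ ≤ n → ℓ ≤ c →
                at (close c es est) v ≤ ℓ
    close-hyb c es est m (_ , h₀ , _) _ root _ _ = ≤-trans (close-≤ c es est r<n) h₀
    close-hyb zero es est m o le (known {ℓ = ℓ} {c = d} p e∈ 1≤d v<n) _ ≤0 =
      ⊥-elim (<⇒≱ (≤-trans 1≤d (m≤n+m d ℓ)) ≤0)
    close-hyb (suc c) es est m o le (known {u = u} {v = v} {ℓ = ℓ} {c = d} p e∈ 1≤d v<n) ≤n ≤c =
      ≤-trans (≤-reflexive (nth-tab 0 n _ v<n)) (≤-trans (relaxAt-edge (close c es est) es e∈)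
        (+-monoˡ-≤ d (close-hyb c es est m o le p (≤-trans (m≤m+n ℓ d) ≤n)
          (s≤s⁻¹ (≤-trans (≤-trans (≤-reflexive (+-comm 1 ℓ)) (+-monoʳ-≤ ℓ 1≤d)) ≤c)))))
    close-hyb c es est m (_ , _ , h) le (real p e) ≤n _ =
      ≤-trans (close-≤ c es est (proj₂ (E< e))) (h le p (≤-trans (n≤1+n _) ≤n) e)

    closed : ∀ es est m → SoundEdges es → Open es m est → Closed es m (close n es est)
    closed es est m se o = close-sound n es est se (proj₁ o) , λ le p ≤n → close-hyb n es est m o le p ≤n ≤n

    zeros-Ok : Ok numsC (tab n (λ _ → 0))
    zeros-Ok = Ok-tab (natC w) n (λ _ _ → m^n>0 2 w)

    initEst-Ok : Ok numsC (initEst r)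
    initEst-Ok = Ok-tab (natC w) n (λ v _ → <-≤-trans (bound (does (v ≟ r))) (^-monoʳ-≤ 2 L≤w))
      where
      bound : ∀ b → (if b then 0 else 2 ^ L ∸ 1) < 2 ^ L
      bound true  = m^n>0 2 L
      bound false = ≤-reflexive (m+[n∸m]≡n (m^n>0 2 L))

    at-zeros : ∀ {v} → v < n → at (tab n (λ _ → 0)) v ≡ 0
    at-zeros = nth-tab 0 n (λ _ → 0)

    est-search-init : ∀ a est → Sound est → ES.Inv (a , est) L (tab n (λ _ → 0))
    est-search-init a est (_ , h) = zeros-Ok , λ v v<n →
      subst (λ x → x + 2 ^ L ≤ 2 ^ L × (∀ u → E u v → x ≤ at est u) × (∃[ u ] E u v × at est u < x + 2 ^ L))
        (sym (at-zeros v<n))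
        (≤-refl , (λ _ _ → z≤n) ,
          let u , e = has-neighbour 2≤n v<n in u , e , proj₂ (h u (proj₁ (E< e))))

    parent-search-init : ∀ a est → PS.Inv (a , est) L (tab n (λ _ → 0))
    parent-search-init a est = zeros-Ok , λ v v<n →
      subst (λ x → x + 2 ^ L ≤ 2 ^ L × (∀ u → E u v → x ≤ parentKey (a , est) v u)
                   × (∃[ u ] E u v × parentKey (a , est) v u < x + 2 ^ L))
        (sym (at-zeros v<n))
        (≤-refl , (λ _ _ → z≤n) , let u , e = has-neighbour 2≤n v<n in u , e , key< v u (proj₁ (E< e)))
      where
      key< : ∀ v u → u < n → parentKey (a , est) v u < 2 ^ L
      key< v u u<n with does (suc (at est u) ≟ at est v)
      ... | true  = <-trans u<n n<2^L
      ... | false = ≤-reflexive (m+[n∸m]≡n (m^n>0 2 L))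

    opened : ∀ a est lo m → Closed (edges a) m est → ES.Inv (a , est) 0 lo →
             Open (edges a) (suc m) (tab n (λ v → at est v ⊓ suc (at lo v)))
    opened a est lo m ((_ , s) , c) (_ , br) =
        tabSound _ (λ v v<n → ⊓-glb (proj₁ (s v v<n)) (near v v<n) , ≤-<-trans (m⊓n≤m _ _) (proj₂ (s v v<n)))
      , ≤-trans (≤-reflexive (nth-tab 0 n _ r<n)) (≤-trans (m⊓n≤m _ _) (c z≤n root z≤n))
      , λ {m′} {u} {v} {ℓ} m′< p ≤n e → ≤-trans (≤-reflexive (nth-tab 0 n _ (proj₂ (E< e))))
          (≤-trans (m⊓n≤n (at est v) _) (s≤s (≤-trans (proj₁ (proj₂ (br v (proj₂ (E< e)))) u e) (c (s≤s⁻¹ m′<) p ≤n))))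
      where
      near : ∀ v → v < n → dst r v ≤ suc (at lo v)
      near v v<n with br v v<n
      ... | _ , _ , u , e , lt = ≤-trans (dst-step r<n e)
        (s≤s (≤-trans (proj₁ (s u (proj₁ (E< e)))) (s≤s⁻¹ (subst (at est u <_) (+-comm (at lo v) 1) lt))))

    RoundInv : A → ℕ → State → Set
    RoundInv a m ((a′ , est) , lo) = a′ ≡ a × Open (edges a) m est × Ok numsC lo

    round-correct : ∀ a → FitA a → SoundEdges (edges a) → ∀ m s → RoundInv a m s → WP Fit round (RoundInv a (suc m)) s
    round-correct a fa se m ((.a , est) , lo) (refl , o , oklo) =
      ((fa , proj₁ (proj₁ o)) , oklo) , z≤n ,
      WP-seq (E.search L) (updateStep ∷ [])
        (λ { (_ , lo′) (refl , inv) → ((fa , proj₁ (proj₁ c)) , proj₁ inv) , z≤n , refl , opened a est′ lo′ m c inv , proj₁ inv })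
        _ (ES.search-correct (a , est′) (fa , proj₁ (proj₁ c)) L _ (est-search-init a est′ (proj₁ c)))
      where
      est′ = close n (edges a) est
      c = closed (edges a) est m se o

    Result : State → Set
    Result s@((a , est) , lo) = Fit s × (∀ v → v < n → at est v ≡ dst r v ×
      (v ≢ r → E (at lo v) v × suc (dst r (at lo v)) ≡ dst r v))

    parents : ∀ a est lo → (∀ v → v < n → at est v ≡ dst r v) → PS.Inv (a , est) 0 lo →
              ∀ v → v < n → v ≢ r → E (at lo v) v × suc (dst r (at lo v)) ≡ dst r v
    parents a est lo exact (_ , br) v v<n v≢r with dst r v in eqd
    ... | zero  = ⊥-elim (v≢r (sym (dst-0 r<n v<n eqd)))
    ... | suc j with dst-pred r<n v<n eqd | br v v<n
    ...   | u , e , eqj | _ , low , u₁ , e₁ , lt = subst (λ x → E x v × suc (dst r x) ≡ suc j) (sym lo≡u₁)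
            (e₁ , trans (cong suc (sym (exact u₁ (proj₁ (E< e₁))))) (trans test (trans (exact v v<n) eqd)))
      where
      key-u : parentKey (a , est) v u ≡ u
      key-u = if-yes (suc (at est u) ≟ at est v)
        (trans (cong suc (trans (exact u (proj₁ (E< e))) eqj)) (sym (trans (exact v v<n) eqd)))
      lo<n : at lo v < n
      lo<n = ≤-<-trans (subst (at lo v ≤_) key-u (low u e)) (proj₁ (E< e))
      key₁≤ : parentKey (a , est) v u₁ ≤ at lo v
      key₁≤ = s≤s⁻¹ (subst (parentKey (a , est) v u₁ <_) (+-comm (at lo v) 1) lt)
      -- If `u₁` failed the layer test, its key would be `2 ^ L ∸ 1`, at least `n`, against `lo<n`.
      test : suc (at est u₁) ≡ at est v
      test with suc (at est u₁) ≟ at est v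
      ... | yes p = p
      ... | no ¬p = ⊥-elim (<⇒≱ (<-≤-trans lo<n (∸-monoˡ-≤ 1 n<2^L))
              (subst (_≤ at lo v) (if-no (suc (at est u₁) ≟ at est v) ¬p) key₁≤))
      key₁ : parentKey (a , est) v u₁ ≡ u₁
      key₁ = if-yes (suc (at est u₁) ≟ at est v) test
      lo≡u₁ : at lo v ≡ u₁
      lo≡u₁ = ≤-antisym (subst (at lo v ≤_) key₁ (low u₁ e₁)) (subst (_≤ at lo v) key₁ key₁≤)

    finish-correct : ∀ a lo m → FitA a → Ok numsC lo → SoundEdges (edges a) →
      (∀ v → v < n → ∃[ m′ ] m′ ≤ m × Hyb (edges a) m′ v (dst r v)) →
      WP Fit (finish m) (λ s → Result s × proj₁ (proj₁ s) ≡ a) ((a , initEst r) , lo)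
    finish-correct a lo m fa oklo se hyb =
      WP-seq (loop (λ _ → round) m) (closeStep ∷ P.search L) last _
        (WP-loop (λ _ → round) m (RoundInv a) (λ i _ → round-correct a fa se i) _ (refl , init , oklo))
      where
      init : Open (edges a) 0 (initEst r)
      init = tabSound _ entry ,
        ≤-reflexive (trans (nth-tab 0 n _ r<n) (if-yes (r ≟ r) refl)) , λ ()
        where
        entry : ∀ v → v < n → dst r v ≤ (if does (v ≟ r) then 0 else 2 ^ L ∸ 1) × (if does (v ≟ r) then 0 else 2 ^ L ∸ 1) < 2 ^ L
        entry v v<n with v ≟ r
        ... | yes refl rewrite if-yes (v ≟ v) {0} {2 ^ L ∸ 1} refl = ≤-reflexive (dst-refl v<n) , m^n>0 2 L
        ... | no ne rewrite if-no (v ≟ r) {0} {2 ^ L ∸ 1} ne =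
          ≤-trans (<⇒≤ (dst<n r<n v<n)) (∸-monoˡ-≤ 1 n<2^L) , ≤-reflexive (m+[n∸m]≡n (m^n>0 2 L))
      last : ∀ s → RoundInv a m s → WP Fit (closeStep ∷ P.search L) (λ s → Result s × proj₁ (proj₁ s) ≡ a) s
      last ((.a , est) , lo) (refl , o , oklo) =
        ((fa , proj₁ (proj₁ o)) , oklo) , z≤n ,
        WP-mono (P.search L)
          (λ { (_ , lo′) (refl , inv) → (((fa , proj₁ (proj₁ c)) , proj₁ inv) ,
                 λ v v<n → exact v v<n , parents a est′ lo′ exact inv v v<n) , refl }) _
          (PS.search-correct (a , est′) (fa , proj₁ (proj₁ c)) L _ (parent-search-init a est′))
        where
        est′ = close n (edges a) est
        c = closed (edges a) est m se o
        exact : ∀ v → v < n → at est′ v ≡ dst r v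
        exact v v<n = let m′ , le , p = hyb v v<n in
          ≤-antisym (proj₂ c le p (<⇒≤ (dst<n r<n v<n))) (proj₁ (proj₂ (proj₁ c) v v<n))

-- Finding the next BFS layers of many sources at once.  A pair (i , v) stands
-- for vertex v in the search from the i-th source; a candidate (i , a) at level ℓ
-- stands for the vertices a, ..., a + 2 ^ ℓ - 1 in that search.

Pairs : Set
Pairs = List (ℕ × ℕ)

open DecMembership (≡-dec _≟_ _≟_) using (_∈?_) public

split : ℕ → Pairs → Pairs
split ℓ []             = []
split ℓ ((i , a) ∷ cs) = (i , a) ∷ (i , a + 2 ^ ℓ) ∷ split ℓ cs

length-split : ∀ ℓ cs → length (split ℓ cs) ≡ 2 * length cs
length-split ℓ []       = refl
length-split ℓ (_ ∷ cs) = trans (cong (suc ∘ suc) (length-split ℓ cs)) (sym (*-suc 2 (length cs)))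

split-∈ : ∀ ℓ {i a cs} → (i , a) ∈ cs → (i , a) ∈ split ℓ cs × (i , a + 2 ^ ℓ) ∈ split ℓ cs
split-∈ ℓ (here refl) = here refl , there (here refl)
split-∈ ℓ (there c∈)  = let p , q = split-∈ ℓ c∈ in there (there p) , there (there q)

All-split : ∀ {P Q : ℕ × ℕ → Set} ℓ {cs} → (∀ i a → P (i , a) → Q (i , a) × Q (i , a + 2 ^ ℓ)) →
            All P cs → All Q (split ℓ cs)
All-split ℓ h []                    = []
All-split ℓ h (_∷_ {x = i , a} p ps) = proj₁ (h i a p) ∷ proj₂ (h i a p) ∷ All-split ℓ h ps

keep : {A : Set} → List A → List ℕ → List A
keep (c ∷ cs) (a ∷ as) = if does (a ≟ 0) then keep cs as else c ∷ keep cs as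
keep _        _        = []

module _ {A : Set} (f : A → ℕ) where

  keep-∈ : ∀ {x} cs → x ∈ cs → 0 < f x → x ∈ keep cs (map f cs)
  keep-∈ (c ∷ cs) (here refl) pos rewrite if-no (f c ≟ 0) {keep cs (map f cs)} {c ∷ keep cs (map f cs)} (>⇒≢ pos) = here refl
  keep-∈ (c ∷ cs) (there x∈)  pos with does (f c ≟ 0)
  ... | true  = keep-∈ cs x∈ pos
  ... | false = there (keep-∈ cs x∈ pos)

  keep-All : ∀ {P : A → Set} cs → All P cs → All (λ x → P x × 0 < f x) (keep cs (map f cs))
  keep-All []       _        = []
  keep-All (c ∷ cs) (p ∷ ps) with f c in eq
  ... | zero  = keep-All cs ps
  ... | suc _ = (p , subst (0 <_) (sym eq) (s≤s z≤n)) ∷ keep-All cs ps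

  keep-sum : ∀ (g : A → ℕ) cs → sumL g (keep cs (map f cs)) ≤ sumL g cs
  keep-sum g []       = z≤n
  keep-sum g (c ∷ cs) with does (f c ≟ 0)
  ... | true  = ≤-trans (keep-sum g cs) (m≤n+m _ _)
  ... | false = +-monoʳ-≤ (g c) (keep-sum g cs)

module Expand (n : ℕ) where

  State : Set
  State = (Pairs × Pairs) × Pairs

  -- In a breadth-first search the neighbours of a layer lie in that layer, the one before or the
  -- one after, so remembering two layers is enough to recognise new vertices.
  asked? : ∀ (prev cur : Pairs) ℓ i a u x →
           Dec ((i , u) ∈ cur × ¬ ((i , x) ∈ cur) × ¬ ((i , x) ∈ prev) × a ≤ x × x < a + 2 ^ ℓ)
  asked? prev cur ℓ i a u x =
    ((i , u) ∈? cur) ×-dec ¬? ((i , x) ∈? cur) ×-dec ¬? ((i , x) ∈? prev) ×-dec (a ≤? x) ×-dec (x <? a + 2 ^ ℓ)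

  asked : Pairs → Pairs → ℕ → ℕ × ℕ → Query
  asked prev cur ℓ (i , a) u x = does (asked? prev cur ℓ i a u x)

  refine : ℕ → Step State
  refine ℓ = mkStep (λ ((prev , cur) , cand) → map (asked prev cur ℓ) (split ℓ cand))
                    (λ (pc , cand) as → pc , keep (split ℓ cand) as)

  expand : ℕ → List (Step State)
  expand zero    = []
  expand (suc ℓ) = refine ℓ ∷ expand ℓ

  length-expand : ∀ ℓ → length (expand ℓ) ≡ ℓ
  length-expand zero    = refl
  length-expand (suc ℓ) = cong suc (length-expand ℓ)

  initCand : ℕ → Pairs
  initCand ks = tab ks (λ i → i , 0)

  module Correct (G : Graph n) (w L cap ks K : ℕ) (L≤w : L ≤ w) (ks≤2^w : ks ≤ 2 ^ w) (n<2^L : n < 2 ^ L)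
                 (cap-ok : 2 * (K + ks) ≤ cap) (prev cur : Pairs) where
    open Graph G
    open Hoare n adj cap

    pairsC : Codec Pairs
    pairsC = listC (K + ks) (natC w ×C natC w)

    Fit : State → Set
    Fit = Ok ((pairsC ×C pairsC) ×C pairsC)

    Next : ℕ → ℕ → Set
    Next i x = ∃[ u ] u < n × E u x × (i , u) ∈ cur × ¬ ((i , x) ∈ cur) × ¬ ((i , x) ∈ prev)

    Next? : ∀ i x → Dec (Next i x)
    Next? i x = anyUpTo? (λ u → T? (adj u x) ×-dec ((i , u) ∈? cur) ×-dec ¬? ((i , x) ∈? cur) ×-dec ¬? ((i , x) ∈? prev)) n

    Inside : ℕ → ℕ → ℕ → ℕ → Set
    Inside ℓ i a x = Next i x × a ≤ x × x < a + 2 ^ ℓ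

    Inside? : ∀ ℓ i a x → Dec (Inside ℓ i a x)
    Inside? ℓ i a x = Next? i x ×-dec (a ≤? x) ×-dec (x <? a + 2 ^ ℓ)

    -- A potential for the length of the candidate list: splitting does not increase the total, and
    -- every candidate kept has weight at least 1, so at most `K` survive a level.
    wt : ℕ → ℕ × ℕ → ℕ
    wt ℓ (i , a) = Σ< n (λ x → 𝟙 (does (Inside? ℓ i a x)))

    double : ∀ ℓ a → a + 2 ^ suc ℓ ≡ (a + 2 ^ ℓ) + 2 ^ ℓ
    double ℓ a = trans (cong (λ x → a + (2 ^ ℓ + x)) (+-identityʳ (2 ^ ℓ))) (sym (+-assoc a (2 ^ ℓ) (2 ^ ℓ)))

    wt-split : ∀ ℓ i a → wt ℓ (i , a) + wt ℓ (i , a + 2 ^ ℓ) ≤ wt (suc ℓ) (i , a)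
    wt-split ℓ i a = ≤-trans (≤-reflexive (sym (Σ<-+ n _ _))) (Σ<-mono n (λ x _ → pointwise x))
      where
      pointwise : ∀ x → 𝟙 (does (Inside? ℓ i a x)) + 𝟙 (does (Inside? ℓ i (a + 2 ^ ℓ) x)) ≤ 𝟙 (does (Inside? (suc ℓ) i a x))
      pointwise x with x <? a + 2 ^ ℓ
      ... | yes lt rewrite 𝟙-no (Inside? ℓ i (a + 2 ^ ℓ) x) (λ (_ , ge , _) → <⇒≱ lt ge) | +-identityʳ (𝟙 (does (Inside? ℓ i a x))) =
        𝟙-mono (Inside? ℓ i a x) (Inside? (suc ℓ) i a x)
          (λ (nx , ge , lt) → nx , ge , <-≤-trans lt (+-monoʳ-≤ a (m≤m+n (2 ^ ℓ) _)))
      ... | no ge rewrite 𝟙-no (Inside? ℓ i a x) (λ (_ , _ , lt) → ge lt) =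
        𝟙-mono (Inside? ℓ i (a + 2 ^ ℓ) x) (Inside? (suc ℓ) i a x)
          (λ (nx , ge , lt) → nx , ≤-trans (m≤m+n a _) ge , subst (x <_) (sym (double ℓ a)) lt)

    sum-split : ∀ ℓ cs → sumL (wt ℓ) (split ℓ cs) ≤ sumL (wt (suc ℓ)) cs
    sum-split ℓ []             = z≤n
    sum-split ℓ ((i , a) ∷ cs) = ≤-trans (≤-reflexive (sym (+-assoc (wt ℓ (i , a)) _ _)))
      (+-mono-≤ (wt-split ℓ i a) (sum-split ℓ cs))

    answer : ℕ → ℕ × ℕ → ℕ
    answer ℓ c = cnt n adj (asked prev cur ℓ c)

    wt-pos : ∀ ℓ i a → 0 < answer ℓ (i , a) → 0 < wt ℓ (i , a)
    wt-pos ℓ i a pos with cnt-pos n adj (asked prev cur ℓ (i , a)) pos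
    ... | u , x , u<n , x<n , t , e with does-T (asked? prev cur ℓ i a u x) t
    ...   | c , ¬c , ¬p , ge , lt = ≤-trans (≤-reflexive (sym (𝟙-yes (Inside? ℓ i a x) ((u , u<n , e , c , ¬c , ¬p) , ge , lt))))
      (Σ<-term n (λ x → 𝟙 (does (Inside? ℓ i a x))) x<n)

    answer-pos : ∀ ℓ i a x → Inside ℓ i a x → 0 < answer ℓ (i , a)
    answer-pos ℓ i a x ((u , u<n , e , c , ¬c , ¬p) , ge , lt) =
      pos-cnt n adj (asked prev cur ℓ (i , a)) u<n (proj₂ (E< e)) (T-does (asked? prev cur ℓ i a u x) (c , ¬c , ¬p , ge , lt)) e

    record Inv (ℓ : ℕ) (cand : Pairs) : Set where
      field
        covers  : ∀ {i x} → i < ks → Next i x → ∃[ a ] (i , a) ∈ cand × a ≤ x × x < a + 2 ^ ℓ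
        total   : sumL (wt ℓ) cand ≤ K
        -- The summand `ks` accommodates the initial list, which holds one untested candidate per
        -- source.
        bounded : length cand ≤ K + ks
        ranges  : All (λ (i , a) → i < ks × a + 2 ^ ℓ ≤ 2 ^ L) cand
    open Inv

    Inv-Ok : ∀ {ℓ cand} → Inv ℓ cand → Ok pairsC cand
    Inv-Ok {ℓ} inv = bounded inv , All.map (λ (i< , a≤) → <-≤-trans i< ks≤2^w ,
      <-≤-trans (m<m+n _ (m^n>0 2 ℓ)) (≤-trans a≤ (^-monoʳ-≤ 2 L≤w))) (ranges inv)

    refine-inv : ∀ ℓ cand → Inv (suc ℓ) cand → let cand′ = keep (split ℓ cand) (map (answer ℓ) (split ℓ cand)) in
                 Inv ℓ cand′ × All (λ c → 0 < wt ℓ c) cand′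
    refine-inv ℓ cand inv = record
      { covers = cov
      ; total = tot
      ; bounded = ≤-trans (length≤sumL (wt ℓ) pos) (≤-trans tot (m≤m+n K ks))
      ; ranges = All.map proj₁ (keep-All (answer ℓ) (split ℓ cand) (All-split ℓ
          (λ i a (i< , le) → (i< , ≤-trans (+-monoʳ-≤ a (m≤m+n (2 ^ ℓ) _)) le) , i< , subst (_≤ 2 ^ L) (double ℓ a) le)
          (ranges inv)))
      } , pos
      where
      cand′ = keep (split ℓ cand) (map (answer ℓ) (split ℓ cand))
      pos : All (λ c → 0 < wt ℓ c) cand′
      pos = All.map (λ { {i , a} (_ , p) → wt-pos ℓ i a p })
        (keep-All (answer ℓ) {P = λ _ → ⊤} (split ℓ cand) (All.universal (λ _ → tt) _))
      tot : sumL (wt ℓ) cand′ ≤ K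
      tot = ≤-trans (keep-sum (answer ℓ) (wt ℓ) (split ℓ cand)) (≤-trans (sum-split ℓ cand) (total inv))
      cov : ∀ {i x} → i < ks → Next i x → ∃[ a ] (i , a) ∈ cand′ × a ≤ x × x < a + 2 ^ ℓ
      cov {i} {x} i< nx with covers inv i< nx
      ... | a , a∈ , ge , lt with x <? a + 2 ^ ℓ
      ...   | yes lt′ = a , keep-∈ (answer ℓ) (split ℓ cand) (proj₁ (split-∈ ℓ a∈)) (answer-pos ℓ i a x (nx , ge , lt′)) , ge , lt′
      ...   | no ge′ = a + 2 ^ ℓ , keep-∈ (answer ℓ) (split ℓ cand) (proj₂ (split-∈ ℓ a∈)) (answer-pos ℓ i (a + 2 ^ ℓ) x (nx , in′)) , in′
        where
        in′ : a + 2 ^ ℓ ≤ x × x < (a + 2 ^ ℓ) + 2 ^ ℓ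
        in′ = ≮⇒≥ ge′ , subst (x <_) (double ℓ a) lt

    record Layer (cand : Pairs) : Set where
      field
        complete : ∀ {i x} → i < ks → Next i x → (i , x) ∈ cand
        sound    : ∀ {i x} → (i , x) ∈ cand → i < ks × Next i x
        short    : length cand ≤ K
        okay     : Ok pairsC cand

    layer : ∀ cand → Inv 0 cand → All (λ c → 0 < wt 0 c) cand → Layer cand
    layer cand inv pos = record
      { complete = comp
      ; sound = λ c∈ → proj₁ (All.lookup (ranges inv) c∈) , nx (Σ<-pos n _ (All.lookup pos c∈))
      ; short = ≤-trans (length≤sumL (wt 0) pos) (total inv)
      ; okay = Inv-Ok inv
      }
      where
      exactly : ∀ {a x} → a ≤ x → x < a + 1 → a ≡ x
      exactly {a} {x} ge lt = ≤-antisym ge (s≤s⁻¹ (subst (x <_) (+-comm a 1) lt))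
      comp : ∀ {i x} → i < ks → Next i x → (i , x) ∈ cand
      comp i< n with covers inv i< n
      ... | a , a∈ , ge , lt with exactly ge lt
      ...   | refl = a∈
      nx : ∀ {i a} → ∃[ x ] x < n × 0 < 𝟙 (does (Inside? 0 i a x)) → Next i a
      nx {i} {a} (x , _ , p) with 𝟙-pos (Inside? 0 i a x) p
      ... | next , ge , lt with exactly ge lt
      ...   | refl = next

    -- Positive weights, which make all final candidates genuine, result from a refinement; hence
    -- the level `suc ℓ` here and the hypotheses `L ≡ suc L′` later.
    expand-correct : Ok (pairsC ×C pairsC) (prev , cur) → ∀ ℓ cand → Inv (suc ℓ) cand →
                     WP Fit (expand (suc ℓ)) (λ (pc , cand′) → pc ≡ (prev , cur) × Layer cand′) ((prev , cur) , cand)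
    expand-correct ok ℓ cand inv = (ok , Inv-Ok inv) ,
      ≤-trans (≤-reflexive (trans (length-map _ (split ℓ cand)) (length-split ℓ cand)))
              (≤-trans (*-monoʳ-≤ 2 (bounded inv)) cap-ok) ,
      subst (WP Fit (expand ℓ) _) (cong (λ as → (prev , cur) , keep (split ℓ cand) as) (map-∘ (split ℓ cand))) (rest ℓ (refine-inv ℓ cand inv))
      where
      rest : ∀ ℓ {cand} → Inv ℓ cand × All (λ c → 0 < wt ℓ c) cand →
             WP Fit (expand ℓ) (λ (pc , cand′) → pc ≡ (prev , cur) × Layer cand′) ((prev , cur) , cand)
      rest zero    (inv , pos) = refl , layer _ inv pos
      rest (suc ℓ) (inv , _)   = expand-correct ok ℓ _ inv

    init-inv : Σ< ks (λ i → Σ< n (λ x → 𝟙 (does (Next? i x)))) ≤ K → Inv L (initCand ks)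
    init-inv tot = record
      { covers = λ {i} {x} i< nx → 0 , ∈-tab ks (λ i → i , 0) i< , z≤n , <-trans (proj₂ (E< (proj₁ (proj₂ (proj₂ nx))))) n<2^L
      ; total = ≤-trans (≤-reflexive (sumL-tab (wt L) ks (λ i → i , 0)))
          (≤-trans (Σ<-mono ks (λ i _ → Σ<-mono n (λ x _ → 𝟙-mono (Inside? L i 0 x) (Next? i x) proj₁))) tot)
      ; bounded = ≤-trans (≤-reflexive (length-tab ks _)) (m≤n+m ks K)
      ; ranges = All-tab ks (λ i i< → i< , ≤-refl)
      }

Σ<-pick : ∀ n (f : ℕ → ℕ) {i} → i < n → Σ< n (λ u → 𝟙 (does (u ≟ i)) * f u) ≡ f i
Σ<-pick (suc n) f {i} i<1+n with n ≟ i
... | yes refl rewrite 𝟙-yes (n ≟ n) refl = trans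
  (cong (_+ (f n + 0)) (trans (Σ<-cong n (λ u u<n → cong (_* f u) (𝟙-no (u ≟ n) (<⇒≢ u<n)))) (Σ<-0 n)))
  (+-identityʳ (f n))
... | no n≢i rewrite 𝟙-no (n ≟ i) n≢i = trans (+-identityʳ _) (Σ<-pick n f (≤∧≢⇒< (s≤s⁻¹ i<1+n) (≢-sym n≢i)))

∈-tab⁻ : {A : Set} (n : ℕ) (f : ℕ → A) {x : A} → x ∈ tab n f → ∃[ i ] i < n × x ≡ f i
∈-tab⁻ (suc n) f (here refl) = 0 , s≤s z≤n , refl
∈-tab⁻ (suc n) f (there x∈)  = let i , i<n , eq = ∈-tab⁻ n (f ∘ suc) x∈ in suc i , s≤s i<n , eq

-- Deterministic algorithm: all edges at vertices of degree at most d are stored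

module LowDegree (n L d : ℕ) where

  open Expand n using (State; expand; initCand; length-expand)

  row : ℕ → Query
  row i u x = does (u ≟ i)

  low? : ∀ (as : List ℕ) (c : ℕ × ℕ) → Dec (at as (proj₁ c) ≤ d)
  low? as c = at as (proj₁ c) ≤? d

  lows : List ℕ → Pairs
  lows as = filter (low? as) (tab n (λ i → i , i))

  -- Every vertex of low degree becomes a source whose current layer is the vertex itself, so a
  -- single expansion lists its neighbourhood.
  degreeStep : Step State
  degreeStep = mkStep (λ _ → tab n row) (λ _ as → ([] , lows as) , initCand n)

  -- Both directions are recorded; the reversed one enters a vertex of low degree, as `few-real`
  -- requires.
  edges : State → List Edge
  edges (_ , cand) = map (λ (i , x) → i , x , 1) cand ++ map (λ (i , x) → x , i , 1) cand

  open Finish n L edges using (finish; length-finish; initEst) renaming (State to FullState)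

  program : ℕ → List (Step FullState)
  program m = map onFst (map onFst (degreeStep ∷ expand L)) ++ finish m

  length-program : ∀ m → length (program m) ≡ suc L + (m * (L + 2) + suc L)
  length-program m = trans (length-++ (map onFst (map onFst (degreeStep ∷ expand L))))
    (cong₂ _+_ (trans (length-map onFst (map onFst (degreeStep ∷ expand L)))
                 (trans (length-map onFst (degreeStep ∷ expand L)) (cong suc (length-expand L))))
               (length-finish m))

  initial : ℕ → FullState
  initial r = ((([] , []) , []) , initEst r) , tab n (λ _ → 0)

  module Correct (G : Graph n) (2≤n : 2 ≤ n) (L′ : ℕ) (L≡ : L ≡ suc L′) (n<2^L : n < 2 ^ L) (w cap : ℕ) (L≤w : L ≤ w)
                 (cap-ok : 2 * (n * d + n) ≤ cap) (r : ℕ) (r<n : r < n) where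
    open Graph G
    open Hoare n adj cap

    pairsC : Codec Pairs
    pairsC = listC (n * d + n) (natC w ×C natC w)

    stateC : Codec State
    stateC = (pairsC ×C pairsC) ×C pairsC

    n≤cap : n ≤ cap
    n≤cap = ≤-trans (m≤n+m n (n * d)) (≤-trans (m≤m+n (n * d + n) _) cap-ok)

    n≤2^w : n ≤ 2 ^ w
    n≤2^w = ≤-trans (<⇒≤ n<2^L) (^-monoʳ-≤ 2 L≤w)

    module F = Finish.Correct n L edges G 2≤n n<2^L w cap L≤w n≤cap (Ok stateC) r r<n

    deg : ℕ → ℕ
    deg i = Σ< n (λ x → 𝟙 (adj i x))

    degrees : List ℕ
    degrees = map (cnt n adj) (tab n row)

    degrees-deg : ∀ {i} → i < n → at degrees i ≡ deg i
    degrees-deg {i} i<n = trans (cong (λ l → at l i) (map-tab (cnt n adj) n row)) (trans (nth-tab 0 n _ i<n)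
      (trans (Σ<-cong n (λ u _ → Σ<-*ˡ n (𝟙 (does (u ≟ i))) (λ v → 𝟙 (adj u v)))) (Σ<-pick n deg i<n)))

    cur : Pairs
    cur = lows degrees

    module X = Expand.Correct n G w L cap n (n * d) L≤w n≤2^w n<2^L cap-ok [] cur

    cur⁻ : ∀ {i u} → (i , u) ∈ cur → i < n × u ≡ i × deg i ≤ d
    cur⁻ {i} c∈ with ∈-filter⁻ (low? degrees) c∈
    ... | c∈′ , le with ∈-tab⁻ n _ c∈′
    ...   | j , j<n , refl = j<n , refl , subst (_≤ d) (degrees-deg j<n) le

    cur⁺ : ∀ {i} → i < n → deg i ≤ d → (i , i) ∈ cur
    cur⁺ i<n le = ∈-filter⁺ (low? degrees) (∈-tab n (λ i → i , i) i<n) (subst (_≤ d) (sym (degrees-deg i<n)) le)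

    total : Σ< n (λ i → Σ< n (λ x → 𝟙 (does (X.Next? i x)))) ≤ n * d
    total = Σ<-≤const n d (λ i i<n → layer-size i i<n)
      where
      next-adj : ∀ {i x} → X.Next i x → E i x
      next-adj (u , _ , e , c , _) with cur⁻ c
      ... | _ , refl , _ = e
      layer-size : ∀ i → i < n → Σ< n (λ x → 𝟙 (does (X.Next? i x))) ≤ d
      layer-size i i<n with deg i ≤? d
      ... | yes le = ≤-trans (Σ<-mono n (λ x _ → 𝟙-mono (X.Next? i x) (T? (adj i x)) next-adj)) le
      ... | no ¬le = ≤-trans (≤-reflexive (trans
        (Σ<-cong n (λ x _ → 𝟙-no (X.Next? i x) (λ (u , _ , e , c , _) → ¬le (proj₂ (proj₂ (cur⁻ c)))))) (Σ<-0 n))) z≤n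

    cur-Ok : Ok pairsC cur
    cur-Ok = ≤-trans (length-filter (low? degrees) (tab n (λ i → i , i)))
               (≤-trans (≤-reflexive (length-tab n _)) (m≤n+m n (n * d))) ,
             All.filter⁺ (low? degrees) (All-tab n (λ i i<n → <-≤-trans i<n n≤2^w , <-≤-trans i<n n≤2^w))

    Known : List Edge → Set
    Known es = F.SoundEdges es × (∀ {u v} → E u v → deg v ≤ d → (u , v , 1) ∈ es)

    layer-known : ∀ {pc cand} → X.Layer cand → Known (edges (pc , cand))
    layer-known {pc} {cand} lay = sound , complete
      where
      module Y = X.Layer lay
      edge : ∀ {i x} → (i , x) ∈ cand → E i x
      edge c∈ with proj₂ (Y.sound c∈)
      ... | u , _ , e , c , _ with cur⁻ c
      ...   | _ , refl , _ = e
      sound : F.SoundEdges (edges (pc , cand))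
      sound u v c e∈ v<n with ∈-++⁻ (map (λ (i , x) → i , x , 1) cand) e∈
      ... | inj₁ p with ∈-map⁻ _ p
      ...   | _ , c∈ , refl = proj₁ (E< (edge c∈)) , subst (dst r v ≤_) (+-comm 1 (dst r u)) (dst-step r<n (edge c∈))
      sound u v c e∈ v<n | inj₂ p with ∈-map⁻ _ p
      ...   | _ , c∈ , refl = proj₂ (E< (edge c∈)) , subst (dst r v ≤_) (+-comm 1 (dst r u)) (dst-step r<n (E-sym (edge c∈)))
      complete : ∀ {u v} → E u v → deg v ≤ d → (u , v , 1) ∈ edges (pc , cand)
      complete {u} {v} e le = ∈-++⁺ʳ (map (λ (i , x) → i , x , 1) cand) (∈-map⁺ (λ (i , x) → x , i , 1)
        (Y.complete v<n (v , v<n , E-sym e , cur⁺ v<n le ,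
          (λ c → E-irr (subst (λ x → E x v) (proj₁ (proj₂ (cur⁻ c))) e)) , λ ())))
        where v<n = proj₂ (E< e)

    ball : ℕ → ℕ
    ball j = Σ< n (λ x → 𝟙 (does (dst r x <? j)))

    ball-mono : ∀ {i j} → i ≤ j → ball i ≤ ball j
    ball-mono {i} {j} le = Σ<-mono n (λ x _ → 𝟙-mono (dst r x <? i) (dst r x <? j) (λ lt → <-≤-trans lt le))

    ball≤n : ∀ j → ball j ≤ n
    ball≤n j = subst (ball j ≤_) (*-identityʳ n) (Σ<-≤const n 1 (λ x _ → 𝟙≤1 _))

    -- The neighbours of a vertex lie in three consecutive layers.
    deg-ball : ∀ {v J} → dst r v ≡ suc J → deg v + ball J ≤ ball (3 + J)
    deg-ball {v} {J} eq = ≤-trans (≤-reflexive (sym (Σ<-+ n _ _))) (Σ<-mono n (λ x _ → pointwise x (T? (adj v x))))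
      where
      pointwise : ∀ x → Dec (E v x) → 𝟙 (adj v x) + 𝟙 (does (dst r x <? J)) ≤ 𝟙 (does (dst r x <? 3 + J))
      pointwise x (yes e) rewrite 𝟙-no (dst r x <? J)
          (λ lt → <⇒≱ lt (s≤s⁻¹ (subst (_≤ suc (dst r x)) eq (dst-step r<n (E-sym e))))) | +-identityʳ (𝟙 (adj v x)) =
        𝟙-mono (T? (adj v x)) (dst r x <? 3 + J) (λ _ → s≤s (subst (λ k → dst r x ≤ suc k) eq (dst-step r<n e)))
      pointwise x (no ¬e) rewrite 𝟙-no (T? (adj v x)) ¬e =
        𝟙-mono (dst r x <? J) (dst r x <? 3 + J) (λ lt → <-≤-trans lt (m≤n+m J 3))

    -- The sum of three consecutive balls is a potential. From `J` to `suc J` it grows by the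
    -- difference of `ball (3 + J)` and `ball J`, which by `deg-ball` is at least the degree of the
    -- vertex entered; so each real edge is paid for with `suc d`.
    few-real : ∀ es → Known es → ∀ J v → v < n → dst r v ≡ J →
               ∃[ m ] F.Hyb es m v J × m * suc d ≤ ball J + ball (1 + J) + ball (2 + J)
    few-real es kn zero v v<n eq = 0 , subst (λ x → F.Hyb es 0 x 0) (dst-0 r<n v<n eq) F.root , z≤n
    few-real es kn (suc J) v v<n eq with dst-pred r<n v<n eq
    ... | u , e , equ with few-real es kn J u (proj₁ (E< e)) equ | deg v ≤? d
    ...   | m , p , le | yes low = m , subst (F.Hyb es m v) (+-comm J 1) (F.known p (proj₂ kn e low) ≤-refl v<n) ,
      ≤-trans le (+-mono-≤ (+-mono-≤ (ball-mono (n≤1+n J)) (ball-mono (n≤1+n (1 + J)))) (ball-mono (n≤1+n (2 + J))))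
    ...   | m , p , le | no high = suc m , F.real p e , (begin
        suc d + m * suc d                                       ≤⟨ +-mono-≤ (≰⇒> high) le ⟩
        deg v + (ball J + ball (1 + J) + ball (2 + J))          ≡⟨ lem (deg v) (ball J) (ball (1 + J)) (ball (2 + J)) ⟩
        ball (1 + J) + ball (2 + J) + (deg v + ball J)          ≤⟨ +-monoʳ-≤ (ball (1 + J) + ball (2 + J)) (deg-ball eq) ⟩
        ball (1 + J) + ball (2 + J) + ball (3 + J)              ∎)
      where
      open ≤-Reasoning
      lem : ∀ a b c d → a + (b + c + d) ≡ c + d + (a + b)
      lem = solve-∀

    program-correct : ∀ m → 3 * n < suc m * suc d → WP F.Fit (program m) F.Result (initial r)
    program-correct m few = WP-seq (map onFst (map onFst (degreeStep ∷ expand L))) (finish m)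
      (λ { ((a , _) , _) (((lay , oka) , refl) , refl) → WP-mono (finish m) (λ _ → proj₁) _
            (F.finish-correct a _ m oka F.zeros-Ok (proj₁ (layer-known {proj₁ a} lay)) (hyb a (layer-known {proj₁ a} lay))) })
      _
      (WP-onFst (map onFst (degreeStep ∷ expand L)) _ _ F.zeros-Ok
        (WP-onFst (degreeStep ∷ expand L) _ _ F.initEst-Ok
          ((((z≤n , []) , (z≤n , [])) , (z≤n , [])) , ≤-trans (≤-reflexive (length-tab n row)) n≤cap , layers L′ L≡)))
      where
      layers : ∀ ℓ → L ≡ suc ℓ → WP (Ok stateC) (expand L) (λ (pc , cand) → X.Layer cand × Ok stateC (pc , cand)) (([] , cur) , initCand n)
      layers ℓ refl = WP-mono (expand (suc ℓ))
        (λ { _ (refl , lay) → lay , (((z≤n , []) , cur-Ok) , X.Layer.okay lay) }) _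
        (X.expand-correct ((z≤n , []) , cur-Ok) ℓ _ (X.init-inv total))
      hyb : ∀ a → Known (edges a) → ∀ v → v < n → ∃[ m′ ] m′ ≤ m × F.Hyb (edges a) m′ v (dst r v)
      hyb a kn v v<n with few-real (edges a) kn (dst r v) v v<n refl
      -- The potential never exceeds `3 * n`, which is the source of the condition on `m` and `d`.
      ... | m′ , p , le = m′ , s≤s⁻¹ (*-cancelʳ-< (suc d) m′ (suc m) (≤-<-trans (≤-trans le
              (≤-trans (+-mono-≤ (+-mono-≤ (ball≤n j) (ball≤n (1 + j))) (ball≤n (2 + j))) (≤-reflexive (lem n)))) few)) , p
        where
        j = dst r v
        lem : ∀ n → n + n + n ≡ 3 * n
        lem = solve-∀

-- Layer sizes of delayed searches, independent of the algorithm

module Load {n : ℕ} (G : Graph n) where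
  open Graph G

  OnLayer : ℕ → ℕ × ℕ → ℕ → Set
  OnLayer τ (t , δ) x = t < n × dst t x + δ ≡ τ

  OnLayer? : ∀ τ s x → Dec (OnLayer τ s x)
  OnLayer? τ (t , δ) x = (t <? n) ×-dec (dst t x + δ ≟ τ)

  layerSize : ℕ → ℕ × ℕ → ℕ
  layerSize τ s = Σ< n (λ x → 𝟙 (does (OnLayer? τ s x)))

-- Randomized algorithm: staggered searches from sampled sources.  A source is a
-- pair (vertex , delay); vertex numbers ≥ n denote sources that do nothing.

module Sampled (n L ks : ℕ) where

  open Expand n using (expand; initCand; length-expand) renaming (State to ExpandState)

  State : Set
  State = (Pairs × List (List ℕ)) × ExpandState

  src : Pairs → ℕ → ℕ × ℕ
  src = nth (0 , 0)

  look : List (List ℕ) → ℕ → ℕ → ℕ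
  look table i j = at (nth [] table i) j

  tab² : (ℕ → ℕ → ℕ) → List (List ℕ)
  tab² f = tab ks (λ i → tab ks (f i))

  look-tab² : ∀ f {i j} → i < ks → j < ks → look (tab² f) i j ≡ f i j
  look-tab² f {i} {j} i< j< = trans (cong (λ row → at row j) (nth-tab [] ks (λ i → tab ks (f i)) i<)) (nth-tab 0 ks (f i) j<)

  starting? : ∀ srcs τ (c : ℕ × ℕ) → Dec (proj₂ (src srcs (proj₁ c)) ≡ τ × proj₂ c < n)
  starting? srcs τ (i , t) = (proj₂ (src srcs i) ≟ τ) ×-dec (t <? n)

  starters : Pairs → ℕ → Pairs
  starters srcs τ = filter (starting? srcs τ) (tab ks (λ i → i , proj₁ (src srcs i)))

  -- A source starts at the time given by its delay, so a vertex on its layer at time `τ` lies at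
  -- distance `τ` minus that delay.
  updated : Pairs → List (List ℕ) → Pairs → ℕ → ℕ → ℕ → ℕ
  updated srcs table cur τ i j =
    if does ((i , proj₁ (src srcs j)) ∈? cur) then look table i j ⊓ (τ ∸ proj₂ (src srcs i)) else look table i j

  collect : ℕ → State → State
  collect τ ((srcs , table) , ((prev , cur) , cand)) =
    let cur′ = cand ++ starters srcs τ in
    (srcs , tab² (updated srcs table cur′ τ)) , ((cur , cur′) , initCand ks)

  body : ℕ → List (Step State)
  body τ = map onSnd (expand L) ++ offline (collect (suc τ)) ∷ []

  rawEdges : State → List Edge
  rawEdges ((srcs , table) , _) = concat (tab ks (λ i → tab ks (λ j → proj₁ (src srcs i) , proj₁ (src srcs j) , look table i j)))

  inRange? : (e : Edge) → Dec (proj₁ e < n)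
  inRange? e = proj₁ e <? n

  edges : State → List Edge
  edges s = filter inRange? (rawEdges s)

  open Finish n L edges using (finish; length-finish; initEst) renaming (State to FullState)

  -- The `2 * h` rounds leave room for a delay of at most `h` followed by `h` layers; the `h`
  -- relaxation rounds cover the stretch from the last source on a shortest path to its end.
  program : ℕ → List (Step FullState)
  program h = map onFst (map onFst (loop body (2 * h))) ++ finish h

  length-program : ∀ h → length (program h) ≡ 2 * h * suc L + (h * (L + 2) + suc L)
  length-program h = trans (length-++ (map onFst (map onFst (loop body (2 * h)))))
    (cong₂ _+_ (trans (length-map onFst (map onFst (loop body (2 * h))))
                 (trans (length-map onFst (loop body (2 * h))) (length-loop body (suc L) length-body (2 * h))))
               (length-finish h))
    where
    length-body : ∀ τ → length (body τ) ≡ suc L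
    length-body τ = trans (length-++ (map onSnd (expand L)))
      (trans (cong (_+ 1) (trans (length-map onSnd (expand L)) (length-expand L))) (+-comm L 1))

  start : Pairs → State
  start srcs = (srcs , tab² (λ _ _ → 2 ^ L ∸ 1)) , (([] , starters srcs 0) , initCand ks)

  initial : Pairs → ℕ → FullState
  initial srcs r = (start srcs , initEst r) , tab n (λ _ → 0)

  module Correct (G : Graph n) (2≤n : 2 ≤ n) (L′ : ℕ) (L≡ : L ≡ suc L′) (n<2^L : n < 2 ^ L) (w cap K : ℕ) (L≤w : L ≤ w)
                 (ks≤2^w : ks ≤ 2 ^ w) (cap-ok : 2 * (K + ks) ≤ cap) (n≤cap : n ≤ cap) (r : ℕ) (r<n : r < n)
                 (srcs : Pairs) (length-srcs : length srcs ≡ ks)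
                 (srcs-ok : All (λ (t , δ) → t < 2 ^ w × δ < 2 ^ w) srcs)
                 (h : ℕ) (load : ∀ τ → τ < 2 * h → sumL (Load.layerSize G (suc τ)) srcs ≤ K) where
    open Graph G
    open Hoare n adj cap
    open Load G

    pairsC : Codec Pairs
    pairsC = listC (K + ks) (natC w ×C natC w)

    expandC : Codec ExpandState
    expandC = (pairsC ×C pairsC) ×C pairsC

    tableC : Codec (List (List ℕ))
    tableC = listC ks (listC ks (natC w))

    staticC : Codec (Pairs × List (List ℕ))
    staticC = listC ks (natC w ×C natC w) ×C tableC

    stateC : Codec State
    stateC = staticC ×C expandC

    module F = Finish.Correct n L edges G 2≤n n<2^L w cap L≤w n≤cap (Ok stateC) r r<n

    n≤2^w : n ≤ 2 ^ w
    n≤2^w = ≤-trans (<⇒≤ n<2^L) (^-monoʳ-≤ 2 L≤w)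

    t δ : ℕ → ℕ
    t i = proj₁ (src srcs i)
    δ i = proj₂ (src srcs i)

    starters⁻ : ∀ {τ i x} → (i , x) ∈ starters srcs τ → i < ks × x ≡ t i × x < n × δ i ≡ τ
    starters⁻ {τ} c∈ with ∈-filter⁻ (starting? srcs τ) c∈
    ... | c∈′ , eq , lt with ∈-tab⁻ ks _ c∈′
    ...   | j , j< , refl = j< , refl , lt , eq

    starters⁺ : ∀ {i} → i < ks → t i < n → (i , t i) ∈ starters srcs (δ i)
    starters⁺ {i} i< lt = ∈-filter⁺ (starting? srcs (δ i)) (∈-tab ks (λ i → i , t i) i<) (refl , lt)

    starters-All : ∀ τ → All (Ok (natC w ×C natC w)) (starters srcs τ)
    starters-All τ = All.tabulate λ { {i , x} c∈ → let i< , _ , x<n , _ = starters⁻ {τ} c∈ in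
      <-≤-trans i< ks≤2^w , <-≤-trans x<n n≤2^w }

    length-starters : ∀ τ → length (starters srcs τ) ≤ ks
    length-starters τ = ≤-trans (length-filter (starting? srcs τ) (tab ks (λ i → i , t i))) (≤-reflexive (length-tab ks _))

    Frontier : ℕ → Pairs → Set
    Frontier τ cur = (∀ {i x} → (i , x) ∈ cur → i < ks × x < n × t i < n × dst (t i) x + δ i ≡ τ)
                   × (∀ {i x} → i < ks → x < n → t i < n → dst (t i) x + δ i ≡ τ → (i , x) ∈ cur)

    -- The layer of time `τ ∸ 1`, written with `suc` so that nothing precedes time 0.
    Former : ℕ → Pairs → Set
    Former τ prev = (∀ {i x} → (i , x) ∈ prev → i < ks × x < n × t i < n × suc (dst (t i) x + δ i) ≡ τ)
                  × (∀ {i x} → i < ks → x < n → t i < n → suc (dst (t i) x + δ i) ≡ τ → (i , x) ∈ prev)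

    record Table (τ : ℕ) (table : List (List ℕ)) : Set where
      field
        small    : ∀ {i j} → i < ks → j < ks → look table i j < 2 ^ L
        fits     : Ok tableC table
        sound    : ∀ {i j} → i < ks → j < ks → t i < n → t j < n → dst r (t j) ≤ dst r (t i) + look table i j
        -- Distance 0 is excluded because the layer of time 0 is formed without updating the table;
        -- `Hyb` accepts known edges of positive weight.
        complete : ∀ {i j} → i < ks → j < ks → t i < n → t j < n → 1 ≤ dst (t i) (t j) →
                   dst (t i) (t j) + δ i ≤ τ → look table i j ≤ dst (t i) (t j)

    record Inv (τ : ℕ) (s : State) : Set where
      constructor mkInv
      field
        {table}     : List (List ℕ)
        {prev cur}  : Pairs
        shape       : s ≡ ((srcs , table) , ((prev , cur) , initCand ks))
        frontier    : Frontier τ cur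
        former      : Former τ prev
        prev-ok     : Ok pairsC prev
        cur-ok      : Ok pairsC cur
        table-spec  : Table τ table

    tab²-ok : ∀ f → (∀ {i j} → i < ks → j < ks → f i j < 2 ^ L) → Ok tableC (tab² f)
    tab²-ok f lt = Ok-tab (listC ks (natC w)) ks (λ i i< → Ok-tab (natC w) ks (λ j j< → <-≤-trans (lt i< j<) (^-monoʳ-≤ 2 L≤w)))

    infinity : 2 ^ L ∸ 1 < 2 ^ L
    infinity = ≤-reflexive (m+[n∸m]≡n (m^n>0 2 L))

    initCand-ok : Ok pairsC (initCand ks)
    initCand-ok = ≤-trans (≤-reflexive (length-tab ks _)) (m≤n+m ks K) ,
      All-tab ks (λ i i< → <-≤-trans i< ks≤2^w , m^n>0 2 w)

    Inv-fits : ∀ {τ s} → Inv τ s → Ok stateC s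
    Inv-fits (mkInv refl _ _ p c ts) =
      ((≤-reflexive length-srcs , srcs-ok) , Table.fits ts) , ((p , c) , initCand-ok)

    start-inv : Inv 0 (start srcs)
    start-inv = mkInv refl
      ( (λ c∈ → let i< , x≡ , x<n , δ≡ = starters⁻ {0} c∈ in
          i< , x<n , subst (_< n) x≡ x<n ,
          cong₂ _+_ (trans (cong (dst _) x≡) (dst-refl (subst (_< n) x≡ x<n))) δ≡)
      , (λ {i} {x} i< x<n t<n eq → subst₂ (λ y z → (i , y) ∈ starters srcs z)
          (dst-0 t<n x<n (m+n≡0⇒m≡0 (dst (t i) x) eq)) (m+n≡0⇒n≡0 (dst (t i) x) eq) (starters⁺ i< t<n)))
      ((λ ()) , λ _ _ _ ())
      (z≤n , [])
      (≤-trans (length-starters 0) (m≤n+m ks K) , starters-All 0)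
      record
        { small = λ i< j< → subst (_< 2 ^ L) (sym (look-tab² (λ _ _ → 2 ^ L ∸ 1) i< j<)) infinity
        ; fits = tab²-ok _ (λ _ _ → infinity)
        ; sound = λ i< j< ti tj → ≤-trans (≤-trans (<⇒≤ (dst<n r<n tj)) (∸-monoˡ-≤ 1 n<2^L))
            (≤-trans (≤-reflexive (sym (look-tab² (λ _ _ → 2 ^ L ∸ 1) i< j<))) (m≤n+m _ _))
        ; complete = λ {i} {j} i< j< ti tj 1≤ le → ⊥-elim (<⇒≱ (≤-trans 1≤ (m≤m+n _ (δ i))) le)
        }

    module Round (τ : ℕ) (τ< : τ < 2 * h) (table : List (List ℕ)) (prev cur : Pairs) (fr : Frontier τ cur) (fo : Former τ prev)
                 (prev-ok : Ok pairsC prev) (cur-ok : Ok pairsC cur) (ts : Table τ table) where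

      module X = Expand.Correct n G w L cap ks K L≤w ks≤2^w n<2^L cap-ok prev cur

      next⇒ : ∀ {i x} → X.Next i x → i < ks × x < n × t i < n × dst (t i) x + δ i ≡ suc τ
      next⇒ {i} {x} (u , u<n , e , c , ¬c , ¬p) with proj₁ fr c
      ... | i< , _ , ti , eq = i< , x<n , ti , ≤-antisym upper lower
        where
        x<n = proj₂ (E< e)
        upper : dst (t i) x + δ i ≤ suc τ
        upper = subst (λ y → dst (t i) x + δ i ≤ suc y) eq (+-monoˡ-≤ (δ i) (dst-step ti e))
        lower′ : τ ≤ suc (dst (t i) x + δ i)
        lower′ = subst (_≤ suc (dst (t i) x + δ i)) eq (+-monoˡ-≤ (δ i) (dst-step ti (E-sym e)))
        lower : suc τ ≤ dst (t i) x + δ i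
        lower = ≤∧≢⇒< (s≤s⁻¹ (≤∧≢⇒< lower′ (λ q → ¬p (proj₂ fo i< x<n ti (sym q)))))
                      (λ q → ¬c (proj₂ fr i< x<n ti (sym q)))

      next⇐ : ∀ {i x j} → i < ks → x < n → t i < n → dst (t i) x + δ i ≡ suc τ → dst (t i) x ≡ suc j → X.Next i x
      next⇐ {i} {x} {j} i< x<n ti eq eqj with dst-pred ti x<n eqj
      ... | u , e , equ = u , proj₁ (E< e) , e ,
        proj₂ fr i< (proj₁ (E< e)) ti (trans (cong (_+ δ i) equ) (suc-injective (trans (cong (_+ δ i) (sym eqj)) eq))) ,
        (λ c → 1+n≢n (trans (sym eq) (proj₂ (proj₂ (proj₂ (proj₁ fr c)))))) ,
        (λ p → m+1+n≢n 1 (trans (cong suc (sym eq)) (proj₂ (proj₂ (proj₂ (proj₁ fo p))))))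

      total : Σ< ks (λ i → Σ< n (λ x → 𝟙 (does (X.Next? i x)))) ≤ K
      total = begin
        Σ< ks (λ i → Σ< n (λ x → 𝟙 (does (X.Next? i x))))
          ≤⟨ Σ<-mono ks (λ i _ → Σ<-mono n (λ x _ → 𝟙-mono (X.Next? i x) (OnLayer? (suc τ) (src srcs i) x)
               (λ nx → proj₂ (proj₂ (next⇒ nx))))) ⟩
        Σ< ks (λ i → layerSize (suc τ) (src srcs i))
          ≡⟨ cong (λ k → Σ< k (λ i → layerSize (suc τ) (src srcs i))) length-srcs ⟨
        Σ< (length srcs) (λ i → layerSize (suc τ) (src srcs i))
          ≡⟨ sumL-nth (0 , 0) (layerSize (suc τ)) srcs ⟩
        sumL (layerSize (suc τ)) srcs
          ≤⟨ load τ τ< ⟩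
        K ∎
        where open ≤-Reasoning

      module _ (cand : Pairs) (lay : X.Layer cand) where
        module Y = X.Layer lay

        cur′ : Pairs
        cur′ = cand ++ starters srcs (suc τ)

        frontier′ : Frontier (suc τ) cur′
        frontier′ = sound , complete
          where
          sound : ∀ {i x} → (i , x) ∈ cur′ → i < ks × x < n × t i < n × dst (t i) x + δ i ≡ suc τ
          sound {i} c∈ with ∈-++⁻ cand c∈
          ... | inj₁ p = next⇒ (proj₂ (Y.sound p))
          ... | inj₂ p with starters⁻ {suc τ} p
          ...   | i< , refl , ti , eq = i< , ti , ti , trans (cong (_+ δ i) (dst-refl ti)) eq
          complete : ∀ {i x} → i < ks → x < n → t i < n → dst (t i) x + δ i ≡ suc τ → (i , x) ∈ cur′
          complete {i} {x} i< x<n ti eq with dst (t i) x in eqd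
          ... | suc j = ∈-++⁺ˡ (Y.complete i< (next⇐ i< x<n ti (trans (cong (_+ δ i) eqd) eq) eqd))
          ... | zero = ∈-++⁺ʳ cand (subst₂ (λ y z → (i , y) ∈ starters srcs z) (dst-0 ti x<n eqd) eq (starters⁺ i< ti))

        table′ : List (List ℕ)
        table′ = tab² (updated srcs table cur′ (suc τ))

        old : ∀ {i j} → updated srcs table cur′ (suc τ) i j ≤ look table i j
        old {i} {j} with does ((i , t j) ∈? cur′)
        ... | true  = m⊓n≤m _ _
        ... | false = ≤-refl

        spec′ : Table (suc τ) table′
        spec′ = record
          { small = λ {i} {j} i< j< → subst (_< 2 ^ L) (sym (look-tab² (updated srcs table cur′ (suc τ)) i< j<)) (lt {i} {j} i< j<)
          ; fits = tab²-ok _ lt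
          ; sound = λ {i} {j} i< j< ti tj → subst (λ y → dst r (t j) ≤ dst r (t i) + y)
              (sym (look-tab² (updated srcs table cur′ (suc τ)) i< j<)) (snd i< j< ti tj ((i , t j) ∈? cur′))
          ; complete = λ {i} {j} i< j< ti tj 1≤ le → ≤-trans (≤-reflexive (look-tab² (updated srcs table cur′ (suc τ)) i< j<))
              (cmp i< j< ti tj 1≤ (m≤n⇒m<n∨m≡n le))
          }
          where
          lt : ∀ {i j} → i < ks → j < ks → updated srcs table cur′ (suc τ) i j < 2 ^ L
          lt {i} {j} i< j< = ≤-<-trans (old {i} {j}) (Table.small ts i< j<)
          snd : ∀ {i j} → i < ks → j < ks → t i < n → t j < n → Dec ((i , t j) ∈ cur′) →
                dst r (t j) ≤ dst r (t i) + updated srcs table cur′ (suc τ) i j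
          snd {i} {j} i< j< ti tj (no ¬c) = subst (λ y → dst r (t j) ≤ dst r (t i) + y)
            (sym (if-no ((i , t j) ∈? cur′) ¬c)) (Table.sound ts i< j< ti tj)
          snd {i} {j} i< j< ti tj (yes c) = subst (λ y → dst r (t j) ≤ dst r (t i) + y)
            (sym (if-yes ((i , t j) ∈? cur′) c))
            (subst (dst r (t j) ≤_) (sym (+-distribˡ-⊓ (dst r (t i)) _ _))
              (⊓-glb (Table.sound ts i< j< ti tj)
                (subst (λ y → dst r (t j) ≤ dst r (t i) + y)
                  (sym (trans (cong (_∸ δ i) (sym (proj₂ (proj₂ (proj₂ (proj₁ frontier′ c)))))) (m+n∸n≡m _ (δ i))))
                  (triangle r<n ti tj))))
          cmp : ∀ {i j} → i < ks → j < ks → t i < n → t j < n → 1 ≤ dst (t i) (t j) →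
                dst (t i) (t j) + δ i < suc τ ⊎ dst (t i) (t j) + δ i ≡ suc τ →
                updated srcs table cur′ (suc τ) i j ≤ dst (t i) (t j)
          cmp {i} {j} i< j< ti tj 1≤ (inj₁ l) = ≤-trans (old {i} {j}) (Table.complete ts i< j< ti tj 1≤ (s≤s⁻¹ l))
          cmp {i} {j} i< j< ti tj 1≤ (inj₂ eq) =
            ≤-trans (≤-reflexive (if-yes ((i , t j) ∈? cur′) (proj₂ frontier′ i< tj ti eq)))
              (≤-trans (m⊓n≤n (look table i j) _)
                (≤-reflexive (trans (cong (_∸ δ i) (sym eq)) (m+n∸n≡m _ (δ i)))))

        inv′ : Inv (suc τ) (collect (suc τ) ((srcs , table) , ((prev , cur) , cand)))
        inv′ = mkInv refl frontier′
          ( (λ c → let i< , x< , ti , eq = proj₁ fr c in i< , x< , ti , cong suc eq)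
          , (λ i< x< ti eq → proj₂ fr i< x< ti (suc-injective eq)))
          cur-ok
          (≤-trans (≤-reflexive (length-++ cand)) (+-mono-≤ Y.short (length-starters (suc τ))) ,
            All.++⁺ (proj₂ Y.okay) (starters-All (suc τ)))
          spec′

      round-correct : ∀ ℓ → L ≡ suc ℓ → WP (Ok stateC) (body τ) (Inv (suc τ)) ((srcs , table) , ((prev , cur) , initCand ks))
      round-correct ℓ refl = WP-seq (map onSnd (expand L)) (offline (collect (suc τ)) ∷ [])
        (λ { (_ , (_ , cand)) (refl , (refl , lay)) →
             (static-ok , ((prev-ok , cur-ok) , X.Layer.okay lay)) , z≤n , inv′ cand lay })
        _
        (WP-onSnd (expand L) _ _ static-ok (X.expand-correct (prev-ok , cur-ok) ℓ _ (X.init-inv total)))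
        where
        static-ok : Ok staticC (srcs , table)
        static-ok = (≤-reflexive length-srcs , srcs-ok) , Table.fits ts

    body-correct : ∀ τ → τ < 2 * h → ∀ s → Inv τ s → WP (Ok stateC) (body τ) (Inv (suc τ)) s
    body-correct τ τ< s (mkInv refl fr fo p c ts) = Round.round-correct τ τ< _ _ _ fr fo p c ts L′ L≡

    module Recover (root-src : src srcs 0 ≡ (r , 0)) (0<ks : 0 < ks) (delays : ∀ {i} → i < ks → δ i ≤ h)
                   (hits : ∀ v → v < n → h < dst r v → ∃[ i ] i < ks × t i < n × 1 ≤ dst (t i) v × dst (t i) v ≤ h
                                                     × dst r (t i) + dst (t i) v ≡ dst r v) where

      module _ (s : State) (inv : Inv (2 * h) s) where

        open Inv inv using (table; table-spec)

        es : List Edge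
        es = edges s

        edge⁻ : ∀ {u v c} → (u , v , c) ∈ es → u < n × (∃[ i ] ∃[ j ] i < ks × j < ks × u ≡ t i × v ≡ t j × c ≡ look table i j)
        edge⁻ e∈ with Inv.shape inv
        ... | refl with ∈-filter⁻ inRange? e∈
        ...   | e∈′ , u<n with ∈-concat⁻′ (tab ks _) e∈′
        ...     | row , p , q with ∈-tab⁻ ks _ q
        ...       | i , i< , refl with ∈-tab⁻ ks _ p
        ...         | j , j< , refl = u<n , i , j , i< , j< , refl , refl , refl

        edge⁺ : ∀ {i j} → i < ks → j < ks → t i < n → (t i , t j , look table i j) ∈ es
        edge⁺ {i} {j} i< j< ti with Inv.shape inv
        ... | refl = ∈-filter⁺ inRange? (∈-concat⁺′ (∈-tab ks (λ j → t i , t j , look table i j) j<)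
                (∈-tab ks (λ i → tab ks (λ j → t i , t j , look table i j)) i<)) ti

        sound-edges : F.SoundEdges es
        sound-edges u v c e∈ v<n with edge⁻ e∈
        ... | u<n , i , j , i< , j< , refl , refl , refl = u<n , Table.sound table-spec i< j< u<n v<n

        -- The upper bound is completeness at time `2 * h`. The lower bound follows from soundness
        -- relative to `r`, because `t i` lies on a shortest path from `r` to `t j`.
        exact-edge : ∀ {i j} → i < ks → j < ks → t i < n → t j < n → 1 ≤ dst (t i) (t j) → dst (t i) (t j) ≤ h →
                     dst r (t i) + dst (t i) (t j) ≡ dst r (t j) → look table i j ≡ dst (t i) (t j)
        exact-edge {i} {j} i< j< ti tj 1≤ ≤h eq = ≤-antisym
          (Table.complete table-spec i< j< ti tj 1≤
            (subst (dst (t i) (t j) + δ i ≤_) (cong (h +_) (sym (+-identityʳ h))) (+-mono-≤ ≤h (delays i<))))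
          (+-cancelˡ-≤ (dst r (t i)) _ _ (subst (_≤ dst r (t i) + look table i j) (sym eq) (Table.sound table-spec i< j< ti tj)))

        follow : ∀ {i j} → i < ks → j < ks → t i < n → t j < n → 1 ≤ dst (t i) (t j) → dst (t i) (t j) ≤ h →
                 dst r (t i) + dst (t i) (t j) ≡ dst r (t j) → F.Hyb es 0 (t i) (dst r (t i)) → F.Hyb es 0 (t j) (dst r (t j))
        follow {i} {j} i< j< ti tj 1≤ ≤h eq p =
          subst (F.Hyb es 0 (t j)) (trans (cong (dst r (t i) +_) c≡) eq)
            (F.known p (edge⁺ i< j< ti) (subst (1 ≤_) (sym c≡) 1≤) tj)
          where c≡ = exact-edge i< j< ti tj 1≤ ≤h eq

        -- Induction on the distance, with `b` as its bound. A source beyond distance `h` has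
        -- another source at most `h` before it on a shortest path; one within distance `h` is
        -- linked directly to source 0, which is the root. So sources are reached by known edges
        -- alone.
        sources : ∀ b {j} → j < ks → t j < n → dst r (t j) < b → F.Hyb es 0 (t j) (dst r (t j))
        sources (suc b) {j} j< tj lt with dst r (t j) ≟ 0 | dst r (t j) ≤? h
        ... | yes eq | _ = subst₂ (F.Hyb es 0) (dst-0 r<n tj eq) (sym eq) F.root
        ... | no ne | yes ≤h = follow 0<ks j< (subst (_< n) (sym t0) r<n) tj
                (subst (λ y → 1 ≤ dst y (t j)) (sym t0) (n≢0⇒n>0 ne)) (subst (λ y → dst y (t j) ≤ h) (sym t0) ≤h)
                (subst (λ y → dst r y + dst y (t j) ≡ dst r (t j)) (sym t0) (cong (_+ dst r (t j)) (dst-refl r<n)))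
                (subst₂ (F.Hyb es 0) (sym t0) (sym (trans (cong (dst r) t0) (dst-refl r<n))) F.root)
          where
          t0 : t 0 ≡ r
          t0 = cong proj₁ root-src
        ... | no ne | no ≰h with hits (t j) tj (≰⇒> ≰h)
        ...   | i , i< , ti , 1≤ , ≤h , eq = follow i< j< ti tj 1≤ ≤h eq
                (sources b i< ti (<-≤-trans (subst (dst r (t i) <_) eq (m<m+n _ 1≤)) (s≤s⁻¹ lt)))

        walk : ∀ k {u v m ℓ} → u < n → v < n → dst u v ≡ k → F.Hyb es m u ℓ → F.Hyb es (m + k) v (ℓ + k)
        walk zero {u} {v} {m} {ℓ} u<n v<n eq p rewrite +-identityʳ m | +-identityʳ ℓ = subst (λ x → F.Hyb es m x ℓ) (dst-0 u<n v<n eq) p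
        walk (suc k) {u} {v} {m} {ℓ} u<n v<n eq p with dst-pred u<n v<n eq
        ... | x , e , eqx rewrite +-suc m k | +-suc ℓ k = F.real (walk k u<n (proj₁ (E< e)) eqx p) e

        hybrid : ∀ v → v < n → ∃[ m ] m ≤ h × F.Hyb es m v (dst r v)
        hybrid v v<n with dst r v ≤? h
        ... | yes ≤h = dst r v , ≤h , walk (dst r v) r<n v<n refl F.root
        ... | no ≰h with hits v v<n (≰⇒> ≰h)
        ...   | i , i< , ti , _ , ≤h , eq = dst (t i) v , ≤h ,
                subst (F.Hyb es (dst (t i) v) v) eq (walk (dst (t i) v) ti v<n refl (sources _ i< ti ≤-refl))

      program-correct : WP F.Fit (program h) F.Result (initial srcs r)
      program-correct = WP-seq (map onFst (map onFst (loop body (2 * h)))) (finish h)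
        (λ { ((a , _) , _) ((inv , refl) , refl) → WP-mono (finish h) (λ _ → proj₁) _
              (F.finish-correct a _ h (Inv-fits inv) F.zeros-Ok (sound-edges a inv) (hybrid a inv)) })
        _
        (WP-onFst (map onFst (loop body (2 * h))) _ _ F.zeros-Ok
          (WP-onFst (loop body (2 * h)) _ _ F.initEst-Ok (WP-loop body (2 * h) Inv body-correct _ start-inv)))

-- Counting seeds

sumB : ∀ R → (Vec Bool R → ℕ) → ℕ
sumB zero    f = f []
sumB (suc R) f = sumB R (f ∘ (true ∷_)) + sumB R (f ∘ (false ∷_))

sumB-mono : ∀ R {f g : Vec Bool R → ℕ} → (∀ s → f s ≤ g s) → sumB R f ≤ sumB R g
sumB-mono zero    h = h []
sumB-mono (suc R) h = +-mono-≤ (sumB-mono R (h ∘ (true ∷_))) (sumB-mono R (h ∘ (false ∷_)))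

sumB-cong : ∀ R {f g : Vec Bool R → ℕ} → (∀ s → f s ≡ g s) → sumB R f ≡ sumB R g
sumB-cong R h = ≤-antisym (sumB-mono R (≤-reflexive ∘ h)) (sumB-mono R (≤-reflexive ∘ sym ∘ h))

sumB-+ : ∀ R (f g : Vec Bool R → ℕ) → sumB R (λ s → f s + g s) ≡ sumB R f + sumB R g
sumB-+ zero    f g = refl
sumB-+ (suc R) f g rewrite sumB-+ R (f ∘ (true ∷_)) (g ∘ (true ∷_)) | sumB-+ R (f ∘ (false ∷_)) (g ∘ (false ∷_)) =
  +-interchange (sumB R (f ∘ (true ∷_))) _ _ _

sumB-const : ∀ R c → sumB R (λ _ → c) ≡ 2 ^ R * c
sumB-const zero    c = sym (+-identityʳ c)
sumB-const (suc R) c rewrite sumB-const R c = lem (2 ^ R) c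
  where
  lem : ∀ a c → a * c + a * c ≡ 2 * a * c
  lem = solve-∀

sumB-*ˡ : ∀ R c (f : Vec Bool R → ℕ) → sumB R (λ s → c * f s) ≡ c * sumB R f
sumB-*ˡ zero    c f = refl
sumB-*ˡ (suc R) c f rewrite sumB-*ˡ R c (f ∘ (true ∷_)) | sumB-*ˡ R c (f ∘ (false ∷_)) = sym (*-distribˡ-+ c _ _)

sumB-Σ< : ∀ R n (f : ℕ → Vec Bool R → ℕ) → sumB R (λ s → Σ< n (λ i → f i s)) ≡ Σ< n (λ i → sumB R (f i))
sumB-Σ< R zero    f = trans (sumB-const R 0) (*-zeroʳ (2 ^ R))
sumB-Σ< R (suc n) f = trans (sumB-+ R (λ s → Σ< n (λ i → f i s)) (f n)) (cong (_+ sumB R (f n)) (sumB-Σ< R n f))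

sumB-++ : ∀ a b (f : Vec Bool (a + b) → ℕ) → sumB (a + b) f ≡ sumB a (λ x → sumB b (λ y → f (x Vec.++ y)))
sumB-++ zero    b f = refl
sumB-++ (suc a) b f = cong₂ _+_ (sumB-++ a b (f ∘ (true ∷_))) (sumB-++ a b (f ∘ (false ∷_)))

Σ<-double : ∀ N (f : ℕ → ℕ) → Σ< (2 * N) f ≡ Σ< N (λ i → f (1 + 2 * i)) + Σ< N (λ i → f (2 * i))
Σ<-double zero    f = refl
Σ<-double (suc N) f = trans (cong (λ k → Σ< k f) (*-suc 2 N)) (trans
  (cong (λ y → y + f (2 * N) + f (1 + 2 * N)) (Σ<-double N f))
  (lem (Σ< N (λ i → f (1 + 2 * i))) (Σ< N (λ i → f (2 * i))) (f (2 * N)) (f (1 + 2 * N))))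
  where
  lem : ∀ a b c d → a + b + c + d ≡ (a + d) + (b + c)
  lem = solve-∀

sumB-val : ∀ R (f : ℕ → ℕ) → sumB R (f ∘ val) ≡ Σ< (2 ^ R) f
sumB-val zero    f = refl
sumB-val (suc R) f = trans (cong₂ _+_ (sumB-val R (λ i → f (1 + 2 * i))) (sumB-val R (λ i → f (2 * i))))
  (sym (Σ<-double (2 ^ R) f))

allVecs : ∀ R → List (Vec Bool R)
allVecs zero    = [] ∷ []
allVecs (suc R) = map (true ∷_) (allVecs R) ++ map (false ∷_) (allVecs R)

allVecs-unique : ∀ R → Unique (allVecs R)
allVecs-unique zero    = [] AllPairs.∷ AllPairs.[]
allVecs-unique (suc R) = Unique.++⁺ (Unique.map⁺ Vec.∷-injectiveʳ (allVecs-unique R))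
                                    (Unique.map⁺ Vec.∷-injectiveʳ (allVecs-unique R)) disjoint
  where
  disjoint : ∀ {s} → s ∈ map (true ∷_) (allVecs R) × s ∈ map (false ∷_) (allVecs R) → ⊥
  disjoint (p , q) with ∈-map⁻ _ p | ∈-map⁻ _ q
  ... | _ , _ , refl | _ , _ , ()

length-allVecs : ∀ R → length (allVecs R) ≡ 2 ^ R
length-allVecs zero    = refl
length-allVecs (suc R) = trans (length-++ (map (true ∷_) (allVecs R)))
  (cong₂ _+_ (trans (length-map _ (allVecs R)) (length-allVecs R))
             (trans (trans (length-map _ (allVecs R)) (length-allVecs R)) (sym (+-identityʳ (2 ^ R)))))

sumL-map : {A B : Set} (f : B → ℕ) (g : A → B) (xs : List A) → sumL f (map g xs) ≡ sumL (f ∘ g) xs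
sumL-map f g []       = refl
sumL-map f g (x ∷ xs) = cong (f (g x) +_) (sumL-map f g xs)

sumL-allVecs : ∀ R f → sumL f (allVecs R) ≡ sumB R f
sumL-allVecs zero    f = +-identityʳ (f [])
sumL-allVecs (suc R) f = trans (sumL-++ f (map (true ∷_) (allVecs R)) _)
  (cong₂ _+_ (trans (sumL-map f _ (allVecs R)) (sumL-allVecs R _)) (trans (sumL-map f _ (allVecs R)) (sumL-allVecs R _)))

length-zeros : {A : Set} (b : A → ℕ) (xs : List A) → length xs ≤ length (filter (λ x → b x ≟ 0) xs) + sumL b xs
length-zeros b []       = z≤n
length-zeros b (x ∷ xs) with b x in eq
... | zero  = s≤s (length-zeros b xs)
... | suc k = ≤-trans (s≤s (length-zeros b xs)) (≤-trans (s≤s (m≤n+m _ k)) (≤-reflexive (lem (length (filter (λ x → b x ≟ 0) xs)) k (sumL b xs))))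
  where
  lem : ∀ a k s → suc (k + (a + s)) ≡ a + suc (k + s)
  lem = solve-∀

-- Markov's inequality in counting form: `b` is at least 1 on every seed not listed, so its sum
-- bounds the number of those seeds.
success : ∀ {R n} (Good : Vec Bool R → Set) (b : Vec Bool R → ℕ) → (∀ s → b s ≡ 0 → Good s) →
          sumB R b * n ≤ 2 ^ R → SuccessProb Good n 1 1
success {R} {n} Good b good le =
  filter (λ s → b s ≟ 0) (allVecs R) ,
  Unique.filter⁺ (λ s → b s ≟ 0) (allVecs-unique R) ,
  All.map (λ {s} → good s) (All.all-filter (λ s → b s ≟ 0) (allVecs R)) ,
  subst₂ _≤_ (sym (cong₂ _*_ (*-identityʳ (2 ^ R ∸ length (filter (λ s → b s ≟ 0) (allVecs R)))) (*-identityʳ n))) (sym (*-identityʳ (2 ^ R)))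
    (≤-trans (*-monoˡ-≤ n few) le)
  where
  few : 2 ^ R ∸ length (filter (λ s → b s ≟ 0) (allVecs R)) ≤ sumB R b
  few = m≤n+o⇒m∸n≤o (2 ^ R) (length (filter (λ s → b s ≟ 0) (allVecs R)))
    (subst₂ (λ x y → x ≤ length (filter (λ s → b s ≟ 0) (allVecs R)) + y) (length-allVecs R) (sumL-allVecs R b) (length-zeros b (allVecs R)))

-- Independent samples

prodL : {A : Set} → (A → ℕ) → List A → ℕ
prodL f []       = 1
prodL f (x ∷ xs) = f x * prodL f xs

module _ {X : Set} {ℓ : ℕ} (decode : Vec Bool ℓ → X) where

  samples : ∀ k → Vec Bool (k * ℓ) → List X
  samples zero    s = []
  samples (suc k) s = decode (Vec.take ℓ s) ∷ samples k (Vec.drop ℓ s)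

  length-samples : ∀ k s → length (samples k s) ≡ k
  length-samples zero    s = refl
  length-samples (suc k) s = cong suc (length-samples k (Vec.drop ℓ s))

  samples-All : ∀ {P : X → Set} → (∀ ω → P (decode ω)) → ∀ k s → All P (samples k s)
  samples-All h zero    s = []
  samples-All h (suc k) s = h _ ∷ samples-All h k (Vec.drop ℓ s)

  -- Independence as a product rule for counting: the samples read disjoint blocks of the seed.
  sumB-prodL : ∀ (f : X → ℕ) k → sumB (k * ℓ) (λ s → prodL f (samples k s)) ≡ sumB ℓ (f ∘ decode) ^ k
  sumB-prodL f zero    = refl
  sumB-prodL f (suc k) = begin
    sumB (ℓ + k * ℓ) (λ s → prodL f (samples (suc k) s))
      ≡⟨ sumB-++ ℓ (k * ℓ) _ ⟩
    sumB ℓ (λ x → sumB (k * ℓ) (λ y → f (decode (Vec.take ℓ (x Vec.++ y))) * prodL f (samples k (Vec.drop ℓ (x Vec.++ y)))))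
      ≡⟨ sumB-cong ℓ (λ x → trans (sumB-cong (k * ℓ) (λ y → cong₂ (λ u v → f (decode u) * prodL f (samples k v)) (take-++ x y) (drop-++ x y)))
           (trans (sumB-*ˡ (k * ℓ) (f (decode x)) _) (trans (cong (f (decode x) *_) (sumB-prodL f k)) (*-comm (f (decode x)) _)))) ⟩
    sumB ℓ (λ x → sumB ℓ (f ∘ decode) ^ k * f (decode x))
      ≡⟨ trans (sumB-*ˡ ℓ (sumB ℓ (f ∘ decode) ^ k) (f ∘ decode)) (*-comm (sumB ℓ (f ∘ decode) ^ k) _) ⟩
    sumB ℓ (f ∘ decode) * sumB ℓ (f ∘ decode) ^ k ∎
    where open ≡-Reasoning

prodL-zero : {A : Set} (f : A → ℕ) (xs : List A) → prodL f xs ≡ 0 → ∃[ x ] x ∈ xs × f x ≡ 0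
prodL-zero f (x ∷ xs) eq with m*n≡0⇒m≡0∨n≡0 (f x) eq
... | inj₁ fx = x , here refl , fx
... | inj₂ r  = let y , y∈ , fy = prodL-zero f xs r in y , there y∈ , fy

-- A discrete form of 2 ^ x ≤ 1 + x on [0,1]: interpolating 2 ^ x linearly between integers
-- keeps the induction inside the naturals.
prodL-lower : {X : Set} (A : ℕ) (f : X → ℕ) (xs : List X) → 0 < A → All (λ x → f x ≤ A) xs →
  ∃[ m ] ∃[ g ] g < A × sumL f xs ≡ m * A + g × A ^ length xs * 2 ^ m * (A + g) ≤ A * prodL (λ x → A + f x) xs
prodL-lower A f []       0<A _        = 0 , 0 , 0<A , refl , ≤-reflexive (lem A)
  where
  lem : ∀ A → 1 * 1 * (A + 0) ≡ A * 1
  lem = solve-∀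
prodL-lower A f (x ∷ xs) 0<A (fx≤A ∷ fs) with prodL-lower A f xs 0<A fs
... | m , g , g<A , eq , le = go (f x + g <? A)
  where
  open ≤-Reasoning
  P = prodL (λ x → A + f x) xs
  B = A ^ length xs * 2 ^ m
  grow : ∀ Y → A * Y ≤ (A + f x) * (A + g) → A * B * Y ≤ A * ((A + f x) * P)
  grow Y h = begin
    A * B * Y                   ≡⟨ l1 A B Y ⟩
    B * (A * Y)                 ≤⟨ *-monoʳ-≤ B h ⟩
    B * ((A + f x) * (A + g))   ≡⟨ l2 B (A + f x) (A + g) ⟩
    (A + f x) * (B * (A + g))   ≤⟨ *-monoʳ-≤ (A + f x) le ⟩
    (A + f x) * (A * P)         ≡⟨ l2 (A + f x) A P ⟩
    A * ((A + f x) * P)         ∎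
    where
    l1 : ∀ A B Y → A * B * Y ≡ B * (A * Y)
    l1 = solve-∀
    l2 : ∀ a b c → a * (b * c) ≡ b * (a * c)
    l2 = solve-∀
  go : Dec (f x + g < A) → _
  go (yes lt) = m , f x + g , lt , trans (cong (f x +_) eq) (l1 (f x) (m * A) g) ,
    ≤-trans (≤-reflexive (cong (_* (A + (f x + g))) (*-assoc A (A ^ length xs) (2 ^ m))))
      (grow (A + (f x + g)) (≤-trans (m≤m+n _ (f x * g)) (≤-reflexive (l2 A (f x) g))))
    where
    l1 : ∀ a b c → a + (b + c) ≡ b + (a + c)
    l1 = solve-∀
    l2 : ∀ A x g → A * (A + (x + g)) + x * g ≡ (A + x) * (A + g)
    l2 = solve-∀
  go (no ge) = suc m , g′ , +-cancelˡ-< A g′ A (subst (_< A + A) (sym A+g′) (+-mono-≤-< fx≤A g<A)) ,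
    trans (cong (f x +_) eq) (trans (l1 (f x) (m * A) g) (trans (cong (m * A +_) (sym A+g′)) (l2 (m * A) A g′))) ,
    ≤-trans (≤-reflexive (l3 A (A ^ length xs) (2 ^ m) (A + g′)))
      (grow (2 * (A + g′)) (subst (λ y → A * (2 * y) ≤ (A + f x) * (A + g)) (sym A+g′) main))
    where
    g′ = f x + g ∸ A
    A+g′ : A + g′ ≡ f x + g
    A+g′ = m+[n∸m]≡n (≮⇒≥ ge)
    l1 : ∀ a b c → a + (b + c) ≡ b + (a + c)
    l1 = solve-∀
    l2 : ∀ a b c → a + (b + c) ≡ b + a + c
    l2 = solve-∀
    l3 : ∀ A p t y → A * p * (2 * t) * y ≡ A * (p * t) * (2 * y)
    l3 = solve-∀
    a = A ∸ g
    A≡ : A ≡ g + a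
    A≡ = sym (m+[n∸m]≡n (<⇒≤ g<A))
    -- The right side exceeds the left by the product of `A - f x` and `A - g`, both nonnegative.
    main : A * (2 * (f x + g)) ≤ (A + f x) * (A + g)
    main = begin
      A * (2 * (f x + g))                          ≡⟨ k1 A (f x) g ⟩
      A * (f x + g) + A * g + A * f x              ≡⟨ cong (λ z → A * (f x + g) + A * g + z * f x) A≡ ⟩
      A * (f x + g) + A * g + (g + a) * f x        ≡⟨ k2 A (f x) g a ⟩
      A * (f x + g) + A * g + g * f x + a * f x    ≤⟨ +-monoʳ-≤ (A * (f x + g) + A * g + g * f x) (*-monoʳ-≤ a fx≤A) ⟩
      A * (f x + g) + A * g + g * f x + a * A      ≡⟨ k3 A (f x) g a ⟩
      A * (f x + g) + A * (g + a) + g * f x        ≡⟨ cong (λ z → A * (f x + g) + A * z + g * f x) A≡ ⟨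
      A * (f x + g) + A * A + g * f x              ≡⟨ k4 A (f x) g ⟩
      (A + f x) * (A + g)                          ∎
      where
      k1 : ∀ A x g → A * (2 * (x + g)) ≡ A * (x + g) + A * g + A * x
      k1 = solve-∀
      k2 : ∀ A x g a → A * (x + g) + A * g + (g + a) * x ≡ A * (x + g) + A * g + g * x + a * x
      k2 = solve-∀
      k3 : ∀ A x g a → A * (x + g) + A * g + g * x + a * A ≡ A * (x + g) + A * (g + a) + g * x
      k3 = solve-∀
      k4 : ∀ A x g → A * (x + g) + A * A + g * x ≡ (A + x) * (A + g)
      k4 = solve-∀

prodL-large : {X : Set} (A M : ℕ) (f : X → ℕ) (xs : List X) → 0 < A → All (λ x → f x ≤ A) xs →
  M * A ≤ sumL f xs → A ^ length xs * 2 ^ M ≤ prodL (λ x → A + f x) xs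
prodL-large A M f xs 0<A fs le with prodL-lower A f xs 0<A fs
... | m , g , g<A , eq , bound = *-cancelˡ-≤ A (begin
  A * (A ^ length xs * 2 ^ M)              ≤⟨ *-monoʳ-≤ A (*-monoʳ-≤ (A ^ length xs) (^-monoʳ-≤ 2 M≤m)) ⟩
  A * (A ^ length xs * 2 ^ m)              ≡⟨ *-comm A _ ⟩
  A ^ length xs * 2 ^ m * A                ≤⟨ *-monoʳ-≤ (A ^ length xs * 2 ^ m) (m≤m+n A g) ⟩
  A ^ length xs * 2 ^ m * (A + g)          ≤⟨ bound ⟩
  A * prodL (λ x → A + f x) xs             ∎)
  where
  open ≤-Reasoning
  instance nz = >-nonZero 0<A
  M≤m : M ≤ m
  M≤m = s≤s⁻¹ (*-cancelʳ-< A M (suc m) (≤-<-trans le (subst (_< suc m * A) (sym eq) (subst (m * A + g <_) (+-comm (m * A) A) (+-monoʳ-< (m * A) g<A)))))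

-- Inequalities between powers

-- This is `(1 + 1/A) ^ j ≤ 1 / (1 - j/A)` cleared of denominators. Each factor is traded by
-- `suc A * c ≤ A * suc c`, valid for `c ≤ A`.
suc^-bound : ∀ A j c → j + c ≡ A → suc A ^ j * c ≤ A ^ suc j
suc^-bound A zero    c eq = ≤-reflexive (trans (+-identityʳ c) (trans eq (sym (*-identityʳ A))))
suc^-bound A (suc j) c eq = begin
  suc A * suc A ^ j * c          ≡⟨ l1 (suc A) (suc A ^ j) c ⟩
  suc A ^ j * (c + A * c)        ≤⟨ *-monoʳ-≤ (suc A ^ j) (+-monoˡ-≤ (A * c) (subst (c ≤_) eq (m≤n+m c (suc j)))) ⟩
  suc A ^ j * (A + A * c)        ≡⟨ l2 A (suc A ^ j) c ⟩
  A * (suc A ^ j * suc c)        ≤⟨ *-monoʳ-≤ A (suc^-bound A j (suc c) (trans (+-suc j c) eq)) ⟩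
  A * A ^ suc j                  ∎
  where
  open ≤-Reasoning
  l1 : ∀ a p c → a * p * c ≡ p * (a * c)
  l1 = solve-∀
  l2 : ∀ A p c → p * (A + A * c) ≡ A * (p * suc c)
  l2 = solve-∀

-- The case `j = c = h` of `suc^-bound`. Adding the mean load of one sample multiplies `2 * n` by at
-- most `1 + 1/(2h)`; this bounds the joint effect of `h` samples by a factor of 2.
suc[2h]^h : ∀ h → suc (2 * h) ^ h ≤ 2 * (2 * h) ^ h
suc[2h]^h zero        = s≤s z≤n
suc[2h]^h h@(suc _) = *-cancelʳ-≤ _ _ h (≤-trans (suc^-bound (2 * h) h h (cong (h +_) (sym (+-identityʳ h)))) (≤-reflexive (lem h ((2 * h) ^ h))))
  where
  lem : ∀ h p → 2 * h * p ≡ 2 * p * h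
  lem = solve-∀

-- Bernoulli's inequality for `1 + H/a`, multiplied by `a ^ suc q` to avoid division.
bernoulli : ∀ a H q → (a + q * H) * a ^ q ≤ a * (a + H) ^ q
bernoulli a H zero    = ≤-reflexive (cong (_* 1) (+-identityʳ a))
bernoulli a H (suc q) = begin
  (a + (H + q * H)) * (a * a ^ q)                          ≤⟨ m≤m+n _ (H * (q * H) * a ^ q) ⟩
  (a + (H + q * H)) * (a * a ^ q) + H * (q * H) * a ^ q    ≡⟨ l1 a H q (a ^ q) ⟩
  (a + H) * ((a + q * H) * a ^ q)                          ≤⟨ *-monoʳ-≤ (a + H) (bernoulli a H q) ⟩
  (a + H) * (a * (a + H) ^ q)                              ≡⟨ l2 (a + H) a ((a + H) ^ q) ⟩
  a * ((a + H) * (a + H) ^ q)                              ∎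
  where
  open ≤-Reasoning
  l1 : ∀ a H q p → (a + (H + q * H)) * (a * p) + H * (q * H) * p ≡ (a + H) * ((a + q * H) * p)
  l1 = solve-∀
  l2 : ∀ a b c → a * (b * c) ≡ b * (a * c)
  l2 = solve-∀

-- With `a` missing and `H` hitting outcomes, `q` samples all miss with probability at most 1/2. The
-- exponent has to be positive when `a` is 0.
halving : ∀ a H q → 1 ≤ q → a ≤ q * H → 2 * a ^ q ≤ (a + H) ^ q
halving zero      H (suc q) _   _  = z≤n
halving a@(suc _) H q       1≤q le = *-cancelˡ-≤ a (begin
  a * (2 * a ^ q)          ≡⟨ lem a (a ^ q) ⟩
  (a + a) * a ^ q          ≤⟨ *-monoˡ-≤ (a ^ q) (+-monoʳ-≤ a le) ⟩
  (a + q * H) * a ^ q      ≤⟨ bernoulli a H q ⟩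
  a * (a + H) ^ q          ∎)
  where
  open ≤-Reasoning
  lem : ∀ a p → a * (2 * p) ≡ (a + a) * p
  lem = solve-∀

^-distribʳ-* : ∀ o m n → (m * n) ^ o ≡ m ^ o * n ^ o
^-distribʳ-* zero    m n = refl
^-distribʳ-* (suc o) m n = trans (cong (m * n *_) (^-distribʳ-* o m n)) (lem m n (m ^ o) (n ^ o))
  where
  lem : ∀ m n p q → m * n * (p * q) ≡ m * p * (n * q)
  lem = solve-∀

-- Probability that the sampled sources fail

module Seeds (n L e q′ : ℕ) where

  -- A sample consists of `L` bits for the vertex and `e` for the delay. Every `q` samples halve the
  -- chance of missing a path, and `3 * L` such blocks bring it down to `1 / 2 ^ (3 * L)`. In the
  -- load threshold `M`, measured in units of `2 * n`, the part `k₁ = k / h` pays for the mean and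
  -- `3 * L` for the tail.
  h ℓ q k₁ k M : ℕ
  h  = 2 ^ e
  ℓ  = L + e
  q  = h * q′
  k₁ = q′ * (3 * L)
  k  = q * (3 * L)
  M  = k₁ + 3 * L

  decode : Vec Bool ℓ → ℕ × ℕ
  decode ω = val (Vec.take L ω) , val (Vec.drop L ω)

  sumB-decode : ∀ (f : ℕ → ℕ → ℕ) → sumB ℓ (λ ω → f (proj₁ (decode ω)) (proj₂ (decode ω))) ≡ Σ< (2 ^ L) (λ t → Σ< h (f t))
  sumB-decode f = trans (sumB-++ L e _) (trans
    (sumB-cong L (λ x → trans
      (sumB-cong e (λ y → cong₂ (λ u v → f (val u) (val v)) (take-++ x y) (drop-++ x y)))
      (sumB-val e (f (val x)))))
    (sumB-val L (λ t → Σ< h (f t))))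

  Ω : ℕ
  Ω = 2 ^ ℓ

  Ω≡ : Ω ≡ 2 ^ L * h
  Ω≡ = ^-distribˡ-+-* 2 L e

  2^seed : 2 ^ (k * ℓ) ≡ Ω ^ k
  2^seed = trans (cong (2 ^_) (*-comm k ℓ)) (sym (^-*-assoc 2 ℓ k))

  module Bad (G : Graph n) (r : ℕ) (r<n : r < n) (3≤n : 3 ≤ n) (n<2^L : n < 2 ^ L) (h≤n : h ≤ n)
             (enough : 2 ^ L ≤ q′ * (h * h)) where
    open Graph G
    open Load G using (OnLayer?; layerSize) public

    -- Excluding `v` itself lets the induction over sources descend when `v` is a source.
    Hit : ℕ → ℕ → Set
    Hit v t = t < n × 1 ≤ dst t v × dst t v ≤ h × dst r t + dst t v ≡ dst r v

    Hit? : ∀ v t → Dec (Hit v t)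
    Hit? v t = (t <? n) ×-dec (1 ≤? dst t v) ×-dec (dst t v ≤? h) ×-dec (dst r t + dst t v ≟ dst r v)

    miss : ℕ → ℕ × ℕ → ℕ
    miss v s = 𝟙 (does (¬? (Hit? v (proj₁ s))))

    far : ℕ → ℕ
    far v = 𝟙 (does (h <? dst r v))

    over : ℕ → List (ℕ × ℕ) → ℕ
    over τ ss = 𝟙 (does (M * (2 * n) ≤? sumL (layerSize (suc τ)) ss))

    -- Bad events are added up as 0-1 values. The event that all samples miss `v` is written as a
    -- product, which factors over the independent samples.
    badness : Vec Bool (k * ℓ) → ℕ
    badness s = Σ< n (λ v → far v * prodL (miss v) (samples decode k s))
              + Σ< (2 * h) (λ τ → over τ (samples decode k s))

    back : ∀ v → v < n → ∀ j → j ≤ dst r v → ∃[ u ] u < n × dst u v ≡ j × dst r u + j ≡ dst r v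
    back v v<n zero    _  = v , v<n , dst-refl v<n , +-identityʳ _
    back v v<n (suc j) le with back v v<n j (≤-trans (n≤1+n j) le)
    ... | u , u<n , eqj , eq with dst r u in equ
    ...   | zero  = ⊥-elim (1+n≰n (subst (suc j ≤_) (sym eq) le))
    ...   | suc i with dst-pred r<n u<n equ
    ...     | x , e , eqx = x , x<n , ≤-antisym (subst (λ y → dst x v ≤ suc y) eqj (step-left e v<n))
                (+-cancelˡ-≤ (dst r x) _ _ (subst (_≤ dst r x + dst x v) (sym eq′) (triangle r<n x<n v<n))) , eq′
      where
      x<n = proj₁ (E< e)
      eq′ : dst r x + suc j ≡ dst r v
      eq′ = trans (+-suc (dst r x) j) (trans (cong (λ y → suc (y + j)) eqx) eq)

    -- A shortest path from `r` supplies a hit at each distance `1, ..., h` from `v`, and distinct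
    -- distances mean distinct vertices.
    many-hits : ∀ v → v < n → h < dst r v → h ≤ Σ< (2 ^ L) (λ t → 𝟙 (does (Hit? v t)))
    many-hits v v<n h< = begin
      h                                                    ≡⟨ trans (Σ<-const h 1) (*-identityʳ h) ⟨
      Σ< h (λ _ → 1)                                       ≤⟨ Σ<-mono h (λ j j<h → at-distance j j<h) ⟩
      Σ< h (λ j → Σ< (2 ^ L) (λ t → 𝟙 (does (At? j t))))   ≡⟨ Σ<-swap h (2 ^ L) (λ j t → 𝟙 (does (At? j t))) ⟩
      Σ< (2 ^ L) (λ t → Σ< h (λ j → 𝟙 (does (At? j t))))   ≤⟨ Σ<-mono (2 ^ L) (λ t _ → once t (Hit? v t)) ⟩
      Σ< (2 ^ L) (λ t → 𝟙 (does (Hit? v t)))               ∎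
      where
      open ≤-Reasoning
      At? : ∀ j t → Dec (Hit v t × dst t v ≡ suc j)
      At? j t = Hit? v t ×-dec (dst t v ≟ suc j)
      at-distance : ∀ j → j < h → 1 ≤ Σ< (2 ^ L) (λ t → 𝟙 (does (At? j t)))
      at-distance j j<h with back v v<n (suc j) (≤-trans j<h (<⇒≤ h<))
      ... | u , u<n , eqj , eq = ≤-trans (≤-reflexive (sym (𝟙-yes (At? j u)
              ((u<n , subst (1 ≤_) (sym eqj) (s≤s z≤n) , subst (_≤ h) (sym eqj) j<h , trans (cong (dst r u +_) eqj) eq) , eqj))))
            (Σ<-term (2 ^ L) (λ t → 𝟙 (does (At? j t))) (<-trans u<n n<2^L))
      once : ∀ t (d : Dec (Hit v t)) → Σ< h (λ j → 𝟙 (does (At? j t))) ≤ 𝟙 (does (Hit? v t))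
      once t (yes p) = ≤-trans (Σ<-unique h (λ j → At? j t) (λ (_ , a) (_ , b) → suc-injective (trans (sym a) b)))
        (≤-reflexive (sym (𝟙-yes (Hit? v t) p)))
      once t (no ¬p) = ≤-trans (≤-reflexive (trans (Σ<-cong h (λ j _ → 𝟙-no (At? j t) (λ (p , _) → ¬p p))) (Σ<-0 h))) z≤n

    miss-bound : ∀ v → v < n → h < dst r v → sumB ℓ (miss v ∘ decode) ^ k * 2 ^ (3 * L) ≤ Ω ^ k
    miss-bound v v<n h< = begin
      m ^ (q * (3 * L)) * 2 ^ (3 * L)     ≡⟨ cong (_* 2 ^ (3 * L)) (sym (^-*-assoc m q (3 * L))) ⟩
      (m ^ q) ^ (3 * L) * 2 ^ (3 * L)     ≡⟨ ^-distribʳ-* (3 * L) (m ^ q) 2 ⟨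
      (m ^ q * 2) ^ (3 * L)               ≤⟨ ^-monoˡ-≤ (3 * L) (≤-trans (≤-reflexive (*-comm (m ^ q) 2)) (subst (λ y → 2 * m ^ q ≤ y ^ q) split-Ω (halving m H q 1≤q m≤qH))) ⟩
      (Ω ^ q) ^ (3 * L)                   ≡⟨ ^-*-assoc Ω q (3 * L) ⟩
      Ω ^ (q * (3 * L))                   ∎
      where
      open ≤-Reasoning
      m = sumB ℓ (miss v ∘ decode)
      H = sumB ℓ (λ ω → 𝟙 (does (Hit? v (proj₁ (decode ω)))))
      complement : ∀ {P : Set} (d : Dec P) → 𝟙 (does (¬? d)) + 𝟙 (does d) ≡ 1
      complement (yes _) = refl
      complement (no _)  = refl
      split-Ω : m + H ≡ Ω
      split-Ω = trans (sym (sumB-+ ℓ _ _)) (trans (sumB-cong ℓ (λ ω → complement (Hit? v (proj₁ (decode ω)))))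
        (trans (sumB-const ℓ 1) (*-identityʳ Ω)))
      -- Each of the at least `h` hitting vertices occurs with all `h` delays.
      hh≤H : h * h ≤ H
      hh≤H = begin
        h * h                                                      ≤⟨ *-monoʳ-≤ h (many-hits v v<n h<) ⟩
        h * Σ< (2 ^ L) (λ t → 𝟙 (does (Hit? v t)))                 ≡⟨ Σ<-*ˡ (2 ^ L) h _ ⟨
        Σ< (2 ^ L) (λ t → h * 𝟙 (does (Hit? v t)))                 ≡⟨ Σ<-cong (2 ^ L) (λ t _ → Σ<-const h (𝟙 (does (Hit? v t)))) ⟨
        Σ< (2 ^ L) (λ t → Σ< h (λ _ → 𝟙 (does (Hit? v t))))        ≡⟨ sumB-decode (λ t _ → 𝟙 (does (Hit? v t))) ⟨
        H                                                          ∎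
      m≤qH : m ≤ q * H
      m≤qH = begin
        m                    ≤⟨ m≤m+n m H ⟩
        m + H                ≡⟨ trans split-Ω Ω≡ ⟩
        2 ^ L * h            ≤⟨ *-monoˡ-≤ h enough ⟩
        q′ * (h * h) * h     ≡⟨ lem q′ h ⟩
        h * q′ * (h * h)     ≤⟨ *-monoʳ-≤ q hh≤H ⟩
        q * H                ∎
        where
        lem : ∀ q h → q * (h * h) * h ≡ h * q * (h * h)
        lem = solve-∀
      1≤q : 1 ≤ q
      1≤q = *-mono-≤ (m^n>0 2 e) (n≢0⇒n>0 (λ z → <⇒≱ (m^n>0 2 L) (subst (λ y → 2 ^ L ≤ y * (h * h)) z enough)))

    layerSize≤ : ∀ τ s → layerSize τ s ≤ n
    layerSize≤ τ s = subst (layerSize τ s ≤_) (*-identityʳ n) (Σ<-≤const n 1 (λ x _ → 𝟙≤1 _))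

    -- For a fixed source, different delays put disjoint layers at time τ.
    mean-load : ∀ τ → sumB ℓ (λ ω → 2 * n + layerSize τ (decode ω)) ≤ 2 ^ L * n * suc (2 * h)
    mean-load τ = begin
      sumB ℓ (λ ω → 2 * n + layerSize τ (decode ω))
        ≡⟨ sumB-+ ℓ (λ _ → 2 * n) (layerSize τ ∘ decode) ⟩
      sumB ℓ (λ _ → 2 * n) + sumB ℓ (layerSize τ ∘ decode)
        ≡⟨ cong₂ _+_ (trans (sumB-const ℓ (2 * n)) (cong (_* (2 * n)) Ω≡)) (sumB-decode (λ t δ → layerSize τ (t , δ))) ⟩
      2 ^ L * h * (2 * n) + Σ< (2 ^ L) (λ t → Σ< h (λ δ → layerSize τ (t , δ)))
        ≤⟨ +-monoʳ-≤ (2 ^ L * h * (2 * n)) (Σ<-≤const (2 ^ L) n (λ t _ → one t)) ⟩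
      2 ^ L * h * (2 * n) + 2 ^ L * n
        ≡⟨ lem (2 ^ L) h n ⟩
      2 ^ L * n * suc (2 * h) ∎
      where
      open ≤-Reasoning
      lem : ∀ N h n → N * h * (2 * n) + N * n ≡ N * n * suc (2 * h)
      lem = solve-∀
      one : ∀ t → Σ< h (λ δ → layerSize τ (t , δ)) ≤ n
      one t = ≤-trans (≤-reflexive (Σ<-swap h n (λ δ x → 𝟙 (does (OnLayer? τ (t , δ) x)))))
        (subst (Σ< n (λ x → Σ< h (λ δ → 𝟙 (does (OnLayer? τ (t , δ) x)))) ≤_) (*-identityʳ n)
          (Σ<-≤const n 1 (λ x _ → Σ<-unique h (λ δ → OnLayer? τ (t , δ) x)
            (λ {i} {j} (_ , a) (_ , b) → +-cancelˡ-≡ (dst t x) i j (trans a (sym b))))))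

    -- A Chernoff bound: `markov` compares the overload with the product of the factors
    -- `2 * n + layerSize`, whose mean is computed by independence and exceeds `(2 * n) ^ k` by at
    -- most `2 ^ k₁`; what remains of `2 ^ M` is `2 ^ (3 * L)`. The unit is `2 * n` because
    -- `(1 + 1/(2h)) ^ h` stays below 2, whereas `(1 + 1/h) ^ h` exceeds 2 for `h > 1`.
    over-bound : ∀ τ → sumB (k * ℓ) (λ s → over τ (samples decode k s)) * 2 ^ (3 * L) ≤ Ω ^ k
    over-bound τ = *-cancelʳ-≤ _ _ ((2 * n) ^ k * 2 ^ k₁) (begin
      B * 2 ^ (3 * L) * ((2 * n) ^ k * 2 ^ k₁)          ≡⟨ l1 B (2 ^ (3 * L)) ((2 * n) ^ k) (2 ^ k₁) ⟩
      (2 * n) ^ k * (2 ^ k₁ * 2 ^ (3 * L)) * B          ≡⟨ cong (λ y → (2 * n) ^ k * y * B) (^-distribˡ-+-* 2 k₁ (3 * L)) ⟨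
      (2 * n) ^ k * 2 ^ M * B                           ≡⟨ sumB-*ˡ (k * ℓ) ((2 * n) ^ k * 2 ^ M) _ ⟨
      sumB (k * ℓ) (λ s → (2 * n) ^ k * 2 ^ M * over τ (samples decode k s))
                                                        ≤⟨ sumB-mono (k * ℓ) markov ⟩
      sumB (k * ℓ) (λ s → prodL (λ x → 2 * n + layerSize (suc τ) x) (samples decode k s))
                                                        ≡⟨ sumB-prodL decode (λ x → 2 * n + layerSize (suc τ) x) k ⟩
      sumB ℓ (λ ω → 2 * n + layerSize (suc τ) (decode ω)) ^ k
                                                        ≤⟨ ^-monoˡ-≤ k (mean-load (suc τ)) ⟩
      (2 ^ L * n * suc (2 * h)) ^ k                     ≡⟨ ^-distribʳ-* k (2 ^ L * n) (suc (2 * h)) ⟩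
      (2 ^ L * n) ^ k * suc (2 * h) ^ k                 ≡⟨ cong (λ y → (2 ^ L * n) ^ k * suc (2 * h) ^ y) k≡ ⟩
      (2 ^ L * n) ^ k * suc (2 * h) ^ (h * k₁)          ≡⟨ cong ((2 ^ L * n) ^ k *_) (^-*-assoc (suc (2 * h)) h k₁) ⟨
      (2 ^ L * n) ^ k * (suc (2 * h) ^ h) ^ k₁          ≤⟨ *-monoʳ-≤ ((2 ^ L * n) ^ k) (^-monoˡ-≤ k₁ (suc[2h]^h h)) ⟩
      (2 ^ L * n) ^ k * (2 * (2 * h) ^ h) ^ k₁          ≡⟨ cong ((2 ^ L * n) ^ k *_) (^-distribʳ-* k₁ 2 ((2 * h) ^ h)) ⟩
      (2 ^ L * n) ^ k * (2 ^ k₁ * ((2 * h) ^ h) ^ k₁)   ≡⟨ cong (λ y → (2 ^ L * n) ^ k * (2 ^ k₁ * y)) (trans (^-*-assoc (2 * h) h k₁) (cong ((2 * h) ^_) (sym k≡))) ⟩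
      (2 ^ L * n) ^ k * (2 ^ k₁ * (2 * h) ^ k)          ≡⟨ l2 ((2 ^ L * n) ^ k) (2 ^ k₁) ((2 * h) ^ k) ⟩
      (2 ^ L * n) ^ k * (2 * h) ^ k * 2 ^ k₁            ≡⟨ cong (_* 2 ^ k₁) (^-distribʳ-* k (2 ^ L * n) (2 * h)) ⟨
      (2 ^ L * n * (2 * h)) ^ k * 2 ^ k₁                ≡⟨ cong (λ y → y ^ k * 2 ^ k₁) (trans (l3 (2 ^ L) n h) (cong (_* (2 * n)) (sym Ω≡))) ⟩
      (Ω * (2 * n)) ^ k * 2 ^ k₁                        ≡⟨ cong (_* 2 ^ k₁) (^-distribʳ-* k Ω (2 * n)) ⟩
      Ω ^ k * (2 * n) ^ k * 2 ^ k₁                      ≡⟨ *-assoc (Ω ^ k) ((2 * n) ^ k) (2 ^ k₁) ⟩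
      Ω ^ k * ((2 * n) ^ k * 2 ^ k₁)                    ∎)
      where
      open ≤-Reasoning
      B = sumB (k * ℓ) (λ s → over τ (samples decode k s))
      0<2n : 0 < 2 * n
      0<2n = *-mono-≤ {1} {2} (s≤s z≤n) (≤-trans (s≤s z≤n) 3≤n)
      instance
        nz : NonZero ((2 * n) ^ k * 2 ^ k₁)
        nz = m*n≢0 ((2 * n) ^ k) (2 ^ k₁) {{m^n≢0 (2 * n) k {{>-nonZero 0<2n}}}} {{m^n≢0 2 k₁}}
      k≡ : k ≡ h * k₁
      k≡ = *-assoc h q′ (3 * L)
      l1 : ∀ B t a b → B * t * (a * b) ≡ a * (b * t) * B
      l1 = solve-∀
      l2 : ∀ a b c → a * (b * c) ≡ a * c * b
      l2 = solve-∀
      l3 : ∀ N n h → N * n * (2 * h) ≡ N * h * (2 * n)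
      l3 = solve-∀
      markov : ∀ s → (2 * n) ^ k * 2 ^ M * over τ (samples decode k s) ≤ prodL (λ x → 2 * n + layerSize (suc τ) x) (samples decode k s)
      markov s = go (M * (2 * n) ≤? sumL (layerSize (suc τ)) ss)
        where
        ss = samples decode k s
        go : Dec (M * (2 * n) ≤ sumL (layerSize (suc τ)) ss) → (2 * n) ^ k * 2 ^ M * over τ ss ≤ prodL (λ x → 2 * n + layerSize (suc τ) x) ss
        go (no ¬p) = ≤-trans (≤-reflexive (trans (cong ((2 * n) ^ k * 2 ^ M *_) (𝟙-no (M * (2 * n) ≤? sumL (layerSize (suc τ)) ss) ¬p))
          (*-zeroʳ ((2 * n) ^ k * 2 ^ M)))) z≤n
        go (yes p) = ≤-trans (≤-reflexive (trans (cong ((2 * n) ^ k * 2 ^ M *_) (𝟙-yes (M * (2 * n) ≤? sumL (layerSize (suc τ)) ss) p))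
            (trans (*-identityʳ _) (cong (λ y → (2 * n) ^ y * 2 ^ M) (sym (length-samples decode k s))))))
          (prodL-large (2 * n) M (layerSize (suc τ)) ss 0<2n
            (All.universal (λ x → ≤-trans (layerSize≤ (suc τ) x) (m≤m+n n _)) ss) p)

    few-bad : sumB (k * ℓ) badness * n ≤ 2 ^ (k * ℓ)
    few-bad = *-cancelʳ-≤ _ _ (2 ^ (3 * L)) (begin
      sumB (k * ℓ) badness * n * 2 ^ (3 * L)
        ≡⟨ l1 (sumB (k * ℓ) badness) n (2 ^ (3 * L)) ⟩
      n * (sumB (k * ℓ) badness * 2 ^ (3 * L))
        ≡⟨ cong (λ y → n * (y * 2 ^ (3 * L))) (sumB-+ (k * ℓ) _ _) ⟩
      n * ((S₁ + S₂) * 2 ^ (3 * L))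
        ≡⟨ cong (n *_) (*-distribʳ-+ (2 ^ (3 * L)) S₁ S₂) ⟩
      n * (S₁ * 2 ^ (3 * L) + S₂ * 2 ^ (3 * L))
        ≤⟨ *-monoʳ-≤ n (+-mono-≤ s₁ s₂) ⟩
      n * (n * Ω ^ k + 2 * h * Ω ^ k)
        ≡⟨ l2 n (2 * h) (Ω ^ k) ⟩
      n * (n + 2 * h) * Ω ^ k
        ≤⟨ *-monoˡ-≤ (Ω ^ k) union-size ⟩
      2 ^ (3 * L) * Ω ^ k
        ≡⟨ trans (*-comm (2 ^ (3 * L)) (Ω ^ k)) (cong (_* 2 ^ (3 * L)) (sym 2^seed)) ⟩
      2 ^ (k * ℓ) * 2 ^ (3 * L) ∎)
      where
      open ≤-Reasoning
      instance
        nz : NonZero (2 ^ (3 * L))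
        nz = m^n≢0 2 (3 * L)
      S₁ = sumB (k * ℓ) (λ s → Σ< n (λ v → far v * prodL (miss v) (samples decode k s)))
      S₂ = sumB (k * ℓ) (λ s → Σ< (2 * h) (λ τ → over τ (samples decode k s)))
      l1 : ∀ a b c → a * b * c ≡ b * (a * c)
      l1 = solve-∀
      l2 : ∀ n h w → n * (n * w + h * w) ≡ n * (n + h) * w
      l2 = solve-∀
      scale : ∀ m c f → (∀ i → i < m → f i * c ≤ Ω ^ k) → Σ< m f * c ≤ m * Ω ^ k
      scale m c f g = ≤-trans (≤-reflexive (trans (*-comm (Σ< m f) c) (trans (sym (Σ<-*ˡ m c f)) (Σ<-cong m (λ i _ → *-comm c (f i))))))
        (Σ<-≤const m (Ω ^ k) g)
      s₂ : S₂ * 2 ^ (3 * L) ≤ 2 * h * Ω ^ k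
      s₂ = ≤-trans (≤-reflexive (cong (_* 2 ^ (3 * L)) (sumB-Σ< (k * ℓ) (2 * h) (λ τ s → over τ (samples decode k s)))))
        (scale (2 * h) (2 ^ (3 * L)) _ (λ τ _ → over-bound τ))
      s₁ : S₁ * 2 ^ (3 * L) ≤ n * Ω ^ k
      s₁ = ≤-trans (≤-reflexive (cong (_* 2 ^ (3 * L)) (sumB-Σ< (k * ℓ) n (λ v s → far v * prodL (miss v) (samples decode k s)))))
        (scale n (2 ^ (3 * L)) _ (λ v v<n → ≤-trans (≤-reflexive (cong (_* 2 ^ (3 * L))
          (trans (sumB-*ˡ (k * ℓ) (far v) _) (cong (far v *_) (sumB-prodL decode (miss v) k)))))
          (each v v<n (h <? dst r v))))
        where
        each : ∀ v → v < n → Dec (h < dst r v) → far v * sumB ℓ (miss v ∘ decode) ^ k * 2 ^ (3 * L) ≤ Ω ^ k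
        each v v<n (yes p) rewrite 𝟙-yes (h <? dst r v) p | +-identityʳ (sumB ℓ (miss v ∘ decode) ^ k) = miss-bound v v<n p
        each v v<n (no ¬p) rewrite 𝟙-no (h <? dst r v) ¬p = z≤n
      -- There are `n` missing events and `2 * h` overload events; the outer factor `n` is the
      -- failure probability aimed at. The constant 3 is absorbed by `3 ≤ n`, the threshold of the
      -- theorem.
      union-size : n * (n + 2 * h) ≤ 2 ^ (3 * L)
      union-size = begin
        n * (n + 2 * h)               ≤⟨ *-monoʳ-≤ n (+-monoʳ-≤ n (*-monoʳ-≤ 2 h≤n)) ⟩
        n * (n + 2 * n)               ≡⟨ l3 n ⟩
        n * (n * 3)                   ≤⟨ *-mono-≤ (<⇒≤ n<2^L) (*-mono-≤ (<⇒≤ n<2^L) (≤-trans 3≤n (<⇒≤ n<2^L))) ⟩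
        2 ^ L * (2 ^ L * 2 ^ L)       ≡⟨ l4 (2 ^ L) ⟩
        (2 ^ L) ^ 3                   ≡⟨ trans (^-*-assoc 2 L 3) (cong (2 ^_) (*-comm L 3)) ⟩
        2 ^ (3 * L)                   ∎
        where
        l3 : ∀ n → n * (n + 2 * n) ≡ n * (n * 3)
        l3 = solve-∀
        l4 : ∀ n → n * (n * n) ≡ n * (n * (n * 1))
        l4 = solve-∀

    module Good (s : Vec Bool (k * ℓ)) (good : badness s ≡ 0) where

      srcs : Pairs
      srcs = (r , 0) ∷ samples decode k s

      -- The additive `n` covers the search from the root, which is added to the samples.
      load : ∀ τ → τ < 2 * h → sumL (layerSize (suc τ)) srcs ≤ M * (2 * n) + n
      load τ τ< = ≤-trans (+-mono-≤ (layerSize≤ (suc τ) (r , 0)) (<⇒≤ (≰⇒> not-over))) (≤-reflexive (+-comm n _))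
        where
        not-over : ¬ (M * (2 * n) ≤ sumL (layerSize (suc τ)) (samples decode k s))
        not-over p = <⇒≱ (≤-trans (≤-reflexive (sym (𝟙-yes (M * (2 * n) ≤? sumL (layerSize (suc τ)) (samples decode k s)) p)))
            (Σ<-term (2 * h) (λ τ → over τ (samples decode k s)) τ<))
          (≤-reflexive (m+n≡0⇒n≡0 (Σ< n (λ v → far v * prodL (miss v) (samples decode k s))) good))

      product-zero : ∀ v → v < n → h < dst r v → prodL (miss v) (samples decode k s) ≡ 0
      product-zero v v<n far-v = n≤0⇒n≡0 (begin
        prodL (miss v) (samples decode k s)            ≡⟨ +-identityʳ _ ⟨
        1 * prodL (miss v) (samples decode k s)        ≡⟨ cong (_* prodL (miss v) (samples decode k s)) (𝟙-yes (h <? dst r v) far-v) ⟨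
        far v * prodL (miss v) (samples decode k s)    ≤⟨ Σ<-term n (λ v → far v * prodL (miss v) (samples decode k s)) v<n ⟩
        Σ< n (λ v → far v * prodL (miss v) (samples decode k s)) ≡⟨ m+n≡0⇒m≡0 _ good ⟩
        0 ∎)
        where open ≤-Reasoning

      hits : ∀ v → v < n → h < dst r v → ∃[ i ] i < suc k × Hit v (proj₁ (nth (0 , 0) srcs i))
      hits v v<n far-v with prodL-zero (miss v) (samples decode k s) (product-zero v v<n far-v)
      ... | x , x∈ , m0 with ∈⇒nth (0 , 0) x∈ | Hit? v (proj₁ x)
      ...   | i , i< , eq | yes p = suc i , s≤s (subst (i <_) (length-samples decode k s) i<) , subst (λ y → Hit v (proj₁ y)) (sym eq) p
      ...   | _ | no ¬p = ⊥-elim (1+n≢0 (trans (sym (𝟙-yes (¬? (Hit? v (proj₁ x))) ¬p)) m0))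

-- From distances and parents to BFS trees

toFin : ∀ {n} → ℕ → Fin n → Fin n
toFin {n} x v with x <? n
... | yes x<n = Fin.fromℕ< x<n
... | no  _   = v

toℕ-toFin : ∀ {n x} (v : Fin n) → x < n → toℕ (toFin x v) ≡ x
toℕ-toFin {n} {x} v x<n with x <? n
... | yes p = Fin.toℕ-fromℕ< p
... | no ¬p = ⊥-elim (¬p x<n)

-- The root is recognised as the vertex with estimate 0, so the output needs no copy of `r`.
parentFrom : ∀ {n} → List ℕ → List ℕ → Fin n → Maybe (Fin n)
parentFrom est lo v = if does (at est (toℕ v) ≟ 0) then nothing else just (toFin (at lo (toℕ v)) v)

module _ {n : ℕ} (σ : List (Upd n)) (simple : SimpleFinal σ) (conn : Connected (Adj σ)) where
  open StreamGraph σ simple conn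
  open Graph graph

  parentFrom-correct : ∀ {par} (r : Fin n) est lo → par ≡ parentFrom est lo →
    (∀ v → v < n → at est v ≡ dst (toℕ r) v × (v ≢ toℕ r → E (at lo v) v × suc (dst (toℕ r) (at lo v)) ≡ dst (toℕ r) v)) →
    IsBFSTree (Adj σ) r par
  parentFrom-correct r est lo refl spec = isBFSTree r (parentFrom est lo)
    (if-yes (at est (toℕ r) ≟ 0) (trans (proj₁ (spec (toℕ r) (Fin.toℕ<n r))) (dst-refl (Fin.toℕ<n r))))
    λ v v≢r → let
      v≢ = λ eq → v≢r (Fin.toℕ-injective eq)
      exact , parent = spec (toℕ v) (Fin.toℕ<n v)
      e , d = parent v≢
      lo≡ = toℕ-toFin v (proj₁ (E< e))
      in toFin (at lo (toℕ v)) v ,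
         if-no (at est (toℕ v) ≟ 0) (λ z → v≢ (sym (dst-0 (Fin.toℕ<n r) (Fin.toℕ<n v) (trans (sym exact) z)))) ,
         subst (λ x → E x (toℕ v)) (sym lo≡) e ,
         trans (cong (λ x → suc (dst (toℕ r) x)) lo≡) d

-- With few passes the whole graph is stored and the relaxations are simulated.

module Store (n L : ℕ) where

  pairs : Pairs
  pairs = concat (tab n (λ u → tab n (λ v → u , v)))

  pair? : ∀ (c : ℕ × ℕ) u v → Dec (u ≡ proj₁ c × v ≡ proj₂ c)
  pair? c u v = (u ≟ proj₁ c) ×-dec (v ≟ proj₂ c)

  pairQuery : ℕ × ℕ → Query
  pairQuery c u v = does (pair? c u v)

  storeStep : Step (ℕ × Pairs)
  storeStep = mkStep (λ _ → map pairQuery pairs) (λ (r , _) as → r , keep pairs as)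

  adjIn : Pairs → ℕ → ℕ → Bool
  adjIn es u v = does ((u , v) ∈? es)

  open Finish n L {⊤} (λ _ → []) using (finish; initEst) renaming (State to FullState)

  -- Evaluated as part of the output, where it costs neither passes nor memory. With `n` rounds no
  -- known edges are required, since distances are below `n`.
  simulate : ℕ × Pairs → FullState
  simulate (r , es) = Hoare.run n (adjIn es) n (finish n) ((tt , initEst r) , tab n (λ _ → 0))

  output : ℕ × Pairs → Fin n → Maybe (Fin n)
  output s = parentFrom (proj₂ (proj₁ (simulate s))) (proj₂ (simulate s))

  length-pairs : length pairs ≡ n * n
  length-pairs = rows n (λ u → u)
    where
    rows : ∀ m (f : ℕ → ℕ) → length (concat (tab m (λ u → tab n (λ v → f u , v)))) ≡ m * n
    rows zero    f = refl
    rows (suc m) f = trans (length-++ (tab n (λ v → f 0 , v))) (cong₂ _+_ (length-tab n _) (rows m (f ∘ suc)))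

  pairs⁻ : ∀ {u v} → (u , v) ∈ pairs → u < n × v < n
  pairs⁻ c∈ with ∈-concat⁻′ (tab n _) c∈
  ... | row , p , q with ∈-tab⁻ n _ q
  ...   | i , i< , refl with ∈-tab⁻ n _ p
  ...     | j , j< , refl = i< , j<

  pairs⁺ : ∀ {u v} → u < n → v < n → (u , v) ∈ pairs
  pairs⁺ {u} {v} u<n v<n = ∈-concat⁺′ (∈-tab n (λ v → u , v) v<n) (∈-tab n (λ u → tab n (λ v → u , v)) u<n)

  module Correct (G : Graph n) (2≤n : 2 ≤ n) (n<2^L : n < 2 ^ L) (r : ℕ) (r<n : r < n) (w : ℕ) (L≤w : L ≤ w) where
    open Graph G
    open Hoare n adj (n * n)

    memC : Codec (ℕ × Pairs)
    memC = natC w ×C listC (n * n) (natC w ×C natC w)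

    Stored : ℕ × Pairs → Set
    Stored (r′ , es) = r′ ≡ r × Ok memC (r′ , es) × (∀ {u v} → (u , v) ∈ es → E u v) × (∀ {u v} → E u v → (u , v) ∈ es)

    answer : ℕ × ℕ → ℕ
    answer c = cnt n adj (pairQuery c)

    n≤2^w : n ≤ 2 ^ w
    n≤2^w = ≤-trans (<⇒≤ n<2^L) (^-monoʳ-≤ 2 L≤w)

    store-correct : WP (Ok memC) (storeStep ∷ []) Stored (r , [])
    store-correct = (<-≤-trans r<n n≤2^w , z≤n , []) , ≤-reflexive (trans (length-map pairQuery pairs) length-pairs) ,
      subst (λ as → Stored (r , keep pairs as)) (map-∘ pairs)
        (refl , (<-≤-trans r<n n≤2^w , ≤-trans (keep-length pairs) (≤-reflexive length-pairs) , All.map proj₁ kept) ,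
         (λ c∈ → positive (proj₂ (All.lookup kept c∈))) ,
         (λ {u} {v} e → keep-∈ answer pairs (pairs⁺ (proj₁ (E< e)) (proj₂ (E< e)))
            (pos-cnt n adj (pairQuery (u , v)) (proj₁ (E< e)) (proj₂ (E< e)) (T-does (pair? (u , v) u v) (refl , refl)) e)))
      where
      keep-length : ∀ cs → length (keep cs (map answer cs)) ≤ length cs
      keep-length []       = z≤n
      keep-length (c ∷ cs) with does (answer c ≟ 0)
      ... | true  = m≤n⇒m≤1+n (keep-length cs)
      ... | false = s≤s (keep-length cs)
      kept : All (λ c → (proj₁ c < 2 ^ w × proj₂ c < 2 ^ w) × 0 < answer c) (keep pairs (map answer pairs))
      kept = keep-All answer pairs (All.tabulate (λ { {u , v} c∈ →
        <-≤-trans (proj₁ (pairs⁻ c∈)) n≤2^w , <-≤-trans (proj₂ (pairs⁻ c∈)) n≤2^w }))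
      positive : ∀ {u v} → 0 < answer (u , v) → E u v
      positive {u} {v} p with cnt-pos n adj (pairQuery (u , v)) p
      ... | x , y , _ , _ , t , e with does-T (pair? (u , v) x y) t
      ...   | refl , refl = e

    module _ (s : ℕ × Pairs) (st : Stored s) where

      private
        es = proj₂ s
        sound : ∀ {u v} → T (adjIn es u v) → E u v
        sound {u} {v} t = proj₁ (proj₂ (proj₂ st)) (does-T ((u , v) ∈? es) t)
        complete : ∀ {u v} → E u v → T (adjIn es u v)
        complete {u} {v} e = T-does ((u , v) ∈? es) (proj₂ (proj₂ (proj₂ st)) e)

      copy : Graph n
      copy = record
        { adj = adjIn es
        ; dst = dst
        ; E< = λ t → E< (sound t)
        ; E-sym = λ t → complete (E-sym (sound t))
        ; E-irr = λ t → E-irr (sound t)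
        ; dst-refl = dst-refl
        ; dst-0 = dst-0
        ; dst-step = λ s<n t → dst-step s<n (sound t)
        ; dst-pred = λ s<n v<n eq → let u , e , eq′ = dst-pred s<n v<n eq in u , complete e , eq′
        }

      module F = Finish.Correct n L {⊤} (λ _ → []) copy 2≤n n<2^L w n L≤w ≤-refl (λ _ → ⊤) r r<n

      path : ∀ d v → v < n → dst r v ≡ d → F.Hyb [] d v d
      path zero    v v<n eq = subst (λ x → F.Hyb [] 0 x 0) (dst-0 r<n v<n eq) F.root
      path (suc d) v v<n eq = let u , e , eq′ = dst-pred r<n v<n eq in F.real (path d u (proj₁ (E< e)) eq′) (complete e)

      simulate-correct : ∀ v → v < n → at (proj₂ (proj₁ (simulate s))) v ≡ dst r v ×
        (v ≢ r → E (at (proj₂ (simulate s)) v) v × suc (dst r (at (proj₂ (simulate s)) v)) ≡ dst r v)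
      simulate-correct v v<n = subst (λ r′ → let s′ = simulate (r′ , es) in at (proj₂ (proj₁ s′)) v ≡ dst r v ×
            (v ≢ r → E (at (proj₂ s′) v) v × suc (dst r (at (proj₂ s′) v)) ≡ dst r v)) (sym (proj₁ st))
          (proj₁ (outcome v v<n) , λ ne → let e , d = proj₂ (outcome v v<n) ne in sound e , d)
        where
        outcome = proj₂ (proj₁ (Hoare.WP-run n (adjIn es) n (finish n) _
          (F.finish-correct tt (tab n (λ _ → 0)) n tt F.zeros-Ok (λ _ _ _ ())
            (λ v v<n → dst r v , <⇒≤ (dst<n r<n v<n) , path (dst r v) v v<n refl))))

-- Logarithms

log-bounds : ∀ n → 1 ≤ n → 2 ^ ⌊log₂ n ⌋ ≤ n × n < 2 ^ suc ⌊log₂ n ⌋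
log-bounds = <-rec _ go
  where
  go : ∀ n → (∀ {m} → m < n → 1 ≤ m → 2 ^ ⌊log₂ m ⌋ ≤ m × m < 2 ^ suc ⌊log₂ m ⌋) → 1 ≤ n → 2 ^ ⌊log₂ n ⌋ ≤ n × n < 2 ^ suc ⌊log₂ n ⌋
  go 1 rec _ = ≤-refl , ≤-refl
  go n@(suc (suc k)) rec _ = subst (λ l → 2 ^ l ≤ n × n < 2 ^ suc l) log≡
    ( ≤-trans (*-monoʳ-≤ 2 (proj₁ ih)) 2m≤n
    , <-≤-trans n<2m+2 (*-monoʳ-≤ 2 (proj₂ ih)))
    where
    m = ⌊ n /2⌋
    ih = rec {m} (⌊n/2⌋<n (suc k)) (s≤s z≤n)
    log≡ : suc ⌊log₂ m ⌋ ≡ ⌊log₂ n ⌋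
    log≡ = trans (cong suc (⌊log₂⌊n/2⌋⌋≡⌊log₂n⌋∸1 n)) (m+[n∸m]≡n (⌊log₂⌋-mono-≤ {2} {n} (s≤s (s≤s z≤n))))
    2m≤n : 2 * m ≤ n
    2m≤n = begin
      2 * m             ≡⟨ cong (m +_) (+-identityʳ m) ⟩
      m + m             ≤⟨ +-monoʳ-≤ m (⌊n/2⌋≤⌈n/2⌉ n) ⟩
      m + ⌈ n /2⌉       ≡⟨ ⌊n/2⌋+⌈n/2⌉≡n n ⟩
      n                 ∎
      where open ≤-Reasoning
    n<2m+2 : n < 2 * suc m
    n<2m+2 = begin-strict
      n                 ≡⟨ ⌊n/2⌋+⌈n/2⌉≡n n ⟨
      m + ⌈ n /2⌉       ≤⟨ +-monoʳ-≤ m (⌊n/2⌋-mono (n≤1+n (suc n))) ⟩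
      m + suc m         <⟨ n<1+n _ ⟩
      suc m + suc m     ≡⟨ cong (suc m +_) (+-identityʳ (suc m)) ⟨
      2 * suc m         ∎
      where open ≤-Reasoning

-- Parameters

-- Counters up to `n * n` take `2 * lg n` bits; the extra factor `2 ^ 4` makes room for the indices
-- of up to `10 * (n * lg n)` sources.
lg width : ℕ → ℕ
lg n    = suc ⌊log₂ n ⌋
width n = 2 * lg n + 4

lg≤width : ∀ n → lg n ≤ width n
lg≤width n = ≤-trans (m≤m+n (lg n) _) (m≤m+n (2 * lg n) 4)

n<2^lg : ∀ {n} → 1 ≤ n → n < 2 ^ lg n
n<2^lg {n} 1≤n = proj₂ (log-bounds n 1≤n)

2^lg≤2n : ∀ {n} → 1 ≤ n → 2 ^ lg n ≤ 2 * n
2^lg≤2n {n} 1≤n = *-monoʳ-≤ 2 (proj₁ (log-bounds n 1≤n))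

2^width : ∀ n → 2 ^ width n ≡ 2 ^ lg n * 2 ^ lg n * 16
2^width n = trans (^-distribˡ-+-* 2 (2 * lg n) 4) (cong (_* 16) (trans (^-distribˡ-+-* 2 (lg n) (lg n + 0))
  (cong (λ y → 2 ^ lg n * 2 ^ y) (+-identityʳ (lg n)))))

n²<2^width : ∀ {n} → 1 ≤ n → n * n < 2 ^ width n
n²<2^width {n} 1≤n = subst (n * n <_) (sym (2^width n))
  (<-≤-trans (*-mono-< (n<2^lg 1≤n) (n<2^lg 1≤n)) (m≤m*n (2 ^ lg n * 2 ^ lg n) 16))

-- One slot of a list of pairs, that is two words and the presence bit; it serves as the unit for
-- the space bounds.
cell : ℕ → ℕ
cell n = suc (width n + width n)

cell≤ : ∀ n → cell n ≤ 13 * lg n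
cell≤ n = ≤-trans (≤-reflexive (l1 (lg n))) (≤-trans (+-monoʳ-≤ (4 * lg n) (*-monoʳ-≤ 9 (s≤s z≤n))) (≤-reflexive (l2 (lg n))))
  where
  l1 : ∀ L → suc ((2 * L + 4) + (2 * L + 4)) ≡ 4 * L + 9 * 1
  l1 = solve-∀
  l2 : ∀ L → 4 * L + 9 * L ≡ 13 * L
  l2 = solve-∀

width<cell : ∀ n → suc (width n) ≤ cell n
width<cell n = s≤s (m≤m+n (width n) (width n))

budget : ℕ → ℕ → ℕ
budget n k = n * n * lg n ^ k

budget-mono : ∀ n {j k} → j ≤ k → budget n j ≤ budget n k
budget-mono n j≤k = *-monoʳ-≤ (n * n) (^-monoʳ-≤ (lg n) j≤k)

budget-polylog : ∀ n c k → c * budget n k ≡ c * n ^ 2 * polylog n k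
budget-polylog n c k = lem c n (lg n ^ k)
  where
  lem : ∀ c n y → c * (n * n * y) ≡ c * (n * (n * 1)) * y
  lem = solve-∀

-- Few passes: p < 10 * lg n

module Few (n p : ℕ) where

  open Store n (lg n) using (storeStep; output; simulate) renaming (module Correct to StoreCorrect)

  storeC : Codec (ℕ × Pairs)
  storeC = natC (width n) ×C listC (n * n) (natC (width n) ×C natC (width n))

  module C = Compile n (width n) (n * n) storeC

  program : List (Step (ℕ × Pairs))
  program = storeStep ∷ []

  init : ⊤ → Fin n → ℕ × Pairs
  init _ r = toℕ r , []

  rand : RandAlg (Upd n) n p (size C.stateC) 0
  rand = C.randAlg p program init output 0 (λ _ → tt)

  det : DetAlg (Fin n × Fin n) n p (size C.stateC)
  det = C.detAlg p program init output tt

  module _ (3≤n : 3 ≤ n) (1≤p : 1 ≤ p) where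

    1≤n : 1 ≤ n
    1≤n = ≤-trans (s≤s z≤n) 3≤n

    rand-tree : ∀ seed r σ → SimpleFinal σ → Connected (Adj σ) → IsBFSTree (Adj σ) r (runRand rand seed r σ)
    rand-tree seed r σ simple conn =
      parentFrom-correct σ simple conn r (proj₂ (proj₁ (simulate (proj₁ final)))) (proj₂ (simulate (proj₁ final)))
        (proj₂ (proj₂ final)) (S.simulate-correct (proj₁ final) (proj₁ (proj₂ final)))
      where
      module S = StoreCorrect (StreamGraph.graph σ simple conn) (≤-trans (s≤s (s≤s z≤n)) 3≤n) (n<2^lg 1≤n)
                   (toℕ r) (Fin.toℕ<n r) (width n) (lg≤width n)
      final = C.rand-correct p program init output (n²<2^width 1≤n) 1≤p σ simple 0 (λ _ → tt) seed r {Q = S.Stored}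
        (λ m → proj₁ ∘ proj₂) S.store-correct

    rand-success : ∀ r σ → SimpleFinal σ → Connected (Adj σ) →
                   SuccessProb (λ seed → IsBFSTree (Adj σ) r (runRand rand seed r σ)) n 1 1
    rand-success r σ simple conn = success {n = n} (λ seed → IsBFSTree (Adj σ) r (runRand rand seed r σ)) (λ _ → 0)
      (λ seed _ → rand-tree seed r σ simple conn) z≤n

    det-tree : ∀ r σ → SimpleFinal (insOnly σ) → Connected (Adj (insOnly σ)) → IsBFSTree (Adj (insOnly σ)) r (runDet det r σ)
    det-tree r σ simple conn =
      parentFrom-correct (insOnly σ) simple conn r (proj₂ (proj₁ (simulate (proj₁ final)))) (proj₂ (simulate (proj₁ final)))
        (proj₂ (proj₂ final)) (S.simulate-correct (proj₁ final) (proj₁ (proj₂ final)))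
      where
      module S = StoreCorrect (StreamGraph.graph (insOnly σ) simple conn) (≤-trans (s≤s (s≤s z≤n)) 3≤n) (n<2^lg 1≤n)
                   (toℕ r) (Fin.toℕ<n r) (width n) (lg≤width n)
      final = C.det-correct p program init output (n²<2^width 1≤n) 1≤p σ simple tt r {Q = S.Stored}
        (λ m → proj₁ ∘ proj₂) S.store-correct

  space : 3 ≤ n → size C.stateC ≤ 39 * budget n 1
  space 3≤n = begin
    width n + n * n * cell n + n * n * suc (width n)
      ≤⟨ +-mono-≤ (+-monoˡ-≤ (n * n * cell n) w≤) (*-monoʳ-≤ (n * n) (width<cell n)) ⟩
    n * n * cell n + n * n * cell n + n * n * cell n
      ≡⟨ l1 (n * n) (cell n) ⟩
    3 * (n * n) * cell n
      ≤⟨ *-monoʳ-≤ (3 * (n * n)) (cell≤ n) ⟩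
    3 * (n * n) * (13 * lg n)
      ≡⟨ l2 (n * n) (lg n) ⟩
    39 * budget n 1 ∎
    where
    open ≤-Reasoning
    n≥1 : 1 ≤ n
    n≥1 = ≤-trans (s≤s z≤n) 3≤n
    w≤ : width n ≤ n * n * cell n
    w≤ = ≤-trans (≤-trans (n≤1+n _) (width<cell n)) (≤-trans (≤-reflexive (sym (+-identityʳ (cell n)))) (*-monoˡ-≤ (cell n) (*-mono-≤ n≥1 n≥1)))
    l1 : ∀ a c → a * c + a * c + a * c ≡ 3 * a * c
    l1 = solve-∀
    l2 : ∀ a L → 3 * a * (13 * L) ≡ 39 * (a * (L * 1))
    l2 = solve-∀

  space-det : 3 ≤ n → p ≤ 10 * lg n → size C.stateC * p ≤ 390 * budget n 2
  space-det 3≤n p≤ = ≤-trans (*-mono-≤ (space 3≤n) p≤) (≤-reflexive (lem (n * n) (lg n)))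
    where
    lem : ∀ a L → 39 * (a * (L * 1)) * (10 * L) ≡ 390 * (a * (L * (L * 1)))
    lem = solve-∀

  space-rand : 3 ≤ n → p ≤ 10 * lg n → size C.stateC * p ^ 2 ≤ 39 * 100 * budget n 3
  space-rand 3≤n p≤ = ≤-trans (*-mono-≤ (space 3≤n) (^-monoˡ-≤ 2 p≤)) (≤-reflexive (lem 39 10 (n * n) (lg n)))
    where
    lem : ∀ c d a L → c * (a * (L * 1)) * (d * L * (d * L * 1)) ≡ c * (d * d) * (a * (L * (L * (L * 1))))
    lem = solve-∀

-- Arithmetic of the space and pass bounds

-- Definitionally the memory size of the turnstile algorithm: sources, distance table, three lists
-- of pairs, two lists of numbers and the counters. Stated for plain numbers, it is estimated
-- without codecs.
turnstile-size : (ks K n w : ℕ) → ℕ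
turnstile-size ks K n w =
  ((ks * suc (w + w) + ks * suc (ks * suc w)) + (((K + ks) * suc (w + w) + (K + ks) * suc (w + w)) + (K + ks) * suc (w + w)))
  + n * suc w + n * suc w + (2 * (K + ks) + n) * suc w

turnstile-size≤ : ∀ ks K n w → turnstile-size ks K n w ≤ suc (w + w) * (ks * ks + 7 * ks + 5 * K + 3 * n)
turnstile-size≤ ks K n w = ≤-trans
  (+-mono-≤ (+-mono-≤ (+-mono-≤ (+-monoˡ-≤ (((K + ks) * c + (K + ks) * c) + (K + ks) * c) (+-monoʳ-≤ (ks * c)
      (≤-trans (≤-reflexive (l1 ks (suc w)))
        (+-mono-≤ (≤-trans (≤-reflexive (sym (*-identityʳ ks))) (*-monoʳ-≤ ks (s≤s z≤n))) (*-monoʳ-≤ (ks * ks) y≤)))))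
      (*-monoʳ-≤ n y≤)) (*-monoʳ-≤ n y≤)) (*-monoʳ-≤ (2 * (K + ks) + n) y≤))
  (≤-reflexive (l2 ks K n c))
  where
  c = suc (w + w)
  y≤ : suc w ≤ c
  y≤ = s≤s (m≤m+n w w)
  l1 : ∀ s y → s * suc (s * y) ≡ s + s * s * y
  l1 = solve-∀
  l2 : ∀ s K n c → ((s * c + (s * c + s * s * c)) + (((K + s) * c + (K + s) * c) + (K + s) * c)) + n * c + n * c + (2 * (K + s) + n) * c
       ≡ c * (s * s + 7 * s + 5 * K + 3 * n)
  l2 = solve-∀

-- The distance table contributes `ks * ks` and the lists of pairs contribute `K`, both of order
-- `V / (h * h)`. The remaining terms are absorbed by `h ≤ n` and `h * h ≤ n`.
turnstile-cells : ∀ n L h ks K V → h ≤ n → h * h ≤ n → n * L * (n * L) ≤ V → n * n ≤ V → n * L * n ≤ V →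
  ks * h ≤ 10 * (n * L) → K * (h * h) ≤ 25 * V → (ks * ks + 7 * ks + 5 * K + 3 * n) * (h * h) ≤ 298 * V
turnstile-cells n L h ks K V h≤n h²≤n v₁ v₂ v₃ ks*h≤ K*h²≤ = begin
  (ks * ks + 7 * ks + 5 * K + 3 * n) * (h * h)
    ≡⟨ l1 ks K n h ⟩
  ks * h * (ks * h) + 7 * (ks * h * h) + 5 * (K * (h * h)) + 3 * (n * (h * h))
    ≤⟨ +-mono-≤ (+-mono-≤ (+-mono-≤ (*-mono-≤ ks*h≤ ks*h≤) (*-monoʳ-≤ 7 (*-mono-≤ ks*h≤ h≤n))) (*-monoʳ-≤ 5 K*h²≤)) (*-monoʳ-≤ 3 (*-monoʳ-≤ n h²≤n)) ⟩
  10 * (n * L) * (10 * (n * L)) + 7 * (10 * (n * L) * n) + 5 * (25 * V) + 3 * (n * n)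
    ≡⟨ l2 n (n * L) V ⟩
  100 * (n * L * (n * L)) + 70 * (n * L * n) + 125 * V + 3 * (n * n)
    ≤⟨ +-mono-≤ (+-monoˡ-≤ (125 * V) (+-mono-≤ (*-monoʳ-≤ 100 v₁) (*-monoʳ-≤ 70 v₃))) (*-monoʳ-≤ 3 v₂) ⟩
  100 * V + 70 * V + 125 * V + 3 * V
    ≡⟨ l3 V ⟩
  298 * V ∎
  where
  open ≤-Reasoning
  l1 : ∀ s K n h → (s * s + 7 * s + 5 * K + 3 * n) * (h * h) ≡ s * h * (s * h) + 7 * (s * h * h) + 5 * (K * (h * h)) + 3 * (n * (h * h))
  l1 = solve-∀
  l2 : ∀ n a V → 10 * a * (10 * a) + 7 * (10 * a * n) + 5 * (25 * V) + 3 * (n * n) ≡ 100 * (a * a) + 70 * (a * n) + 125 * V + 3 * (n * n)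
  l2 = solve-∀
  l3 : ∀ V → 100 * V + 70 * V + 125 * V + 3 * V ≡ 298 * V
  l3 = solve-∀

-- `c` is the size of a cell and `Z` the number of cells. One factor `L` comes from the cell and two
-- from the square of `p`; with the two inside `V` this makes the exponent 5 of the logarithm.
space-bound : ∀ a b d S c Z V L h p → S ≤ c * Z → c ≤ a * L → Z * (h * h) ≤ b * V → p ≤ d * L * h →
              S * p ^ 2 ≤ a * b * (d * d) * (V * (L * (L * L)))
space-bound a b d S c Z V L h p S≤ c≤ Z≤ p≤ = begin
  S * p ^ 2                                ≤⟨ *-mono-≤ S≤ (^-monoˡ-≤ 2 p≤) ⟩
  c * Z * (d * L * h) ^ 2                  ≡⟨ l1 c Z d L h ⟩
  c * (Z * (h * h)) * (d * d * (L * L))    ≤⟨ *-monoˡ-≤ (d * d * (L * L)) (*-mono-≤ c≤ Z≤) ⟩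
  a * L * (b * V) * (d * d * (L * L))      ≡⟨ l2 a b (d * d) V L ⟩
  a * b * (d * d) * (V * (L * (L * L)))    ∎
  where
  open ≤-Reasoning
  l1 : ∀ c Z d L h → c * Z * (d * L * h * (d * L * h * 1)) ≡ c * (Z * (h * h)) * (d * d * (L * L))
  l1 = solve-∀
  l2 : ∀ a b d V L → a * L * (b * V) * (d * (L * L)) ≡ a * b * d * (V * (L * (L * L)))
  l2 = solve-∀

load-cells : ∀ q L n y → q * y ≤ 3 * n → y ≤ n → n ≤ n * L → ((q * (3 * L) + 3 * L) * (2 * n) + n) * y ≤ 25 * (n * L * n)
load-cells q L n y qy≤ y≤n n≤nL = begin
  ((q * (3 * L) + 3 * L) * (2 * n) + n) * y            ≡⟨ l1 q L n y ⟩
  6 * L * n * (q * y + y) + n * y                      ≤⟨ +-mono-≤ (*-monoʳ-≤ (6 * L * n) (+-mono-≤ qy≤ y≤n)) (*-monoʳ-≤ n (≤-trans y≤n n≤nL)) ⟩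
  6 * L * n * (3 * n + n) + n * (n * L)                ≡⟨ l2 n L ⟩
  25 * (n * L * n)                                     ∎
  where
  open ≤-Reasoning
  l1 : ∀ q L n y → ((q * (3 * L) + 3 * L) * (2 * n) + n) * y ≡ 6 * L * n * (q * y + y) + n * y
  l1 = solve-∀
  l2 : ∀ n L → 6 * L * n * (3 * n + n) + n * (n * L) ≡ 25 * (n * L * n)
  l2 = solve-∀

source-cells : ∀ h q L n → q * (h * h) ≤ 3 * n → h ≤ n * L → suc (h * q * (3 * L)) * h ≤ 10 * (n * L)
source-cells h q L n qh²≤ h≤ = begin
  h + h * q * (3 * L) * h                    ≡⟨ cong (h +_) (l1 h q L) ⟩
  h + q * (h * h) * (3 * L)                  ≤⟨ +-mono-≤ h≤ (*-monoˡ-≤ (3 * L) qh²≤) ⟩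
  n * L + 3 * n * (3 * L)                    ≡⟨ l2 n L ⟩
  10 * (n * L)                               ∎
  where
  open ≤-Reasoning
  l1 : ∀ h q L → h * q * (3 * L) * h ≡ q * (h * h) * (3 * L)
  l1 = solve-∀
  l2 : ∀ n L → n * L + 3 * n * (3 * L) ≡ 10 * (n * L)
  l2 = solve-∀

-- The count is at most `9 * L * h`, rounded up to the factor 10 that also appears in the threshold
-- `10 * lg n` on `p`.
turnstile-passes : ∀ L h → 1 ≤ L → 1 ≤ h → 2 * h * suc L + (h * (L + 2) + suc L) ≤ 10 * L * h
turnstile-passes L h 1≤L 1≤h = begin
  2 * h * suc L + (h * (L + 2) + suc L)                ≡⟨ l1 L h ⟩
  3 * (h * L) + 4 * (h * 1) + 1 * L + 1 * 1
    ≤⟨ +-mono-≤ (+-mono-≤ (+-monoʳ-≤ (3 * (h * L)) (*-monoʳ-≤ 4 (*-monoʳ-≤ h 1≤L))) (*-monoˡ-≤ L 1≤h)) (*-mono-≤ 1≤h 1≤L) ⟩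
  3 * (h * L) + 4 * (h * L) + h * L + h * L            ≤⟨ m≤m+n _ (h * L) ⟩
  3 * (h * L) + 4 * (h * L) + h * L + h * L + h * L    ≡⟨ l2 L h ⟩
  10 * L * h                                           ∎
  where
  open ≤-Reasoning
  l1 : ∀ L h → 2 * h * suc L + (h * (L + 2) + suc L) ≡ 3 * (h * L) + 4 * (h * 1) + 1 * L + 1 * 1
  l1 = solve-∀
  l2 : ∀ L h → 3 * (h * L) + 4 * (h * L) + h * L + h * L + h * L ≡ 10 * L * h
  l2 = solve-∀

n<2^n : ∀ m → m < 2 ^ m
n<2^n zero    = s≤s z≤n
n<2^n (suc m) = ≤-trans (+-mono-≤ (m^n>0 2 m) (n<2^n m)) (≤-reflexive (cong (2 ^ m +_) (sym (+-identityʳ (2 ^ m)))))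

-- Abstract, because unfolding a multiplication by such a constant is expensive.
abstract
  C₁ : ℕ
  C₁ = 13 * 298 * (20 * 20)

  C₁≡ : 13 * 298 * (20 * 20) ≡ C₁
  C₁≡ = refl

  3900≤C₁ : 39 * 100 ≤ C₁
  3900≤C₁ = ≤ᵇ⇒≤ _ _ tt

-- The turnstile algorithm for given parameters

module Turnstile (n p L w e q′ : ℕ) where

  open Seeds n L e q′ using (k; ℓ; M; decode; h) renaming (module Bad to SeedsBad)

  -- One source is added for the root, and `K` is the load guaranteed for a good seed. A pass asks
  -- at most two queries per candidate, or one per vertex.
  ks K cap : ℕ
  ks  = suc k
  K   = M * (2 * n) + n
  cap = 2 * (K + ks) + n

  open Sampled n L ks using (program; initial; length-program; State) renaming (module Correct to SampledCorrect)

  pairsC : Codec Pairs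
  pairsC = listC (K + ks) (natC w ×C natC w)

  numsC : Codec (List ℕ)
  numsC = listC n (natC w)

  memC : Codec ((State × List ℕ) × List ℕ)
  memC = (((listC ks (natC w ×C natC w) ×C listC ks (listC ks (natC w))) ×C ((pairsC ×C pairsC) ×C pairsC)) ×C numsC) ×C numsC

  module C = Compile n w cap memC

  init : Pairs → Fin n → (State × List ℕ) × List ℕ
  init ss r = initial ((toℕ r , 0) ∷ ss) (toℕ r)

  out : (State × List ℕ) × List ℕ → Fin n → Maybe (Fin n)
  out ((_ , est) , lo) = parentFrom est lo

  rand : RandAlg (Upd n) n p (size C.stateC) (k * ℓ)
  rand = C.randAlg p (program h) init out (k * ℓ) (samples decode k)

  module Correct (L′ : ℕ) (L≡ : L ≡ suc L′) (3≤n : 3 ≤ n) (n<2^L : n < 2 ^ L) (L≤w : L ≤ w) (n²<2^w : n * n < 2 ^ w)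
                 (h≤n : h ≤ n) (enough : 2 ^ L ≤ q′ * (h * h)) (ks≤2^w : ks ≤ 2 ^ w) (passes : length (program h) ≤ p) where

    2≤n : 2 ≤ n
    2≤n = ≤-trans (s≤s (s≤s z≤n)) 3≤n

    2^e≤2^w : h ≤ 2 ^ w
    2^e≤2^w = ≤-trans h≤n (≤-trans (<⇒≤ n<2^L) (^-monoʳ-≤ 2 L≤w))

    trees : ∀ r σ → SimpleFinal σ → Connected (Adj σ) →
            SuccessProb (λ seed → IsBFSTree (Adj σ) r (runRand rand seed r σ)) n 1 1
    trees r σ simple conn = success _ B.badness tree B.few-bad
      where
      G = StreamGraph.graph σ simple conn
      r<n = Fin.toℕ<n r
      module B = SeedsBad G (toℕ r) r<n 3≤n n<2^L h≤n enough
      tree : ∀ s → B.badness s ≡ 0 → IsBFSTree (Adj σ) r (runRand rand s r σ)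
      tree s good = parentFrom-correct σ simple conn r (proj₂ (proj₁ (proj₁ final))) (proj₂ (proj₁ final))
          (proj₂ (proj₂ final)) (proj₂ (proj₁ (proj₂ final)))
        where
        module Gd = B.Good s good
        bounded : All (λ (t , δ) → t < 2 ^ w × δ < h) (samples decode k s)
        bounded = samples-All decode (λ ω → <-≤-trans (val< (Vec.take L ω)) (^-monoʳ-≤ 2 L≤w) , val< (Vec.drop L ω)) k s
        srcs-ok : All (λ (t , δ) → t < 2 ^ w × δ < 2 ^ w) Gd.srcs
        srcs-ok = (<-≤-trans r<n (≤-trans (<⇒≤ n<2^L) (^-monoʳ-≤ 2 L≤w)) , m^n>0 2 w)
                ∷ All.map (λ (a , b) → a , <-≤-trans b 2^e≤2^w) bounded
        module S = SampledCorrect G 2≤n L′ L≡ n<2^L w cap K L≤w ks≤2^w (m≤m+n (2 * (K + ks)) n) (m≤n+m n (2 * (K + ks)))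
                     (toℕ r) r<n Gd.srcs (cong suc (length-samples decode k s)) srcs-ok h Gd.load
        delays : ∀ {i} → i < ks → S.δ i ≤ h
        delays {i} i< = All-nth (0 , 0) {xs = Gd.srcs} (z≤n ∷ All.map (λ (_ , b) → <⇒≤ b) bounded)
          (subst (i <_) (sym (cong suc (length-samples decode k s))) i<)
        module Rc = S.Recover refl (s≤s z≤n) delays (λ v v<n far-v → Gd.hits v v<n far-v)
        final = C.rand-correct p (program h) init out n²<2^w passes σ simple (k * ℓ) (samples decode k) s r {Q = S.F.Result}
          (λ m → proj₁) Rc.program-correct

    space : 1 ≤ L → h * h ≤ n → q′ * (h * h) ≤ 3 * n → suc (w + w) ≤ 13 * L → p ≤ 20 * L * h →
            size C.stateC * p ^ 2 ≤ C₁ * (n * n * L ^ 5)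
    space 1≤L h²≤n q′h²≤ c≤ p≤ = subst₂ (λ c y → size C.stateC * p ^ 2 ≤ c * y) C₁≡ V≡
      (space-bound 13 298 20 (size C.stateC) (suc (w + w)) (ks * ks + 7 * ks + 5 * K + 3 * n) V L h p (turnstile-size≤ ks K n w) c≤ cells p≤)
      where
      V : ℕ
      V = n * n * L ^ 2
      l1 : ∀ n L → n * L * (n * L) ≡ n * n * (L * (L * 1))
      l1 = solve-∀
      l2 : ∀ n L → n * (n * L) ≡ n * L * n
      l2 = solve-∀
      l3 : ∀ y L → y * (L * (L * 1)) * (L * (L * L)) ≡ y * (L * (L * (L * (L * (L * 1)))))
      l3 = solve-∀
      V≡ : V * (L * (L * L)) ≡ n * n * L ^ 5
      V≡ = l3 (n * n) L
      n≤nL : n ≤ n * L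
      n≤nL = ≤-trans (≤-reflexive (sym (*-identityʳ n))) (*-monoʳ-≤ n 1≤L)
      v₁ : n * L * (n * L) ≤ V
      v₁ = ≤-reflexive (l1 n L)
      v₃ : n * L * n ≤ V
      v₃ = ≤-trans (*-monoʳ-≤ (n * L) n≤nL) v₁
      v₂ : n * n ≤ V
      v₂ = ≤-trans (*-monoˡ-≤ n n≤nL) v₃
      cells : (ks * ks + 7 * ks + 5 * K + 3 * n) * (h * h) ≤ 298 * V
      cells = turnstile-cells n L h ks K V h≤n h²≤n v₁ v₂ v₃
        (source-cells h q′ L n q′h²≤ (≤-trans h≤n n≤nL))
        (≤-trans (load-cells q′ L n (h * h) q′h²≤ h²≤n n≤nL) (*-monoʳ-≤ 25 v₃))

-- Many passes: 10 * lg n ≤ p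

module Many (n p : ℕ) where

  L w : ℕ
  L = lg n
  w = width n

  private
    instance
      nz : NonZero (10 * L)
      nz = m*n≢0 10 L

  x : ℕ
  x = p / (10 * L)

  module Facts (3≤n : 3 ≤ n) (p²≤n : p * p ≤ n) (big : 10 * L ≤ p) where

    1≤n : 1 ≤ n
    1≤n = ≤-trans (s≤s z≤n) 3≤n

    2≤n : 2 ≤ n
    2≤n = ≤-trans (s≤s (s≤s z≤n)) 3≤n

    1≤x : 1 ≤ x
    1≤x = m≥n⇒m/n>0 big

    x*≤p : 10 * L * x ≤ p
    x*≤p = ≤-trans (≤-reflexive (*-comm (10 * L) x)) (m/n*n≤m p (10 * L))

    p≤ : p ≤ 10 * L * suc x
    p≤ = begin
      p                                        ≡⟨ m≡m%n+[m/n]*n p (10 * L) ⟩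
      p % (10 * L) + x * (10 * L)              ≤⟨ +-monoˡ-≤ (x * (10 * L)) (<⇒≤ (m%n<n p (10 * L))) ⟩
      suc x * (10 * L)                         ≡⟨ *-comm (suc x) (10 * L) ⟩
      10 * L * suc x                           ∎
      where open ≤-Reasoning

    x≤p : x ≤ p
    x≤p = ≤-trans (≤-trans (≤-reflexive (sym (+-identityʳ x))) (*-monoˡ-≤ x {1} {10 * L} (s≤s z≤n))) x*≤p

    p≤n : p ≤ n
    p≤n = ≤-trans (≤-trans (≤-reflexive (sym (*-identityʳ p))) (*-monoʳ-≤ p (≤-trans (s≤s z≤n) big))) p²≤n

  module Insertion where

    d : ℕ
    d = (3 * n) / suc x

    open LowDegree n L d using (program; initial; length-program) renaming (module Correct to LowCorrect)

    cap : ℕ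
    cap = 2 * (n * d + n)

    pairsC : Codec Pairs
    pairsC = listC (n * d + n) (natC w ×C natC w)

    numsC : Codec (List ℕ)
    numsC = listC n (natC w)

    memC : Codec ((((Pairs × Pairs) × Pairs) × List ℕ) × List ℕ)
    memC = (((pairsC ×C pairsC) ×C pairsC) ×C numsC) ×C numsC

    module C = Compile n w cap memC

    init : ⊤ → Fin n → (((Pairs × Pairs) × Pairs) × List ℕ) × List ℕ
    init _ r = initial (toℕ r)

    out : (((Pairs × Pairs) × Pairs) × List ℕ) × List ℕ → Fin n → Maybe (Fin n)
    out ((_ , est) , lo) = parentFrom est lo

    det : DetAlg (Fin n × Fin n) n p (size C.stateC)
    det = C.detAlg p (program x) init out tt

    module _ (3≤n : 3 ≤ n) (p²≤n : p * p ≤ n) (big : 10 * L ≤ p) where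
      open Facts 3≤n p²≤n big

      enough : 3 * n < suc x * suc d
      enough = begin-strict
        3 * n                                ≡⟨ m≡m%n+[m/n]*n (3 * n) (suc x) ⟩
        (3 * n) % suc x + d * suc x          <⟨ +-monoˡ-< (d * suc x) (m%n<n (3 * n) (suc x)) ⟩
        suc d * suc x                        ≡⟨ *-comm (suc d) (suc x) ⟩
        suc x * suc d                        ∎
        where open ≤-Reasoning

      passes : length (program x) ≤ p
      passes = begin
        length (program x)                        ≡⟨ length-program x ⟩
        suc L + (x * (L + 2) + suc L)             ≡⟨ l1 L x ⟩
        x * L + 2 * (x * 1) + 2 * (1 * L) + 2 * (1 * 1)
          ≤⟨ +-mono-≤ (+-mono-≤ (+-monoʳ-≤ (x * L) (*-monoʳ-≤ 2 (*-monoʳ-≤ x {1} {L} (s≤s z≤n)))) (*-monoʳ-≤ 2 (*-monoˡ-≤ L 1≤x)))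
               (*-monoʳ-≤ 2 (*-mono-≤ 1≤x (s≤s z≤n))) ⟩
        x * L + 2 * (x * L) + 2 * (x * L) + 2 * (x * L)     ≤⟨ m≤m+n _ (3 * (x * L)) ⟩
        x * L + 2 * (x * L) + 2 * (x * L) + 2 * (x * L) + 3 * (x * L) ≡⟨ l2 L x ⟩
        10 * L * x                                ≤⟨ x*≤p ⟩
        p                                         ∎
        where
        open ≤-Reasoning
        l1 : ∀ L x → suc L + (x * (L + 2) + suc L) ≡ x * L + 2 * (x * 1) + 2 * (1 * L) + 2 * (1 * 1)
        l1 = solve-∀
        l2 : ∀ L x → x * L + 2 * (x * L) + 2 * (x * L) + 2 * (x * L) + 3 * (x * L) ≡ 10 * L * x
        l2 = solve-∀

      tree : ∀ σ → SimpleFinal (insOnly σ) → Connected (Adj (insOnly σ)) → ∀ r →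
             IsBFSTree (Adj (insOnly σ)) r (runDet det r σ)
      tree σ simple conn r =
        parentFrom-correct (insOnly σ) simple conn r (proj₂ (proj₁ (proj₁ final))) (proj₂ (proj₁ final))
          (proj₂ (proj₂ final)) (proj₂ (proj₁ (proj₂ final)))
        where
        module K = LowCorrect (StreamGraph.graph (insOnly σ) simple conn) 2≤n ⌊log₂ n ⌋ refl (n<2^lg 1≤n) w cap
                     (lg≤width n) ≤-refl (toℕ r) (Fin.toℕ<n r)
        final = C.det-correct p (program x) init out (n²<2^width 1≤n) passes σ simple tt r {Q = K.F.Result}
          (λ m → proj₁) (K.program-correct x enough)

      space : size C.stateC * p ≤ 2041 * budget n 2
      space = begin
        size C.stateC * p                               ≤⟨ *-monoˡ-≤ p size≤ ⟩
        cell n * (5 * (n * d) + 7 * n) * p              ≡⟨ l2 (cell n) (n * d) n p ⟩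
        cell n * (5 * (n * d * p) + 7 * (n * p))        ≤⟨ *-mono-≤ (cell≤ n) (+-mono-≤ (*-monoʳ-≤ 5 ndp) (*-monoʳ-≤ 7 np)) ⟩
        13 * L * (5 * (30 * budget n 1) + 7 * budget n 1) ≡⟨ l3 (n * n) L ⟩
        2041 * budget n 2                               ∎
        where
        open ≤-Reasoning
        l1 : ∀ D n c → ((D + n) * c + (D + n) * c) + (D + n) * c + n * c + n * c + 2 * (D + n) * c ≡ c * (5 * D + 7 * n)
        l1 = solve-∀
        l2 : ∀ c D n p → c * (5 * D + 7 * n) * p ≡ c * (5 * (D * p) + 7 * (n * p))
        l2 = solve-∀
        l3 : ∀ a L → 13 * L * (5 * (30 * (a * (L * 1))) + 7 * (a * (L * 1))) ≡ 2041 * (a * (L * (L * 1)))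
        l3 = solve-∀
        y≤ : suc w ≤ cell n
        y≤ = width<cell n
        size≤ : size C.stateC ≤ cell n * (5 * (n * d) + 7 * n)
        size≤ = ≤-trans (+-mono-≤ (+-mono-≤ (+-monoʳ-≤ (((n * d + n) * cell n + (n * d + n) * cell n) + (n * d + n) * cell n)
            (*-monoʳ-≤ n y≤)) (*-monoʳ-≤ n y≤)) (*-monoʳ-≤ cap y≤)) (≤-reflexive (l1 (n * d) n (cell n)))
        np : n * p ≤ budget n 1
        np = ≤-trans (*-monoʳ-≤ n p≤n) (≤-trans (≤-reflexive (sym (*-identityʳ (n * n)))) (budget-mono n {0} {1} z≤n))
        ndp : n * d * p ≤ 30 * budget n 1
        ndp = begin
          n * d * p                         ≤⟨ *-monoʳ-≤ (n * d) p≤ ⟩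
          n * d * (10 * L * suc x)          ≡⟨ k1 n d L (suc x) ⟩
          n * (10 * L) * (d * suc x)        ≤⟨ *-monoʳ-≤ (n * (10 * L)) (m/n*n≤m (3 * n) (suc x)) ⟩
          n * (10 * L) * (3 * n)            ≡⟨ k2 n L ⟩
          30 * budget n 1                   ∎
          where
          k1 : ∀ n d L y → n * d * (10 * L * y) ≡ n * (10 * L) * (d * y)
          k1 = solve-∀
          k2 : ∀ n L → n * (10 * L) * (3 * n) ≡ 30 * (n * n * (L * 1))
          k2 = solve-∀

  module Sampling where

    -- Rounding `x` down to a power of two makes a delay exactly `e` random bits; the factor lost is
    -- the 2 that turns 10 into 20 in `p≤20Lh`.
    e h : ℕ
    e = ⌊log₂ x ⌋
    h = 2 ^ e

    private
      instance
        nz-h² : NonZero (h * h)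
        nz-h² = m*n≢0 h h {{m^n≢0 2 e}} {{m^n≢0 2 e}}

    -- The added 1 makes `q′ * (h * h)` reach `2 ^ L`; because `h * h ≤ n` and `2 ^ L ≤ 2 * n`, the
    -- product stays at most `3 * n`.
    q′ : ℕ
    q′ = suc (2 ^ L / (h * h))

    module T = Turnstile n p L w e q′

    module _ (3≤n : 3 ≤ n) (p²≤n : p * p ≤ n) (big : 10 * L ≤ p) where
      open Facts 3≤n p²≤n big

      1≤h : 1 ≤ h
      1≤h = m^n>0 2 e

      h≤x : h ≤ x
      h≤x = proj₁ (log-bounds x 1≤x)

      p≤20Lh : p ≤ 20 * L * h
      p≤20Lh = ≤-trans p≤ (≤-trans (*-monoʳ-≤ (10 * L) (proj₂ (log-bounds x 1≤x))) (≤-reflexive (lem L h)))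
        where
        lem : ∀ L h → 10 * L * (2 * h) ≡ 20 * L * h
        lem = solve-∀

      h²≤n : h * h ≤ n
      h²≤n = ≤-trans (*-mono-≤ (≤-trans h≤x x≤p) (≤-trans h≤x x≤p)) p²≤n

      h≤n : h ≤ n
      h≤n = ≤-trans (≤-trans h≤x x≤p) p≤n

      enough : 2 ^ L ≤ q′ * (h * h)
      enough = begin
        2 ^ L                                                ≡⟨ m≡m%n+[m/n]*n (2 ^ L) (h * h) ⟩
        2 ^ L % (h * h) + 2 ^ L / (h * h) * (h * h)          ≤⟨ +-monoˡ-≤ (2 ^ L / (h * h) * (h * h)) (<⇒≤ (m%n<n (2 ^ L) (h * h))) ⟩
        q′ * (h * h)                                         ∎
        where open ≤-Reasoning

      q′h²≤ : q′ * (h * h) ≤ 3 * n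
      q′h²≤ = ≤-trans (+-mono-≤ h²≤n (≤-trans (m/n*n≤m (2 ^ L) (h * h)) (2^lg≤2n 1≤n))) (≤-reflexive (lem n))
        where
        lem : ∀ n → n + 2 * n ≡ 3 * n
        lem = solve-∀

      n≤nL : n ≤ n * L
      n≤nL = m≤m*n n L

      ks*h≤ : T.ks * h ≤ 10 * (n * L)
      ks*h≤ = source-cells h q′ L n q′h²≤ (≤-trans h≤n n≤nL)

      ks≤2^w : T.ks ≤ 2 ^ w
      ks≤2^w = begin
        T.ks                        ≤⟨ m≤m*n T.ks h {{m^n≢0 2 e}} ⟩
        T.ks * h                    ≤⟨ ks*h≤ ⟩
        10 * (n * L)                ≤⟨ *-mono-≤ {10} {16} (m≤m+n 10 6) (*-mono-≤ (<⇒≤ (n<2^lg 1≤n)) (<⇒≤ (n<2^n L))) ⟩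
        16 * (2 ^ L * 2 ^ L)        ≡⟨ trans (*-comm 16 (2 ^ L * 2 ^ L)) (sym (2^width n)) ⟩
        2 ^ w                       ∎
        where open ≤-Reasoning

      passes : length (Sampled.program n L T.ks h) ≤ p
      passes = ≤-trans (≤-reflexive (Sampled.length-program n L T.ks h))
        (≤-trans (turnstile-passes L h (s≤s z≤n) 1≤h) (≤-trans (*-monoʳ-≤ (10 * L) h≤x) x*≤p))

      module TC = T.Correct ⌊log₂ n ⌋ refl 3≤n (n<2^lg 1≤n) (lg≤width n) (n²<2^width 1≤n) h≤n enough ks≤2^w passes

      space : size T.C.stateC * p ^ 2 ≤ C₁ * budget n 5
      space = TC.space (s≤s z≤n) h²≤n q′h²≤ (cell≤ n) p≤20Lh

-- Choice between few and many passes

-- The decision is an argument, so that a correctness proof can match on it and the chosen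
-- algorithm, with its sizes, reduces.
randChoice : ∀ n p → Dec (10 * lg n ≤ p) → Σ ℕ λ S → Σ ℕ λ R → RandAlg (Upd n) n p S R
randChoice n p (yes _) = _ , _ , Many.Sampling.T.rand n p
randChoice n p (no _)  = _ , _ , Few.rand n p

detChoice : ∀ n p → Dec (10 * lg n ≤ p) → Σ ℕ λ S → DetAlg (Fin n × Fin n) n p S
detChoice n p (yes _) = _ , Many.Insertion.det n p
detChoice n p (no _)  = _ , Few.det n p

C₂ : ℕ
C₂ = 2041

randChoice-correct : ∀ n p (d : Dec (10 * lg n ≤ p)) → 3 ≤ n → 1 ≤ p → p * p ≤ n →
  let S , R , A = randChoice n p d in
  (S * p ^ 2 ≤ C₁ * n ^ 2 * polylog n 5)
  × (∀ (r : Fin n) (σ : List (Upd n)) → SimpleFinal σ → Connected (Adj σ) →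
       SuccessProb (λ seed → IsBFSTree (Adj σ) r (runRand A seed r σ)) n 1 1)
randChoice-correct n p (yes big) 3≤n 1≤p p²≤n =
  ≤-trans (Many.Sampling.space n p 3≤n p²≤n big) (≤-reflexive (budget-polylog n C₁ 5)) ,
  Many.Sampling.TC.trees n p 3≤n p²≤n big
randChoice-correct n p (no small) 3≤n 1≤p p²≤n =
  ≤-trans (Few.space-rand n p 3≤n (<⇒≤ (≰⇒> small))) (≤-trans (*-mono-≤ 3900≤C₁ (budget-mono n {3} {5} (≤ᵇ⇒≤ _ _ tt)))
    (≤-reflexive (budget-polylog n C₁ 5))) ,
  Few.rand-success n p 3≤n 1≤p

detChoice-correct : ∀ n p (d : Dec (10 * lg n ≤ p)) → 3 ≤ n → 1 ≤ p → p * p ≤ n →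
  let S , A = detChoice n p d in
  (S * p ≤ C₂ * n ^ 2 * polylog n 2)
  × (∀ (r : Fin n) (σ : List (Fin n × Fin n)) → SimpleFinal (insOnly σ) → Connected (Adj (insOnly σ)) →
       IsBFSTree (Adj (insOnly σ)) r (runDet A r σ))
detChoice-correct n p (yes big) 3≤n 1≤p p²≤n =
  ≤-trans (Many.Insertion.space n p 3≤n p²≤n big) (≤-reflexive (budget-polylog n C₂ 2)) ,
  λ r σ simple conn → Many.Insertion.tree n p 3≤n p²≤n big σ simple conn r
detChoice-correct n p (no small) 3≤n 1≤p p²≤n =
  ≤-trans (Few.space-det n p 3≤n (<⇒≤ (≰⇒> small))) (≤-trans (*-monoˡ-≤ (budget n 2) {390} {C₂} (≤ᵇ⇒≤ _ _ tt))
    (≤-reflexive (budget-polylog n C₂ 2))) ,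
  Few.det-tree n p 3≤n 1≤p

theorem3 : (∃[ n₀ ] ∃[ C ] ∃[ k ] ∃[ a ] ∃[ b ] (1 ≤ a) × (1 ≤ b) ×
    Σ (ℕ → ℕ → ℕ) (λ S → Σ (ℕ → ℕ → ℕ) (λ R →
    Σ ((n p : ℕ) → RandAlg (Upd n) n p (S n p) (R n p)) (λ Alg →
    ∀ (n p : ℕ) → n₀ ≤ n → 1 ≤ p → p * p ≤ n →
    (S n p * p ^ 2 ≤ C * n ^ 2 * polylog n k)
    × (∀ (r : Fin n) (σ : List (Upd n)) → SimpleFinal σ → Connected (Adj σ) →
    SuccessProb (λ seed → IsBFSTree (Adj σ) r (runRand (Alg n p) seed r σ)) n a b)))))
    ×
    (∃[ n₀ ] ∃[ C ] ∃[ k ] Σ (ℕ → ℕ → ℕ) (λ S →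
    Σ ((n p : ℕ) → DetAlg (Fin n × Fin n) n p (S n p)) (λ Alg →
    ∀ (n p : ℕ) → n₀ ≤ n → 1 ≤ p → p * p ≤ n →
    (S n p * p ≤ C * n ^ 2 * polylog n k)
    × (∀ (r : Fin n) (σ : List (Fin n × Fin n)) →
    SimpleFinal (insOnly σ) → Connected (Adj (insOnly σ)) →
    IsBFSTree (Adj (insOnly σ)) r (runDet (Alg n p) r σ)))))
theorem3 =
  (3 , C₁ , 5 , 1 , 1 , s≤s z≤n , s≤s z≤n ,
    (λ n p → proj₁ (rc n p)) , (λ n p → proj₁ (proj₂ (rc n p))) , (λ n p → proj₂ (proj₂ (rc n p))) ,
    λ n p → randChoice-correct n p (10 * lg n ≤? p)) ,
  (3 , C₂ , 2 , (λ n p → proj₁ (dc n p)) , (λ n p → proj₂ (dc n p)) ,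
    λ n p → detChoice-correct n p (10 * lg n ≤? p))
  where
  rc : ∀ n p → Σ ℕ λ S → Σ ℕ λ R → RandAlg (Upd n) n p S R
  rc n p = randChoice n p (10 * lg n ≤? p)
  dc : ∀ n p → Σ ℕ λ S → DetAlg (Fin n × Fin n) n p S
  dc n p = detChoice n p (10 * lg n ≤? p)
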